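{- There exists an infinite sequence of trees $(T_k)_{k\in\mathbb{N}}$ such that $\lim_{k\to\infty} n(T_k)=\lim_{k\to\infty} m(T_k)=\infty$ and $f(T_k)\geq 0.3$ for all $k\in\mathbb{N}$, where $$f(T)=\left|\frac{p_A(T)}{m(T)}-\left(1-\frac{p_D(T)}{n(T)}\right)\right|.$$
   Context: Let $T$ be a tree on $N$ vertices with adjacency matrix $A(T)$ and distance matrix $D(T)$, whose $(i,j)$ entry is the graph distance between vertices $i$ and $j$. Adjacency side. Write the characteristic polynomial of $A(T)$, with zero coefficients omitted, as $CPA(T)=\sum_{i=0}^{m-1} a_i x^{\alpha_i}$, where $\alpha_0<\alpha_1<\dots<\alpha_{m-1}$ and every $a_i\neq 0$. Then $m(T)$ is the number of non-zero coefficients of $CPA(T)$. The peak position $p_A(T)$ is the position, counted from $1$ in order of increasing exponent, of the maximum of the sequence $|a_0|,|a_1|,\dots,|a_{m-1}|$. So if $|a_0|$ is the maximum, then $p_A(T)=1$. Distance side. Write $CPD(T)=\det(D(T)-xI)=\sum_{k=0}^{N}\delta_k x^k$. The normalized coefficients are $d_k=\frac{2^k}{2^{N-2}}|\delta_k|$. The peak $p_D(T)$ is the index $k$ at which the sequence $d_0(T),\dots,d_{N-2}(T)$ attains its maximum. Finally, $n(T)=N+1$ is the number of terms of $CPD(T)$. -}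

module Defs where

open import Data.Bool using (Bool; true; false; if_then_else_; _∧_; _∨_; not)
open import Data.Nat as ℕ using (ℕ; zero; suc; _∸_; _^_; _<ᵇ_; _≤_)
open import Data.Fin as Fin using (Fin; zero; suc; toℕ; punchIn)
open import Data.Fin.Properties using (_≟_)
open import Data.Integer as ℤ using (ℤ; +_; -[1+_])
open import Data.Rational as ℚ using (ℚ)
open import Data.List using (List; []; _∷_; map; upTo)
open import Relation.Nullary using (does)
open import Relation.Binary.PropositionalEquality using (_≡_)
open import Data.Product using (Σ; ∃; _×_)

record Graph (N : ℕ) : Set where
  field
    adj    : Fin N → Fin N → Bool
    sym    : ∀ u v → adj u v ≡ adj v u
    irrefl : ∀ u → adj u u ≡ false
open Graph public

data Walk {N : ℕ} (G : Graph N) : Fin N → Fin N → Set where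
  here : ∀ {u} → Walk G u u
  step : ∀ {u w v} → adj G u w ≡ true → Walk G w v → Walk G u v

Connected : ∀ {N} → Graph N → Set
Connected G = ∀ u v → Walk G u v

sumFin : ∀ {n} → (Fin n → ℕ) → ℕ
sumFin {zero}  f = 0
sumFin {suc n} f = f zero ℕ.+ sumFin (λ i → f (suc i))

anyFin : ∀ {n} → (Fin n → Bool) → Bool
anyFin {zero}  f = false
anyFin {suc n} f = f zero ∨ anyFin (λ i → f (suc i))

edgeCount : ∀ {N} → Graph N → ℕ
edgeCount G = sumFin λ i → sumFin λ j →
  if (toℕ i <ᵇ toℕ j) ∧ adj G i j then 1 else 0

record Tree : Set where
  field
    N       : ℕ
    graph   : Graph N
    nonempty : 1 ≤ N
    connected : Connected graph
    edges   : edgeCount graph ≡ N ∸ 1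
open Tree public

within : ∀ {N} → Graph N → ℕ → Fin N → Fin N → Bool
within G zero    u v = does (u ≟ v)
within G (suc k) u v = within G k u v ∨ anyFin (λ w → adj G u w ∧ within G k w v)

-- least k ≤ b with p k (or b if none)
leastUpTo : ℕ → (ℕ → Bool) → ℕ
leastUpTo zero    p = 0
leastUpTo (suc b) p = if p 0 then 0 else suc (leastUpTo b (λ k → p (suc k)))

-- graph distance (in a connected graph on N vertices it is < N)
dist : ∀ {N} → Graph N → Fin N → Fin N → ℕ
dist {N} G u v = leastUpTo N (λ k → within G k u v)

-- Integer polynomials: coefficient lists, index i = coefficient of x^i

Poly : Set
Poly = List ℤ

addP : Poly → Poly → Poly
addP [] q = q
addP p [] = p
addP (a ∷ p) (b ∷ q) = (a ℤ.+ b) ∷ addP p q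

scaleP : ℤ → Poly → Poly
scaleP c p = map (c ℤ.*_) p

mulP : Poly → Poly → Poly
mulP [] q = []
mulP (a ∷ p) q = addP (scaleP a q) (+ 0 ∷ mulP p q)

coeff : Poly → ℕ → ℤ
coeff []      _       = + 0
coeff (a ∷ p) zero    = a
coeff (a ∷ p) (suc k) = coeff p k

sign : ℕ → ℤ
sign zero = + 1
sign (suc k) = ℤ.- sign k

detP : ∀ n → (Fin n → Fin n → Poly) → Poly
detP zero    M = + 1 ∷ []
detP (suc n) M = go (suc n) (λ j → j)
  where
  go : ∀ r → (Fin r → Fin (suc n)) → Poly
  go zero    col = []
  go (suc r) col = addP
    (scaleP (sign (toℕ (col zero)))
      (mulP (M zero (col zero))
            (detP n (λ i k → M (suc i) (punchIn (col zero) k)))))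
    (go r (λ j → col (suc j)))

δij : ∀ {n} → Fin n → Fin n → ℤ
δij i j = if does (i ≟ j) then + 1 else + 0

Amat : (T : Tree) → Fin (N T) → Fin (N T) → ℤ
Amat T i j = if adj (graph T) i j then + 1 else + 0

Dmat : (T : Tree) → Fin (N T) → Fin (N T) → ℤ
Dmat T i j = + dist (graph T) i j

CPA : Tree → Poly
CPA T = detP (N T) (λ i j → ℤ.- Amat T i j ∷ δij i j ∷ [])

CPD : Tree → Poly
CPD T = detP (N T) (λ i j → Dmat T i j ∷ ℤ.- δij i j ∷ [])

nonzeros : List ℤ → List ℤ
nonzeros [] = []
nonzeros (+ zero ∷ xs) = nonzeros xs
nonzeros (+ suc n ∷ xs) = + suc n ∷ nonzeros xs
nonzeros (-[1+ n ] ∷ xs) = -[1+ n ] ∷ nonzeros xs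

length : ∀ {A : Set} → List A → ℕ
length [] = 0
length (_ ∷ xs) = suc (length xs)

-- 0-based index of the FIRST occurrence of the maximum (0 for empty list)
argmaxℕ : List ℕ → ℕ
argmaxℕ [] = 0
argmaxℕ (x ∷ xs) = go 0 x 1 xs
  where
  go : ℕ → ℕ → ℕ → List ℕ → ℕ
  go bi bv i [] = bi
  go bi bv i (y ∷ ys) = if bv <ᵇ y then go i y (suc i) ys else go bi bv (suc i) ys

argmaxℚ : List ℚ → ℕ
argmaxℚ [] = 0
argmaxℚ (x ∷ xs) = go 0 x 1 xs
  where
  go : ℕ → ℚ → ℕ → List ℚ → ℕ
  go bi bv i [] = bi
  go bi bv i (y ∷ ys) = if not (y ℚ.≤ᵇ bv) then go i y (suc i) ys else go bi bv (suc i) ys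

cpaNonzero : Tree → List ℤ
cpaNonzero T = nonzeros (map (coeff (CPA T)) (upTo (suc (N T))))

mA : Tree → ℕ
mA T = length (cpaNonzero T)

-- 1-based position of the maximum of |a_0|, ..., |a_{m-1}|
pA : Tree → ℕ
pA T = suc (argmaxℕ (map ℤ.∣_∣ (cpaNonzero T)))

-- a / d as a rational (with the harmless convention a / 0 = 0)
frac : ℤ → ℕ → ℚ
frac a zero    = ℚ.0ℚ
frac a (suc d) = a ℚ./ suc d

dcoeff : Tree → ℕ → ℚ
dcoeff T k = frac (+ (2 ^ k ℕ.* ℤ.∣ coeff (CPD T) k ∣)) (2 ^ (N T ∸ 2))

pD : Tree → ℕ
pD T = argmaxℚ (map (dcoeff T) (upTo (suc (N T ∸ 2))))

nD : Tree → ℕ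
nD T = suc (N T)

f : Tree → ℚ
f T = ℚ.∣ frac (+ pA T) (mA T) ℚ.- (ℚ.1ℚ ℚ.- frac (+ pD T) (nD T)) ∣

{-# OPTIONS --safe #-}

-- Take a root with k children ("hubs"), each carrying L = 2k - 1 leaves.
-- The characteristic polynomial of the adjacency matrix is a power of x times (x² - L - k) (x² - L)^(k-1); since L ≥ k its
-- constant coefficient is the largest one, so the adjacency peak is at position 1 among k + 1.
-- With h the depth vector, D - x = h 1ᵀ + 1 hᵀ - K, where K is block diagonal. Eliminating the two rank-one terms
-- gives det (D - x) = c(x) (x + 2)^(k(L-1)) (x² + (4 + 2L) x + 4)^(k-1) with a cubic c. Substituting x = 2t, which accounts
-- for the normalisation 2^k, turns all factors but the cubic into palindromic polynomials with symmetric unimodal coefficients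
-- centred at b, and the cubic moves the peak to b + 2 at most, which is half of the number 2b + 4 of terms.
module Submission where

open import Defs

open import Data.Nat as ℕ using (ℕ; zero; suc)
open import Data.Fin as Fin using (Fin; zero; suc; toℕ; punchIn)
open import Algebra.Bundles using (CommutativeRing)
open import Algebra.Structures using (IsCommutativeRing)
open import Level using (0ℓ)
open import Data.Vec.Functional using (Vector)
open import Relation.Binary.PropositionalEquality using (_≡_; refl; cong; cong₂; trans; module ≡-Reasoning) renaming (sym to ≡-sym)
open import Data.List as List using (List; []; _∷_; _++_; lookup)
open import Data.List.Relation.Unary.All using (All; []; _∷_) renaming (map to mapAll)
open import Data.List.Relation.Unary.All.Properties using (++⁺)
import Algebra.Properties.Ring
import Algebra.Properties.Semiring.Sum
import Algebra.Solver.Ring.NaturalCoefficients.Default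

-- There is no division in the integers, so no step can normalise a pivot. Each elimination instead
-- has the form `μ * det M ≡ c * det M′`, justified by an explicit vector, and the multiplier `μ` is
-- cancelled afterwards. This is done for matrices evaluated at an integer point `x`, because there
-- a multiplier only has to be nonzero for all large `x`; the coefficients are recovered at the end
-- from agreement at all large naturals (`eventually-equal`). On the distance side an upper bound on
-- the peak suffices: with adjacency peak 1, the expression inside the absolute value is at most 1/m
-- + 1/2 - 1, and m at least 5 makes this at most -3/10. The choice L = 2k - 1 also has to be odd:
-- the determinant contains a power of -(x + 2) with exponent k (L - 1), and an even L - 1 removes
-- its sign.

module Determinant {A : Set} {add mul : A → A → A} {neg : A → A} {0ᴬ 1ᴬ : A}
                   (isCommutativeRing : IsCommutativeRing _≡_ add mul neg 0ᴬ 1ᴬ) where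
  open ≡-Reasoning

  -- Determinants over a commutative ring: expansions and column operations

  commutativeRing : CommutativeRing 0ℓ 0ℓ
  commutativeRing = record { isCommutativeRing = isCommutativeRing }

  open CommutativeRing commutativeRing using (_+_; _*_; -_; 0#; 1#; ring; semiring; commutativeSemiring; +-identityˡ; +-identityʳ; +-assoc; +-comm; *-identityˡ; zeroˡ; zeroʳ; -‿inverseʳ)
  open Algebra.Properties.Ring ring using (-1*x≈-x)
  open Algebra.Properties.Semiring.Sum semiring
  open Algebra.Solver.Ring.NaturalCoefficients.Default commutativeSemiring using (solve; _:=_; _:+_; _:*_; con)

  infixr 8 ⊖_
  -- Negation is a product with `- 1#` because the solver used here works in semirings: the factor
  -- `- 1#` is passed to it as one more variable.
  ⊖_ : A → A
  ⊖ a = - 1# * a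

  sgn : ℕ → A
  sgn zero    = 1#
  sgn (suc k) = ⊖ sgn k

  +⊖ : ∀ a → a + ⊖ a ≡ 0#
  +⊖ a = trans (cong (λ z → a + z) (-1*x≈-x a)) (-‿inverseʳ a)

  Matrix : ℕ → ℕ → Set
  Matrix m n = Fin m → Fin n → A

  minor₀ : ∀ {n} → Matrix (suc n) (suc n) → Matrix n n
  minor₀ M i j = M (suc i) (suc j)

  det : ∀ n → Matrix n n → A
  det zero    M = 1#
  det (suc n) M = sum λ j → sgn (toℕ j) * (M zero j * det n (λ i k → M (suc i) (punchIn j k)))

  det-cong : ∀ n {M M′ : Matrix n n} → (∀ i j → M i j ≡ M′ i j) → det n M ≡ det n M′
  det-cong zero    e = refl
  det-cong (suc n) e = sum-cong-≗ λ j →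
    cong (λ z → sgn (toℕ j) * z) (cong₂ _*_ (e zero j) (det-cong n (λ i k → e (suc i) (punchIn j k))))

  sum-zero : ∀ {n} (g : Vector A n) → (∀ i → g i ≡ 0#) → sum g ≡ 0#
  sum-zero {n} g e = trans (sum-cong-≗ e) (sum-replicate-zero n)

  sum-linear : ∀ {n} (r : A) (g h : Vector A n) → sum (λ i → g i + r * h i) ≡ sum g + r * sum h
  sum-linear r g h = trans (∑-distrib-+ g (λ i → r * h i)) (cong (λ z → sum g + z) (≡-sym (*-distribˡ-sum r h)))

  *0* : ∀ a b → a * (0# * b) ≡ 0#
  *0* a b = trans (cong (λ z → a * z) (zeroˡ b)) (zeroʳ a)

  **0 : ∀ a b → a * (b * 0#) ≡ 0#
  **0 a b = trans (cong (λ z → a * z) (zeroʳ b)) (zeroʳ a)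

  -- Both expansions share the corner term. Every other minor of the first row still contains the
  -- first column, so induction expands it there; after the two sums are exchanged, the inner sum is
  -- the row expansion of a minor of the first column.
  det-expand-column : ∀ n (M : Matrix (suc n) (suc n)) →
    det (suc n) M ≡ sum λ i → sgn (toℕ i) * (M i zero * det n (λ i′ k → M (punchIn i i′) (suc k)))
  det-expand-column zero    M = refl
  det-expand-column (suc n) M = cong (λ z → 1# * (M zero zero * det (suc n) (minor₀ M)) + z) (begin
      sum (λ j → ⊖ s j * (M zero (suc j) * det (suc n) (λ i k → M (suc i) (punchIn (suc j) k))))
        ≡⟨ sum-cong-≗ (λ j → cong (λ z → ⊖ s j * (M zero (suc j) * z)) (det-expand-column n (λ i k → M (suc i) (punchIn (suc j) k)))) ⟩
      sum (λ j → ⊖ s j * (M zero (suc j) * sum (λ i → s i * (M (suc i) zero * m i j))))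
        ≡⟨ sum-cong-≗ (λ j → push (⊖ s j) (M zero (suc j)) (λ i → s i * (M (suc i) zero * m i j))) ⟩
      sum (λ j → sum (λ i → ⊖ s j * (M zero (suc j) * (s i * (M (suc i) zero * m i j)))))
        ≡⟨ ∑-comm (λ j i → ⊖ s j * (M zero (suc j) * (s i * (M (suc i) zero * m i j)))) ⟩
      sum (λ i → sum (λ j → ⊖ s j * (M zero (suc j) * (s i * (M (suc i) zero * m i j)))))
        ≡⟨ sum-cong-≗ (λ i → sum-cong-≗ (λ j → rearrange (- 1#) (s j) (M zero (suc j)) (s i) (M (suc i) zero) (m i j))) ⟩
      sum (λ i → sum (λ j → ⊖ s i * (M (suc i) zero * (s j * (M zero (suc j) * m i j)))))
        ≡⟨ sum-cong-≗ (λ i → push (⊖ s i) (M (suc i) zero) (λ j → s j * (M zero (suc j) * m i j))) ⟨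
      sum (λ i → ⊖ s i * (M (suc i) zero * sum (λ j → s j * (M zero (suc j) * m i j)))) ∎)
    where
    s : Fin (suc n) → A
    s i = sgn (toℕ i)
    m : Fin (suc n) → Fin (suc n) → A
    m i j = det n (λ i′ k → M (suc (punchIn i i′)) (suc (punchIn j k)))
    push : ∀ {n} a b (g : Vector A n) → a * (b * sum g) ≡ sum (λ i → a * (b * g i))
    push a b g = trans (cong (λ z → a * z) (*-distribˡ-sum b g)) (*-distribˡ-sum a (λ i → b * g i))
    rearrange : ∀ o a b c d e → (o * a) * (b * (c * (d * e))) ≡ (o * c) * (d * (a * (b * e)))
    rearrange = solve 6 (λ o a b c d e → (o :* a) :* (b :* (c :* (d :* e))) := (o :* c) :* (d :* (a :* (b :* e)))) refl

  infixr 5 _◃_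
  -- Deleting a row acts on each column separately, so a matrix written as columns in front of a
  -- rectangular rest keeps this form in all minors of its first column. Column operations can then
  -- be proved by induction on the size.
  _◃_ : ∀ {m n} → Vector A m → Matrix m n → Matrix m (suc n)
  (a ◃ R) i zero    = a i
  (a ◃ R) i (suc j) = R i j

  det-expand-◃ : ∀ n (a : Vector A (suc n)) (R : Matrix (suc n) n) →
    det (suc n) (a ◃ R) ≡ sum λ i → sgn (toℕ i) * (a i * det n (λ i′ → R (punchIn i i′)))
  det-expand-◃ n a R = det-expand-column n (a ◃ R)

  det-linear₀ : ∀ n r (a b : Vector A (suc n)) (R : Matrix (suc n) n) →
    det (suc n) ((λ i → a i + r * b i) ◃ R) ≡ det (suc n) (a ◃ R) + r * det (suc n) (b ◃ R)
  det-linear₀ n r a b R = begin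
    det (suc n) ((λ i → a i + r * b i) ◃ R)
      ≡⟨ det-expand-◃ n _ R ⟩
    sum (λ i → s i * ((a i + r * b i) * m i))
      ≡⟨ sum-cong-≗ (λ i → distr (s i) (a i) r (b i) (m i)) ⟩
    sum (λ i → s i * (a i * m i) + r * (s i * (b i * m i)))
      ≡⟨ sum-linear r (λ i → s i * (a i * m i)) (λ i → s i * (b i * m i)) ⟩
    sum (λ i → s i * (a i * m i)) + r * sum (λ i → s i * (b i * m i))
      ≡⟨ cong₂ (λ u v → u + r * v) (det-expand-◃ n a R) (det-expand-◃ n b R) ⟨
    det (suc n) (a ◃ R) + r * det (suc n) (b ◃ R) ∎
    where
    s : Fin (suc n) → A
    s i = sgn (toℕ i)
    m : Fin (suc n) → A
    m i = det n (λ i′ → R (punchIn i i′))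
    distr : ∀ s a r b m → s * ((a + r * b) * m) ≡ s * (a * m) + r * (s * (b * m))
    distr = solve 5 (λ s a r b m → s :* ((a :+ r :* b) :* m) := s :* (a :* m) :+ r :* (s :* (b :* m))) refl

  ◃-delete : ∀ {m n} (a : Vector A (suc m)) (R : Matrix (suc m) n) i i′ j →
    (a ◃ R) (punchIn i i′) j ≡ ((λ k → a (punchIn i k)) ◃ (λ k → R (punchIn i k))) i′ j
  ◃-delete a R i i′ zero    = refl
  ◃-delete a R i i′ (suc j) = refl

  det-expand-◃◃ : ∀ n (a b : Vector A (suc (suc n))) (R : Matrix (suc (suc n)) n) →
    det (suc (suc n)) (a ◃ b ◃ R)
      ≡ sum λ i → sgn (toℕ i) * (a i * det (suc n) ((λ k → b (punchIn i k)) ◃ (λ k → R (punchIn i k))))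
  det-expand-◃◃ n a b R = trans (det-expand-◃ (suc n) a (b ◃ R)) (sum-cong-≗ λ i →
    cong (λ z → sgn (toℕ i) * (a i * z)) (det-cong (suc n) {λ i′ j → (b ◃ R) (punchIn i i′) j} {(λ k → b (punchIn i k)) ◃ (λ k → R (punchIn i k))} (◃-delete b R i)))

  det-linear₁ : ∀ n r (c a b : Vector A (suc (suc n))) (R : Matrix (suc (suc n)) n) →
    det (suc (suc n)) (c ◃ (λ i → a i + r * b i) ◃ R)
      ≡ det (suc (suc n)) (c ◃ a ◃ R) + r * det (suc (suc n)) (c ◃ b ◃ R)
  det-linear₁ n r c a b R = begin
    det (suc (suc n)) (c ◃ (λ i → a i + r * b i) ◃ R)
      ≡⟨ det-expand-◃◃ n c _ R ⟩
    sum (λ i → s i * (c i * det (suc n) ((λ k → a (punchIn i k) + r * b (punchIn i k)) ◃ (λ k → R (punchIn i k)))))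
      ≡⟨ sum-cong-≗ (λ i → trans (cong (λ z → s i * (c i * z)) (det-linear₀ n r _ _ _)) (distr (s i) (c i) r (m a i) (m b i))) ⟩
    sum (λ i → s i * (c i * m a i) + r * (s i * (c i * m b i)))
      ≡⟨ sum-linear r (λ i → s i * (c i * m a i)) (λ i → s i * (c i * m b i)) ⟩
    sum (λ i → s i * (c i * m a i)) + r * sum (λ i → s i * (c i * m b i))
      ≡⟨ cong₂ (λ u v → u + r * v) (det-expand-◃◃ n c a R) (det-expand-◃◃ n c b R) ⟨
    det (suc (suc n)) (c ◃ a ◃ R) + r * det (suc (suc n)) (c ◃ b ◃ R) ∎
    where
    s : Fin (suc (suc n)) → A
    s i = sgn (toℕ i)
    m : Vector A (suc (suc n)) → Fin (suc (suc n)) → A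
    m v i = det (suc n) ((λ k → v (punchIn i k)) ◃ (λ k → R (punchIn i k)))
    distr : ∀ s c r x y → s * (c * (x + r * y)) ≡ s * (c * x) + r * (s * (c * y))
    distr = solve 5 (λ s c r x y → s :* (c :* (x :+ r :* y)) := s :* (c :* x) :+ r :* (s :* (c :* y))) refl

  -- In the row expansion the first two terms have the same minor and opposite signs. The minors of
  -- all later terms still contain both equal columns and vanish by induction.
  det-alternating : ∀ n (M : Matrix (suc (suc n)) (suc (suc n))) →
    (∀ i → M i zero ≡ M i (suc zero)) → det (suc (suc n)) M ≡ 0#
  det-alternating n M e = begin
    1# * (M zero zero * d₀) + ((⊖ 1#) * (M zero (suc zero) * d₁) + rest)
      ≡⟨ cong₂ (λ u v → 1# * (M zero zero * d₀) + ((⊖ 1#) * (u * v) + rest)) (≡-sym (e zero)) d₁≡d₀ ⟩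
    1# * (M zero zero * d₀) + ((⊖ 1#) * (M zero zero * d₀) + rest)
      ≡⟨ collect (- 1#) (M zero zero * d₀) rest ⟩
    (M zero zero * d₀ + ⊖ (M zero zero * d₀)) + rest
      ≡⟨ cong₂ _+_ (+⊖ _) (sum-zero _ (vanish n M e)) ⟩
    0# + 0#
      ≡⟨ +-identityˡ 0# ⟩
    0# ∎
    where
    d₀ d₁ rest : A
    d₀ = det (suc n) (λ i k → M (suc i) (suc k))
    d₁ = det (suc n) (λ i k → M (suc i) (punchIn (suc zero) k))
    rest = sum λ j → sgn (toℕ (suc (suc j))) * (M zero (suc (suc j)) * det (suc n) (λ i k → M (suc i) (punchIn (suc (suc j)) k)))
    d₁≡d₀ : d₁ ≡ d₀
    d₁≡d₀ = det-cong (suc n) {λ i k → M (suc i) (punchIn (suc zero) k)} {λ i k → M (suc i) (suc k)} λ { i zero → e (suc i) ; i (suc k) → refl }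
    collect : ∀ o a r → 1# * a + ((o * 1#) * a + r) ≡ (a + o * a) + r
    collect = solve 3 (λ o a r → con 1 :* a :+ ((o :* con 1) :* a :+ r) := (a :+ o :* a) :+ r) refl
    vanish : ∀ n (M : Matrix (suc (suc n)) (suc (suc n))) → (∀ i → M i zero ≡ M i (suc zero)) → ∀ j →
      sgn (toℕ (suc (suc j))) * (M zero (suc (suc j)) * det (suc n) (λ i k → M (suc i) (punchIn (suc (suc j)) k))) ≡ 0#
    vanish (suc n) M e j = trans
      (cong (λ z → sgn (toℕ (suc (suc j))) * (M zero (suc (suc j)) * z)) (det-alternating n (λ i k → M (suc i) (punchIn (suc (suc j)) k)) (λ i → e (suc i))))
      (**0 _ _)

  det-repeated : ∀ n (a : Vector A (suc (suc n))) (R : Matrix (suc (suc n)) n) →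
    det (suc (suc n)) (a ◃ a ◃ R) ≡ 0#
  det-repeated n a R = det-alternating n (a ◃ a ◃ R) (λ i → refl)

  -- Polarisation: expand the vanishing determinant whose first two columns are both `a + b`. The
  -- terms with a repeated column drop out and the two mixed ones must cancel.
  det-swap : ∀ n (a b : Vector A (suc (suc n))) (R : Matrix (suc (suc n)) n) →
    det (suc (suc n)) (a ◃ b ◃ R) ≡ ⊖ det (suc (suc n)) (b ◃ a ◃ R)
  det-swap n a b R = begin
    D a b                                   ≡⟨ +-identityʳ _ ⟨
    D a b + 0#                              ≡⟨ cong (λ z → D a b + z) (+⊖ (D b a)) ⟨
    D a b + (D b a + ⊖ D b a)               ≡⟨ +-assoc _ _ _ ⟨
    (D a b + D b a) + ⊖ D b a               ≡⟨ cong (λ z → z + ⊖ D b a) antisym ⟩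
    0# + ⊖ D b a                            ≡⟨ +-identityˡ _ ⟩
    ⊖ D b a                                 ∎
    where
    D : (a b : Vector A (suc (suc n))) → A
    D a b = det (suc (suc n)) (a ◃ b ◃ R)
    a+b : Vector A (suc (suc n))
    a+b i = a i + 1# * b i
    pad : ∀ x y → x + y ≡ (0# + 1# * x) + 1# * (y + 1# * 0#)
    pad = solve 2 (λ x y → x :+ y := (con 0 :+ con 1 :* x) :+ con 1 :* (y :+ con 1 :* con 0)) refl
    antisym : D a b + D b a ≡ 0#
    antisym = begin
      D a b + D b a
        ≡⟨ pad (D a b) (D b a) ⟩
      (0# + 1# * D a b) + 1# * (D b a + 1# * 0#)
        ≡⟨ cong₂ (λ u v → (u + 1# * D a b) + 1# * (D b a + 1# * v)) (det-repeated n a R) (det-repeated n b R) ⟨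
      (D a a + 1# * D a b) + 1# * (D b a + 1# * D b b)
        ≡⟨ cong₂ (λ u v → u + 1# * v) (det-linear₁ n 1# a a b R) (det-linear₁ n 1# b a b R) ⟨
      D a a+b + 1# * D b a+b
        ≡⟨ det-linear₀ (suc n) 1# a b (a+b ◃ R) ⟨
      D a+b a+b
        ≡⟨ det-repeated n a+b R ⟩
      0# ∎

  drop : ∀ a b → a + b * 0# ≡ a
  drop a b = trans (cong (λ z → a + z) (zeroʳ b)) (+-identityʳ a)

  -- Swap the second column to the front, expand along it, and use induction.
  det-add-first-column : ∀ n (c : Vector A (suc n)) (R : Matrix (suc n) n) (r : Vector A n) →
    det (suc n) (c ◃ (λ i j → R i j + r j * c i)) ≡ det (suc n) (c ◃ R)
  det-add-first-column zero    c R r = refl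
  det-add-first-column (suc n) c R r = begin
    det (suc (suc n)) (c ◃ R⁺)
      ≡⟨ det-cong (suc (suc n)) {c ◃ R⁺} {c ◃ (λ i → R₀ i + r zero * c i) ◃ R′⁺} split⁺ ⟩
    det (suc (suc n)) (c ◃ (λ i → R₀ i + r zero * c i) ◃ R′⁺)
      ≡⟨ det-linear₁ n (r zero) c R₀ c R′⁺ ⟩
    det (suc (suc n)) (c ◃ R₀ ◃ R′⁺) + r zero * det (suc (suc n)) (c ◃ c ◃ R′⁺)
      ≡⟨ cong (λ z → det (suc (suc n)) (c ◃ R₀ ◃ R′⁺) + r zero * z) (det-repeated n c R′⁺) ⟩
    det (suc (suc n)) (c ◃ R₀ ◃ R′⁺) + r zero * 0#
      ≡⟨ drop (det (suc (suc n)) (c ◃ R₀ ◃ R′⁺)) (r zero) ⟩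
    det (suc (suc n)) (c ◃ R₀ ◃ R′⁺)
      ≡⟨ det-swap n c R₀ R′⁺ ⟩
    ⊖ det (suc (suc n)) (R₀ ◃ c ◃ R′⁺)
      ≡⟨ cong ⊖_ (det-expand-◃◃ n R₀ c R′⁺) ⟩
    ⊖ sum (λ i → sgn (toℕ i) * (R₀ i * det (suc n) ((λ k → c (punchIn i k)) ◃ (λ k → R′⁺ (punchIn i k)))))
      ≡⟨ cong ⊖_ (sum-cong-≗ λ i → cong (λ z → sgn (toℕ i) * (R₀ i * z))
           (det-add-first-column n (λ k → c (punchIn i k)) (λ k → R′ (punchIn i k)) (λ j → r (suc j)))) ⟩
    ⊖ sum (λ i → sgn (toℕ i) * (R₀ i * det (suc n) ((λ k → c (punchIn i k)) ◃ (λ k → R′ (punchIn i k)))))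
      ≡⟨ cong ⊖_ (det-expand-◃◃ n R₀ c R′) ⟨
    ⊖ det (suc (suc n)) (R₀ ◃ c ◃ R′)
      ≡⟨ det-swap n c R₀ R′ ⟨
    det (suc (suc n)) (c ◃ R₀ ◃ R′)
      ≡⟨ det-cong (suc (suc n)) {c ◃ R} {c ◃ R₀ ◃ R′} split ⟨
    det (suc (suc n)) (c ◃ R) ∎
    where
    R⁺ : Matrix (suc (suc n)) (suc n)
    R⁺ i j = R i j + r j * c i
    R₀ : Vector A (suc (suc n))
    R₀ i = R i zero
    R′ R′⁺ : Matrix (suc (suc n)) n
    R′ i j = R i (suc j)
    R′⁺ i j = R i (suc j) + r (suc j) * c i
    split⁺ : ∀ i j → (c ◃ R⁺) i j ≡ (c ◃ (λ i → R₀ i + r zero * c i) ◃ R′⁺) i j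
    split⁺ i zero          = refl
    split⁺ i (suc zero)    = refl
    split⁺ i (suc (suc j)) = refl
    split : ∀ i j → (c ◃ R) i j ≡ (c ◃ R₀ ◃ R′) i j
    split i zero          = refl
    split i (suc zero)    = refl
    split i (suc (suc j)) = refl

  -- The multiple of the first remaining column contributes a repeated column. What is left of the
  -- combination is swapped behind that column, and expansion along it yields minors of the same
  -- shape with one column fewer.
  det-dependent : ∀ n (R : Matrix (suc n) n) (μ : Vector A n) →
    det (suc n) ((λ i → sum λ j → R i j * μ j) ◃ R) ≡ 0#
  det-dependent zero    R μ = trans (cong (λ z → z + 0#) (*0* 1# 1#)) (+-identityˡ 0#)
  det-dependent (suc n) R μ = begin
    det (suc (suc n)) ((λ i → sum λ j → R i j * μ j) ◃ R)
      ≡⟨ det-cong (suc (suc n)) {(λ i → sum λ j → R i j * μ j) ◃ R} {(λ i → v i + μ zero * R₀ i) ◃ R₀ ◃ R′} split ⟩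
    det (suc (suc n)) ((λ i → v i + μ zero * R₀ i) ◃ R₀ ◃ R′)
      ≡⟨ det-linear₀ (suc n) (μ zero) v R₀ (R₀ ◃ R′) ⟩
    det (suc (suc n)) (v ◃ R₀ ◃ R′) + μ zero * det (suc (suc n)) (R₀ ◃ R₀ ◃ R′)
      ≡⟨ cong₂ (λ x y → x + μ zero * y) (det-swap n v R₀ R′) (det-repeated n R₀ R′) ⟩
    ⊖ det (suc (suc n)) (R₀ ◃ v ◃ R′) + μ zero * 0#
      ≡⟨ drop (⊖ det (suc (suc n)) (R₀ ◃ v ◃ R′)) (μ zero) ⟩
    ⊖ det (suc (suc n)) (R₀ ◃ v ◃ R′)
      ≡⟨ cong ⊖_ (trans (det-expand-◃◃ n R₀ v R′) (sum-zero _ λ i →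
           trans (cong (λ z → sgn (toℕ i) * (R₀ i * z)) (det-dependent n (λ k → R′ (punchIn i k)) (λ j → μ (suc j))))
                 (**0 (sgn (toℕ i)) (R₀ i)))) ⟩
    ⊖ 0#
      ≡⟨ zeroʳ _ ⟩
    0# ∎
    where
    R₀ v : Vector A (suc (suc n))
    R₀ i = R i zero
    R′ : Matrix (suc (suc n)) n
    R′ i j = R i (suc j)
    v i = sum λ j → R′ i j * μ (suc j)
    comm : ∀ a b s → a * b + s ≡ s + b * a
    comm = solve 3 (λ a b s → a :* b :+ s := s :+ b :* a) refl
    split : ∀ i j → ((λ i → sum λ j → R i j * μ j) ◃ R) i j ≡ ((λ i → v i + μ zero * R₀ i) ◃ R₀ ◃ R′) i j
    split i zero          = comm (R i zero) (μ zero) (v i)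
    split i (suc zero)    = refl
    split i (suc (suc j)) = refl

  det-columns : ∀ n (M : Matrix (suc n) (suc n)) →
    det (suc n) M ≡ det (suc n) ((λ i → M i zero) ◃ (λ i j → M i (suc j)))
  det-columns n M = det-cong (suc n) {M} {(λ i → M i zero) ◃ (λ i j → M i (suc j))} λ { i zero → refl ; i (suc j) → refl }

  -- Replace the first column by `M μ`. The multiples of the other columns do not change the
  -- determinant, so it is scaled by `μ zero`; but the new column is `c` followed by zeros, so only
  -- one minor survives. This is the elimination step without division on which all later
  -- determinants rest.
  cramer : ∀ n (M : Matrix (suc n) (suc n)) (μ : Vector A (suc n)) (c : A) →
    (sum λ j → M zero j * μ j) ≡ c → (∀ i → (sum λ j → M (suc i) j * μ j) ≡ 0#) →
    μ zero * det (suc n) M ≡ c * det n (minor₀ M)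
  cramer n M μ c row₀ rows = begin
    μ zero * det (suc n) M
      ≡⟨ cong (λ z → μ zero * z) (det-columns n M) ⟩
    μ zero * det (suc n) (M₀ ◃ R)
      ≡⟨ +-identityˡ _ ⟨
    0# + μ zero * det (suc n) (M₀ ◃ R)
      ≡⟨ cong (λ z → z + μ zero * det (suc n) (M₀ ◃ R)) (det-dependent n R (λ j → μ (suc j))) ⟨
    det (suc n) (v ◃ R) + μ zero * det (suc n) (M₀ ◃ R)
      ≡⟨ det-linear₀ n (μ zero) v M₀ R ⟨
    det (suc n) ((λ i → v i + μ zero * M₀ i) ◃ R)
      ≡⟨ det-expand-◃ n _ R ⟩
    sum (λ i → sgn (toℕ i) * ((v i + μ zero * M₀ i) * det n (λ i′ → R (punchIn i i′))))
      ≡⟨ cong₂ _+_ (cong (λ z → 1# * (z * det n (minor₀ M))) (trans (comm (v zero) (μ zero) (M₀ zero)) row₀))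
           (sum-zero _ λ i → trans (cong (λ z → sgn (toℕ (suc i)) * (z * det n (λ i′ → R (punchIn (suc i) i′))))
                                     (trans (comm (v (suc i)) (μ zero) (M₀ (suc i))) (rows i)))
                                   (*0* _ _)) ⟩
    1# * (c * det n (minor₀ M)) + 0#
      ≡⟨ trans (+-identityʳ _) (*-identityˡ _) ⟩
    c * det n (minor₀ M) ∎
    where
    M₀ v : Vector A (suc n)
    M₀ i = M i zero
    R : Matrix (suc n) n
    R i j = M i (suc j)
    v i = sum λ j → R i j * μ (suc j)
    comm : ∀ a b c → a + b * c ≡ c * b + a
    comm = solve 3 (λ a b c → a :+ b :* c := c :* b :+ a) refl

  -- Adding `r j` times the first column to each other column clears the first row except for its
  -- leading 1.
  det-border : ∀ n (M : Matrix (suc n) (suc n)) (r : Vector A n) → M zero zero ≡ 1# →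
    (∀ j → M zero (suc j) + r j ≡ 0#) →
    det (suc n) M ≡ det n (λ i j → M (suc i) (suc j) + r j * M (suc i) zero)
  det-border n M r one cancel = begin
    det (suc n) M
      ≡⟨ det-columns n M ⟩
    det (suc n) ((λ i → M i zero) ◃ (λ i j → M i (suc j)))
      ≡⟨ det-add-first-column n _ _ r ⟨
    det (suc n) M⁺
      ≡⟨ cong₂ _+_ (cong (λ z → 1# * (z * det n (minor₀ M⁺))) one) (sum-zero _ λ j →
           trans (cong (λ z → sgn (toℕ (suc j)) * (z * d j)) (row₀ j)) (*0* _ _)) ⟩
    1# * (1# * det n (minor₀ M⁺)) + 0#
      ≡⟨ trans (+-identityʳ _) (trans (*-identityˡ _) (*-identityˡ _)) ⟩
    det n (minor₀ M⁺) ∎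
    where
    M⁺ : Matrix (suc n) (suc n)
    M⁺ = (λ i → M i zero) ◃ (λ i j → M i (suc j) + r j * M i zero)
    d : Fin n → A
    d j = det n (λ i k → M⁺ (suc i) (punchIn (suc j) k))
    times-one : ∀ a b → a + b * 1# ≡ a + b
    times-one = solve 2 (λ a b → a :+ b :* con 1 := a :+ b) refl
    row₀ : ∀ j → M zero (suc j) + r j * M zero zero ≡ 0#
    row₀ j = trans (cong (λ z → M zero (suc j) + r j * z) one) (trans (times-one _ _) (cancel j))

  -- Determinants indexed by lists

  lsum : {V : Set} → List V → (V → A) → A
  lsum []       g = 0#
  lsum (v ∷ vs) g = g v + lsum vs g

  sum-lookup : {V : Set} (vs : List V) (g : V → A) → sum (λ j → g (lookup vs j)) ≡ lsum vs g
  sum-lookup []       g = refl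
  sum-lookup (v ∷ vs) g = cong (λ z → g v + z) (sum-lookup vs g)

  -- Rows and columns are labelled by a list of vertices, so that eliminating a vertex means
  -- removing the head of the list.
  listMatrix : {V : Set} (m : V → V → A) (vs : List V) → Matrix (List.length vs) (List.length vs)
  listMatrix m vs i j = m (lookup vs i) (lookup vs j)

  listDet : {V : Set} → (V → V → A) → List V → A
  listDet m vs = det (List.length vs) (listMatrix m vs)

  padZero : {V : Set} (μ : V → A) (as bs : List V) → Vector A (List.length (as ++ bs))
  padZero μ []       bs j       = 0#
  padZero μ (a ∷ as) bs zero    = μ a
  padZero μ (a ∷ as) bs (suc j) = padZero μ as bs j

  sum-padZero : {V : Set} (g μ : V → A) (as bs : List V) →
    sum (λ j → g (lookup (as ++ bs) j) * padZero μ as bs j) ≡ lsum as (λ w → g w * μ w)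
  sum-padZero g μ []       bs = sum-zero (λ j → g (lookup bs j) * 0#) (λ j → zeroʳ _)
  sum-padZero g μ (a ∷ as) bs = cong (λ z → g a * μ a + z) (sum-padZero g μ as bs)

  lsum-zero : {V : Set} (vs : List V) (g : V → A) → All (λ v → g v ≡ 0#) vs → lsum vs g ≡ 0#
  lsum-zero []       g []       = refl
  lsum-zero (v ∷ vs) g (e ∷ es) = trans (cong₂ _+_ e (lsum-zero vs g es)) (+-identityˡ 0#)

  All-lookup : {V : Set} {P : V → Set} (vs : List V) → All P vs → ∀ i → P (lookup vs i)
  All-lookup (v ∷ vs) (p ∷ ps) zero    = p
  All-lookup (v ∷ vs) (p ∷ ps) (suc i) = All-lookup vs ps i

  -- Rows outside the block vanish on its columns, so a vector supported on the block, padded with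
  -- zeros, already satisfies the equations of `cramer` in those rows. Only the row sums inside the
  -- block have to be computed.
  cramer-block : {V : Set} (m : V → V → A) (μ : V → A) (c : A) (v : V) (as bs : List V) →
    lsum (v ∷ as) (λ w → m v w * μ w) ≡ c →
    All (λ u → lsum (v ∷ as) (λ w → m u w * μ w) ≡ 0#) as →
    All (λ u → All (λ w → m u w ≡ 0#) (v ∷ as)) bs →
    μ v * listDet m (v ∷ as ++ bs) ≡ c * listDet m (as ++ bs)
  cramer-block m μ c v as bs row₀ rows zeros =
    cramer (List.length (as ++ bs)) (listMatrix m (v ∷ as ++ bs)) (padZero μ (v ∷ as) bs) c
      (trans (sum-padZero (m v) μ (v ∷ as) bs) row₀)
      (λ i → trans (sum-padZero (m (lookup (as ++ bs) i)) μ (v ∷ as) bs)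
                   (All-lookup (as ++ bs) (++⁺ rows (mapAll vanish zeros)) i))
    where
    vanish : ∀ {u} → All (λ w → m u w ≡ 0#) (v ∷ as) → lsum (v ∷ as) (λ w → m u w * μ w) ≡ 0#
    vanish es = lsum-zero (v ∷ as) _ (mapAll (λ {w} e → trans (cong (λ z → z * μ w) e) (zeroˡ (μ w))) es)

open import Data.Bool using (Bool; true; false; if_then_else_; _∧_; _∨_; T; not)
import Data.Bool.Properties as Boolₚ
open import Data.Fin.Properties using (_≟_)
open import Data.Integer as ℤ using (ℤ; +_; -[1+_]; _+_; _*_; -_; ∣_∣; _^_)
import Data.Integer.Properties as ℤₚ
open import Data.Integer.Tactic.RingSolver using (solve-∀)
open import Data.List using (map; upTo; applyUpTo; replicate)
open import Data.List.Membership.Propositional using (_∈_)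
open import Data.List.Membership.Propositional.Properties using (∈-++⁺ʳ; ∈-++⁺ˡ; ∈-lookup)
import Data.List.Properties as Listₚ
import Data.List.Relation.Unary.All as All
import Data.List.Relation.Unary.All.Properties as Allₚ
open import Data.List.Relation.Unary.AllPairs using ([]; _∷_)
open import Data.List.Relation.Unary.Any as Any using (here; there)
import Data.List.Relation.Unary.Any.Properties as Anyₚ
open import Data.List.Relation.Unary.Unique.Propositional using (Unique)
open import Data.Nat using (_≡ᵇ_; _≤_; _<_; z≤n; s≤s; _<ᵇ_; _∸_)
import Data.Nat.Properties as ℕₚ
import Data.Nat.Tactic.RingSolver as ℕSolver
open import Data.Product using (∃; _×_; _,_; proj₁; proj₂)
open import Data.Rational as ℚ using (ℚ)
import Data.Rational.Properties as ℚₚ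
import Data.Rational.Unnormalised as ℚᵘ
import Data.Rational.Unnormalised.Properties as ℚᵘₚ
open import Data.Sum using (_⊎_; inj₁; inj₂)
open import Data.Unit using (⊤; tt)
open import Relation.Binary.PropositionalEquality using (_≢_; subst; subst₂)
open import Relation.Nullary using (does; yes; no; contradiction)
open import Relation.Nullary.Decidable using (dec-true)
open import Algebra.Properties.Semiring.Sum ℤₚ.+-*-semiring using (sum; sum-cong-≗; *-distribˡ-sum)
open Determinant ℤₚ.+-*-isCommutativeRing

-- Rank-two updates of integer matrices

sum-combination : ∀ {n} (g μ ν : Vector ℤ n) (c d : ℤ) →
  sum (λ j → g j * (c * μ j + d * ν j)) ≡ c * sum (λ j → g j * μ j) + d * sum (λ j → g j * ν j)
sum-combination {zero}  g μ ν c d = lem c d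
  where
  lem : ∀ c d → + 0 ≡ c * + 0 + d * + 0
  lem = solve-∀
sum-combination {suc n} g μ ν c d =
  trans (cong (λ z → g zero * (c * μ zero + d * ν zero) + z)
              (sum-combination (λ j → g (suc j)) (λ j → μ (suc j)) (λ j → ν (suc j)) c d))
        (lem (g zero) (μ zero) (ν zero) c d (sum (λ j → g (suc j) * μ (suc j))) (sum (λ j → g (suc j) * ν (suc j))))
  where
  lem : ∀ g m n c d x y → g * (c * m + d * n) + (c * x + d * y) ≡ c * (g * m + x) + d * (g * n + y)
  lem = solve-∀

sum-scale : ∀ {n} (g : Vector ℤ n) (c : ℤ) → sum (λ j → c * g j) ≡ c * sum g
sum-scale g c = ≡-sym (*-distribˡ-sum c g)

-- The matrix P + a rᵀ + b tᵀ is bordered to [1 0 -rᵀ; 0 1 -tᵀ; a b P]; the two border columns are then eliminated.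
det-rank-two : ∀ n (P : Matrix n n) (a b r t μ ν : Vector ℤ n) (s rμ rν tμ tν : ℤ) →
  (∀ i → sum (λ j → P i j * μ j) ≡ - (s * a i)) →
  (∀ i → sum (λ j → P i j * ν j) ≡ - (s * b i)) →
  sum (λ j → r j * μ j) ≡ rμ → sum (λ j → r j * ν j) ≡ rν →
  sum (λ j → t j * μ j) ≡ tμ → sum (λ j → t j * ν j) ≡ tν →
  (s * s * (s + - tν)) * det n (λ i j → (P i j + r j * a i) + t j * b i)
    ≡ ((s + - tν) * ((s + - rμ) * (s + - tν) + - (rν * tμ))) * det n P
det-rank-two n P a b r t μ ν s rμ rν tμ tν Pμ Pν erμ erν etμ etν = begin
  (s * s * c₁) * det n Q
    ≡⟨ cong (λ z → (s * s * c₁) * z) (≡-sym borders) ⟩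
  (s * s * c₁) * det (suc (suc n)) B
    ≡⟨ reassoc s c₁ (det (suc (suc n)) B) ⟩
  s * ((c₁ * s) * det (suc (suc n)) B)
    ≡⟨ cong (λ z → s * z) (cramer (suc n) B lam c row₀ rows) ⟩
  s * (c * det (suc n) B′)
    ≡⟨ exchange s c (det (suc n) B′) ⟩
  c * (s * det (suc n) B′)
    ≡⟨ cong (λ z → c * z) (cramer n B′ lam′ c₁ row₀′ rows′) ⟩
  c * (c₁ * det n P)
    ≡⟨ final c c₁ (det n P) ⟩
  (c₁ * c) * det n P ∎
  where
  open ≡-Reasoning
  c₁ c : ℤ
  c₁ = s + - tν
  c = (s + - rμ) * c₁ + - (rν * tμ)
  Q : Matrix n n
  Q i j = (P i j + r j * a i) + t j * b i
  B : Matrix (suc (suc n)) (suc (suc n))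
  B zero          zero          = + 1
  B zero          (suc zero)    = + 0
  B zero          (suc (suc j)) = - r j
  B (suc zero)    zero          = + 0
  B (suc zero)    (suc zero)    = + 1
  B (suc zero)    (suc (suc j)) = - t j
  B (suc (suc i)) zero          = a i
  B (suc (suc i)) (suc zero)    = b i
  B (suc (suc i)) (suc (suc j)) = P i j
  B′ : Matrix (suc n) (suc n)
  B′ i j = B (suc i) (suc j)
  r⁺ : Vector ℤ (suc n)
  r⁺ zero    = + 0
  r⁺ (suc j) = r j
  B⁺ : Matrix (suc n) (suc n)
  B⁺ i j = B (suc i) (suc j) + r⁺ j * B (suc i) zero
  neg-cancel : ∀ a → - a + a ≡ + 0
  neg-cancel = solve-∀
  borders : det (suc (suc n)) B ≡ det n Q
  borders = trans
    (det-border (suc n) B r⁺ refl (λ { zero → refl ; (suc j) → neg-cancel (r j) }))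
    (trans (det-border n B⁺ t refl (λ j → lem (t j) (r j)))
           (det-cong n (λ i j → cong (λ z → (P i j + r j * a i) + t j * z) (lem′ (b i) (a i)))))
    where
    lem : ∀ t r → (- t + r * + 0) + t ≡ + 0
    lem = solve-∀
    lem′ : ∀ b a → b + + 0 * a ≡ b
    lem′ = solve-∀
  reassoc : ∀ s c d → (s * s * c) * d ≡ s * ((c * s) * d)
  reassoc = solve-∀
  exchange : ∀ s c d → s * (c * d) ≡ c * (s * d)
  exchange = solve-∀
  final : ∀ c c₁ d → c * (c₁ * d) ≡ (c₁ * c) * d
  final = solve-∀
  -- The weights `c₁` and `tμ` are those for which the second border row cancels: there the sum is
  -- `tμ * s - c₁ * tμ - tμ * tν`, and `c₁` is `s - tν`. The rows below cancel for any weights,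
  -- since `μ` and `ν` are mapped by `P` to `- s` times the border columns.
  combine : Vector ℤ n
  combine j = c₁ * μ j + tμ * ν j
  lam : Vector ℤ (suc (suc n))
  lam zero          = c₁ * s
  lam (suc zero)    = tμ * s
  lam (suc (suc j)) = combine j
  lam′ : Vector ℤ (suc n)
  lam′ zero    = s
  lam′ (suc j) = ν j
  neg-sum : ∀ (g ρ : Vector ℤ n) z → sum (λ j → g j * ρ j) ≡ z → sum (λ j → - g j * ρ j) ≡ - z
  neg-sum g ρ z e = trans (sum-cong-≗ (λ j → lem (g j) (ρ j))) (trans (sum-scale (λ j → g j * ρ j) (- + 1)) (trans (cong (λ w → - + 1 * w) e) (lem″ z)))
    where
    lem : ∀ g r → - g * r ≡ - + 1 * (g * r)
    lem = solve-∀
    lem″ : ∀ z → - + 1 * z ≡ - z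
    lem″ = solve-∀
  row₀ : sum (λ j → B zero j * lam j) ≡ c
  row₀ = trans
    (cong (λ z → + 1 * (c₁ * s) + (+ 0 * (tμ * s) + z))
      (trans (sum-combination (λ j → - r j) μ ν c₁ tμ) (cong₂ (λ u v → c₁ * u + tμ * v) (neg-sum r μ rμ erμ) (neg-sum r ν rν erν))))
    (lem s c₁ rμ rν tμ)
    where
    lem : ∀ s c₁ rμ rν tμ → + 1 * (c₁ * s) + (+ 0 * (tμ * s) + (c₁ * - rμ + tμ * - rν)) ≡ (s + - rμ) * c₁ + - (rν * tμ)
    lem = solve-∀
  rows : ∀ i → sum (λ j → B (suc i) j * lam j) ≡ + 0
  rows zero = trans
    (cong (λ z → + 0 * (c₁ * s) + (+ 1 * (tμ * s) + z))
      (trans (sum-combination (λ j → - t j) μ ν c₁ tμ) (cong₂ (λ u v → c₁ * u + tμ * v) (neg-sum t μ tμ etμ) (neg-sum t ν tν etν))))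
    (lem s tν tμ)
    where
    lem : ∀ s tν tμ → + 0 * ((s + - tν) * s) + (+ 1 * (tμ * s) + ((s + - tν) * - tμ + tμ * - tν)) ≡ + 0
    lem = solve-∀
  rows (suc i) = trans
    (cong (λ z → a i * (c₁ * s) + (b i * (tμ * s) + z))
      (trans (sum-combination (P i) μ ν c₁ tμ) (cong₂ (λ u v → c₁ * u + tμ * v) (Pμ i) (Pν i))))
    (lem s c₁ tμ (a i) (b i))
    where
    lem : ∀ s c₁ tμ a b → a * (c₁ * s) + (b * (tμ * s) + (c₁ * - (s * a) + tμ * - (s * b))) ≡ + 0
    lem = solve-∀
  row₀′ : sum (λ j → B′ zero j * lam′ j) ≡ c₁
  row₀′ = trans (cong (λ z → + 1 * s + z) (neg-sum t ν tν etν)) (lem s tν)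
    where
    lem : ∀ s t → + 1 * s + - t ≡ s + - t
    lem = solve-∀
  rows′ : ∀ i → sum (λ j → B′ (suc i) j * lam′ j) ≡ + 0
  rows′ i = trans (cong (λ z → b i * s + z) (Pν i)) (lem (b i) s)
    where
    lem : ∀ b s → b * s + - (s * b) ≡ + 0
    lem = solve-∀

-- Integer polynomials determined by their values

eval : Poly → ℤ → ℤ
eval []      x = + 0
eval (a ∷ p) x = a + x * eval p x

eval-addP : ∀ p q x → eval (addP p q) x ≡ eval p x + eval q x
eval-addP []      q       x = ≡-sym (ℤₚ.+-identityˡ _)
eval-addP (a ∷ p) []      x = ≡-sym (ℤₚ.+-identityʳ _)
eval-addP (a ∷ p) (b ∷ q) x = trans (cong (λ z → (a + b) + x * z) (eval-addP p q x)) (lem a b x (eval p x) (eval q x))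
  where
  lem : ∀ a b x p q → (a + b) + x * (p + q) ≡ (a + x * p) + (b + x * q)
  lem = solve-∀

eval-scaleP : ∀ c p x → eval (scaleP c p) x ≡ c * eval p x
eval-scaleP c []      x = ≡-sym (ℤₚ.*-zeroʳ c)
eval-scaleP c (a ∷ p) x = trans (cong (λ z → c * a + x * z) (eval-scaleP c p x)) (lem a c x (eval p x))
  where
  lem : ∀ a c x p → c * a + x * (c * p) ≡ c * (a + x * p)
  lem = solve-∀

eval-mulP : ∀ p q x → eval (mulP p q) x ≡ eval p x * eval q x
eval-mulP []      q x = refl
eval-mulP (a ∷ p) q x = begin
  eval (addP (scaleP a q) (+ 0 ∷ mulP p q)) x
    ≡⟨ eval-addP (scaleP a q) (+ 0 ∷ mulP p q) x ⟩
  eval (scaleP a q) x + (+ 0 + x * eval (mulP p q) x)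
    ≡⟨ cong₂ (λ u v → u + (+ 0 + x * v)) (eval-scaleP a q x) (eval-mulP p q x) ⟩
  a * eval q x + (+ 0 + x * (eval p x * eval q x))
    ≡⟨ lem a x (eval p x) (eval q x) ⟩
  (a + x * eval p x) * eval q x ∎
  where
  open ≡-Reasoning
  lem : ∀ a x p q → a * q + (+ 0 + x * (p * q)) ≡ (a + x * p) * q
  lem = solve-∀

-- The expansion of detP along the first row is a local function of Defs. It is recovered by unification:
-- in the normal form of detP (suc (suc m)) M it occurs applied to variables once its size and column arguments are abstracted.
mutual
  expansionTail : ∀ m → (Fin (suc (suc m)) → Fin (suc (suc m)) → Poly) → Poly
  expansionTail = _

  expansionTail-spec : ∀ m M → detP (suc (suc m)) M ≡
    addP (scaleP (+ 1) (mulP (M zero zero) (detP (suc m) (λ i k → M (suc i) (suc k)))))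
      (addP (scaleP (sign 1) (mulP (M zero (suc zero)) (detP (suc m) (λ i k → M (suc i) (punchIn (suc zero) k)))))
        (expansionTail m M))
  expansionTail-spec m M = refl

mutual
  expansion : (n : ℕ) (M : Fin (suc n) → Fin (suc n) → Poly) (r : ℕ) → (Fin r → Fin (suc n)) → Poly
  expansion = _

  expansion-spec : ∀ m M → expansionTail m M ≡ expansion (suc m) M m (λ j → suc (suc j))
  expansion-spec m M with (λ (j : Fin m) → Fin.suc (Fin.suc j))
  ... | col with suc m
  ... | n = refl

sgn≡sign : ∀ k → sgn k ≡ sign k
sgn≡sign zero    = refl
sgn≡sign (suc k) = trans (cong (λ z → - + 1 * z) (sgn≡sign k)) (ℤₚ.-1*i≡-i (sign k))

eval-detP : ∀ n (M : Fin n → Fin n → Poly) x → eval (detP n M) x ≡ det n (λ i j → eval (M i j) x)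
eval-expansion : ∀ n (M : Fin (suc n) → Fin (suc n) → Poly) x r (col : Fin r → Fin (suc n)) →
  eval (expansion n M r col) x ≡ sum λ j → sgn (toℕ (col j)) *
    (eval (M zero (col j)) x * det n (λ i k → eval (M (suc i) (punchIn (col j) k)) x))

eval-detP zero    M x = cong (λ z → + 1 + z) (ℤₚ.*-zeroʳ x)
eval-detP (suc n) M x = eval-expansion n M x (suc n) (λ j → j)

eval-expansion n M x zero    col = refl
eval-expansion n M x (suc r) col = begin
  eval (addP (scaleP s (mulP p d)) rest) x
    ≡⟨ eval-addP (scaleP s (mulP p d)) rest x ⟩
  eval (scaleP s (mulP p d)) x + eval rest x
    ≡⟨ cong₂ _+_ (trans (eval-scaleP s (mulP p d) x) (cong₂ _*_ (≡-sym (sgn≡sign (toℕ (col zero)))) (eval-mulP p d x)))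
                 (eval-expansion n M x r (λ j → col (suc j))) ⟩
  sgn (toℕ (col zero)) * (eval p x * eval d x) + _
    ≡⟨ cong (λ z → sgn (toℕ (col zero)) * (eval p x * z) + sum (λ j → term (suc j))) (eval-detP n _ x) ⟩
  sum term ∎
  where
  open ≡-Reasoning
  s : ℤ
  s = sign (toℕ (col zero))
  p d rest : Poly
  p = M zero (col zero)
  d = detP n (λ i k → M (suc i) (punchIn (col zero) k))
  rest = expansion n M r (λ j → col (suc j))
  term : Fin (suc r) → ℤ
  term j = sgn (toℕ (col j)) * (eval (M zero (col j)) x * det n (λ i k → eval (M (suc i) (punchIn (col j) k)) x))

coeff-addP : ∀ p q i → coeff (addP p q) i ≡ coeff p i + coeff q i
coeff-addP []      q       i       = ≡-sym (ℤₚ.+-identityˡ _)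
coeff-addP (a ∷ p) []      i       = ≡-sym (ℤₚ.+-identityʳ _)
coeff-addP (a ∷ p) (b ∷ q) zero    = refl
coeff-addP (a ∷ p) (b ∷ q) (suc i) = coeff-addP p q i

coeff-scaleP : ∀ c p i → coeff (scaleP c p) i ≡ c * coeff p i
coeff-scaleP c []      i       = ≡-sym (ℤₚ.*-zeroʳ c)
coeff-scaleP c (a ∷ p) zero    = refl
coeff-scaleP c (a ∷ p) (suc i) = coeff-scaleP c p i

multiple-small : ∀ m n → n ℕ.* m ℕ.< n → m ≡ 0
multiple-small zero    n lt = refl
multiple-small (suc m) n lt = contradiction (ℕₚ.≤-<-trans (ℕₚ.m≤m*n n (suc m)) lt) (ℕₚ.<-irrefl refl)

-- The constant term is divisible by every large integer at which the polynomial vanishes.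
eventually-zero : ∀ p B → (∀ n → B ℕ.≤ n → eval p (+ n) ≡ + 0) → ∀ i → coeff p i ≡ + 0
eventually-zero []      B h i       = refl
eventually-zero (a ∷ p) B h zero    = ℤₚ.∣i∣≡0⇒i≡0 (begin
  ∣ a ∣             ≡⟨ abs-a ⟩
  n ℕ.* ∣ e ∣       ≡⟨ cong (λ z → n ℕ.* z) (multiple-small ∣ e ∣ n (subst (λ z → z ℕ.< n) abs-a (ℕₚ.m≤n+m (suc ∣ a ∣) B))) ⟩
  n ℕ.* 0           ≡⟨ ℕₚ.*-zeroʳ n ⟩
  0                 ∎)
  where
  open ≡-Reasoning
  n : ℕ
  -- Large enough to be a zero and larger than `∣ a ∣`, so that `a`, a multiple of `n`, can only be
  -- 0.
  n = B ℕ.+ suc ∣ a ∣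
  e : ℤ
  e = eval p (+ n)
  move : ∀ a b → a ≡ (a + b) + - b
  move = solve-∀
  abs-a : ∣ a ∣ ≡ n ℕ.* ∣ e ∣
  abs-a = begin
    ∣ a ∣                        ≡⟨ cong ∣_∣ (move a (+ n * e)) ⟩
    ∣ (a + + n * e) + - (+ n * e) ∣  ≡⟨ cong (λ z → ∣ z + - (+ n * e) ∣) (h n (ℕₚ.m≤m+n B _)) ⟩
    ∣ + 0 + - (+ n * e) ∣        ≡⟨ cong ∣_∣ (ℤₚ.+-identityˡ (- (+ n * e))) ⟩
    ∣ - (+ n * e) ∣              ≡⟨ ℤₚ.∣-i∣≡∣i∣ (+ n * e) ⟩
    ∣ + n * e ∣                  ≡⟨ ℤₚ.abs-* (+ n) e ⟩
    n ℕ.* ∣ e ∣                  ∎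
eventually-zero (a ∷ p) B h (suc i) = eventually-zero p (suc B) tail-zero i
  where
  open ≡-Reasoning
  tail-zero : ∀ n → suc B ℕ.≤ n → eval p (+ n) ≡ + 0
  tail-zero (suc n) le with ℤₚ.i*j≡0⇒i≡0∨j≡0 (+ suc n) {eval p (+ suc n)} (begin
      + suc n * eval p (+ suc n)        ≡⟨ ℤₚ.+-identityˡ _ ⟨
      + 0 + + suc n * eval p (+ suc n)  ≡⟨ cong (λ z → z + + suc n * eval p (+ suc n)) (eventually-zero (a ∷ p) B h zero) ⟨
      a + + suc n * eval p (+ suc n)    ≡⟨ h (suc n) (ℕₚ.≤-trans (ℕₚ.n≤1+n B) le) ⟩
      + 0 ∎)
  ... | inj₂ e = e

eventually-equal : ∀ p q B → (∀ n → B ℕ.≤ n → eval p (+ n) ≡ eval q (+ n)) → ∀ i → coeff p i ≡ coeff q i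
eventually-equal p q B h i = begin
  coeff p i
    ≡⟨ move (coeff p i) (coeff q i) ⟩
  (coeff p i + - + 1 * coeff q i) + coeff q i
    ≡⟨ cong (λ z → (coeff p i + z) + coeff q i) (coeff-scaleP (- + 1) q i) ⟨
  (coeff p i + coeff (scaleP (- + 1) q) i) + coeff q i
    ≡⟨ cong (λ z → z + coeff q i) (coeff-addP p _ i) ⟨
  coeff (addP p (scaleP (- + 1) q)) i + coeff q i
    ≡⟨ cong (λ z → z + coeff q i) (eventually-zero (addP p (scaleP (- + 1) q)) B difference i) ⟩
  + 0 + coeff q i
    ≡⟨ ℤₚ.+-identityˡ _ ⟩
  coeff q i ∎
  where
  open ≡-Reasoning
  move : ∀ a b → a ≡ (a + - + 1 * b) + b
  move = solve-∀
  cancel : ∀ a → a + - + 1 * a ≡ + 0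
  cancel = solve-∀
  difference : ∀ n → B ℕ.≤ n → eval (addP p (scaleP (- + 1) q)) (+ n) ≡ + 0
  difference n le = trans (eval-addP p _ (+ n)) (trans (cong₂ _+_ (h n le) (eval-scaleP (- + 1) q (+ n))) (cancel (eval q (+ n))))

-- Graph distance

∨-true : ∀ a {b} → a ∨ b ≡ true → a ≡ true ⊎ b ≡ true
∨-true true  e = inj₁ refl
∨-true false e = inj₂ e

∨-trueʳ : ∀ a {b} → b ≡ true → a ∨ b ≡ true
∨-trueʳ a refl = Boolₚ.∨-zeroʳ a

∧-true : ∀ a {b} → a ∧ b ≡ true → a ≡ true × b ≡ true
∧-true true e = refl , e

anyFin-true : ∀ {n} (p : Fin n → Bool) → anyFin p ≡ true → ∃ λ i → p i ≡ true
anyFin-true {suc n} p e with ∨-true (p zero) e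
... | inj₁ e₀ = zero , e₀
... | inj₂ e₁ = let i , eᵢ = anyFin-true (λ i → p (suc i)) e₁ in suc i , eᵢ

true-anyFin : ∀ {n} (p : Fin n → Bool) i → p i ≡ true → anyFin p ≡ true
true-anyFin p zero    e rewrite e = refl
true-anyFin p (suc i) e = ∨-trueʳ (p zero) (true-anyFin (λ i → p (suc i)) i e)

leastUpTo-threshold : ∀ b p d → (∀ k → d ≤ k → p k ≡ true) → (∀ k → p k ≡ true → d ≤ k) → d ≤ b →
  leastUpTo b p ≡ d
leastUpTo-threshold zero    p zero    above below le = refl
leastUpTo-threshold (suc b) p zero    above below le rewrite above 0 z≤n = refl
leastUpTo-threshold (suc b) p (suc d) above below (s≤s le) with p 0 in eq
... | true  = contradiction (below 0 eq) λ ()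
... | false = cong suc (leastUpTo-threshold b (λ k → p (suc k)) d
                (λ k d≤k → above (suc k) (s≤s d≤k)) (λ k e → ℕ.s≤s⁻¹ (below (suc k) e)) le)

-- These four properties characterise graph distance: `d` falls by at most one along an edge, so no
-- shorter walk exists, and from a positive value some edge makes it fall by one, so a walk of that
-- length exists. The same descent proves connectedness.
module GraphDistance {N} (G : Graph N) (d : Fin N → Fin N → ℕ)
  (d-refl : ∀ u → d u u ≡ 0)
  (d-zero : ∀ u v → d u v ≡ 0 → u ≡ v)
  (d-edge : ∀ u w v → adj G u w ≡ true → d u v ≤ suc (d w v))
  (d-descent : ∀ u v n → d u v ≡ suc n → ∃ λ w → adj G u w ≡ true × d w v ≡ n) where

  within-sound : ∀ k u v → within G k u v ≡ true → d u v ≤ k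
  within-sound zero u v e with u ≟ v
  ... | yes refl = ℕₚ.≤-reflexive (d-refl u)
  within-sound (suc k) u v e with ∨-true (within G k u v) e
  ... | inj₁ e₁ = ℕₚ.m≤n⇒m≤1+n (within-sound k u v e₁)
  ... | inj₂ e₂ with anyFin-true (λ w → adj G u w ∧ within G k w v) e₂
  ...   | w , e₃ = let uw , wv = ∧-true (adj G u w) e₃ in
                   ℕₚ.≤-trans (d-edge u w v uw) (s≤s (within-sound k w v wv))

  within-complete : ∀ k u v → d u v ≤ k → within G k u v ≡ true
  within-complete zero u v le = dec-true (u ≟ v) (d-zero u v (ℕₚ.n≤0⇒n≡0 le))
  within-complete (suc k) u v le with ℕₚ.m≤n⇒m<n∨m≡n le
  ... | inj₁ (s≤s le′) = cong (λ b → b ∨ anyFin (λ w → adj G u w ∧ within G k w v)) (within-complete k u v le′)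
  ... | inj₂ eq with d-descent u v k eq
  ...   | w , uw , wv = ∨-trueʳ (within G k u v) (true-anyFin _ w
                          (cong₂ _∧_ uw (within-complete k w v (ℕₚ.≤-reflexive wv))))

  dist-unique : ∀ u v → d u v ≤ N → dist G u v ≡ d u v
  dist-unique u v = leastUpTo-threshold N (λ k → within G k u v) (d u v)
    (λ k → within-complete k u v) (λ k → within-sound k u v)

  walk : ∀ n u v → d u v ≡ n → Walk G u v
  walk zero    u v e = subst (Walk G u) (d-zero u v e) here
  walk (suc n) u v e = let w , uw , wv = d-descent u v n e in step uw (walk n w v wv)

-- The trees

data Vertex : Set where
  root : Vertex
  node : ℕ → ℕ → Vertex

≡ᵇ-refl : ∀ n → (n ≡ᵇ n) ≡ true
≡ᵇ-refl zero    = refl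
≡ᵇ-refl (suc n) = ≡ᵇ-refl n

≡ᵇ-true : ∀ m n → (m ≡ᵇ n) ≡ true → m ≡ n
≡ᵇ-true zero    zero    e = refl
≡ᵇ-true (suc m) (suc n) e = cong suc (≡ᵇ-true m n e)

≡ᵇ-false : ∀ m n → m ≢ n → (m ≡ᵇ n) ≡ false
≡ᵇ-false m n ne with m ≡ᵇ n in eq
... | true  = contradiction (≡ᵇ-true m n eq) ne
... | false = refl

≡ᵇ-sym : ∀ m n → (m ≡ᵇ n) ≡ (n ≡ᵇ m)
≡ᵇ-sym zero    zero    = refl
≡ᵇ-sym zero    (suc n) = refl
≡ᵇ-sym (suc m) zero    = refl
≡ᵇ-sym (suc m) (suc n) = ≡ᵇ-sym m n

-- node i 0 is the i-th child of the root, node i (suc a) is a leaf attached to it.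
adjV : Vertex → Vertex → Bool
adjV root             root             = false
adjV root             (node j zero)    = true
adjV root             (node j (suc b)) = false
adjV (node i zero)    root             = true
adjV (node i (suc a)) root             = false
adjV (node i zero)    (node j zero)    = false
adjV (node i zero)    (node j (suc b)) = i ≡ᵇ j
adjV (node i (suc a)) (node j zero)    = i ≡ᵇ j
adjV (node i (suc a)) (node j (suc b)) = false

adjV-sym : ∀ u v → adjV u v ≡ adjV v u
adjV-sym root             root             = refl
adjV-sym root             (node j zero)    = refl
adjV-sym root             (node j (suc b)) = refl
adjV-sym (node i zero)    root             = refl
adjV-sym (node i (suc a)) root             = refl
adjV-sym (node i zero)    (node j zero)    = refl
adjV-sym (node i zero)    (node j (suc b)) = ≡ᵇ-sym i j
adjV-sym (node i (suc a)) (node j zero)    = ≡ᵇ-sym i j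
adjV-sym (node i (suc a)) (node j (suc b)) = refl

adjV-irrefl : ∀ u → adjV u u ≡ false
adjV-irrefl root             = refl
adjV-irrefl (node i zero)    = refl
adjV-irrefl (node i (suc a)) = refl

depth : ℕ → ℕ
depth zero    = 1
depth (suc a) = 2

siblingDistance : ℕ → ℕ → ℕ
siblingDistance zero    zero    = 0
siblingDistance zero    (suc b) = 1
siblingDistance (suc a) zero    = 1
siblingDistance (suc a) (suc b) = if a ≡ᵇ b then 0 else 2

distV : Vertex → Vertex → ℕ
distV root       root       = 0
distV root       (node j b) = depth b
distV (node i a) root       = depth a
distV (node i a) (node j b) = if i ≡ᵇ j then siblingDistance a b else depth a ℕ.+ depth b

siblingDistance-refl : ∀ a → siblingDistance a a ≡ 0
siblingDistance-refl zero    = refl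
siblingDistance-refl (suc a) = cong (if_then 0 else 2) (≡ᵇ-refl a)

distV-refl : ∀ u → distV u u ≡ 0
distV-refl root       = refl
distV-refl (node i a) rewrite ≡ᵇ-refl i = siblingDistance-refl a

siblingDistance-zero : ∀ a b → siblingDistance a b ≡ 0 → a ≡ b
siblingDistance-zero zero    zero    e = refl
siblingDistance-zero (suc a) (suc b) e with a ≡ᵇ b in eq
... | true = cong suc (≡ᵇ-true a b eq)

distV-zero : ∀ u v → distV u v ≡ 0 → u ≡ v
distV-zero root             root             e = refl
distV-zero root             (node j zero)    ()
distV-zero root             (node j (suc b)) ()
distV-zero (node i zero)    root             ()
distV-zero (node i (suc a)) root             ()
distV-zero (node i a)       (node j b)       e with i ≡ᵇ j in eq
... | true = cong₂ node (≡ᵇ-true i j eq) (siblingDistance-zero a b e)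
distV-zero (node i zero)    (node j b)       () | false
distV-zero (node i (suc a)) (node j b)       () | false

depth≤2 : ∀ a → depth a ≤ 2
depth≤2 zero    = s≤s z≤n
depth≤2 (suc a) = ℕₚ.≤-refl

siblingDistance≤2 : ∀ a b → siblingDistance a b ≤ 2
siblingDistance≤2 zero    zero    = z≤n
siblingDistance≤2 zero    (suc b) = s≤s z≤n
siblingDistance≤2 (suc a) zero    = s≤s z≤n
siblingDistance≤2 (suc a) (suc b) with a ≡ᵇ b
... | true  = z≤n
... | false = ℕₚ.≤-refl

distV≤4 : ∀ u v → distV u v ≤ 4
distV≤4 root       root       = z≤n
distV≤4 root       (node j b) = ℕₚ.≤-trans (depth≤2 b) (s≤s (s≤s z≤n))
distV≤4 (node i a) root       = ℕₚ.≤-trans (depth≤2 a) (s≤s (s≤s z≤n))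
distV≤4 (node i a) (node j b) with i ≡ᵇ j
... | true  = ℕₚ.≤-trans (siblingDistance≤2 a b) (s≤s (s≤s z≤n))
... | false = ℕₚ.+-mono-≤ (depth≤2 a) (depth≤2 b)

distV-edge : ∀ u w v → adjV u w ≡ true → distV u v ≤ suc (distV w v)
distV-edge root (node i zero) root e = z≤n
distV-edge root (node i zero) (node j b) e with i ≡ᵇ j
distV-edge root (node i zero) (node j zero)    e | true = ℕₚ.≤-refl
distV-edge root (node i zero) (node j (suc b)) e | true = ℕₚ.≤-refl
... | false = ℕₚ.m≤n+m (depth b) 2
distV-edge (node i zero) root root e = ℕₚ.≤-refl
distV-edge (node i zero) root (node j b) e with i ≡ᵇ j
distV-edge (node i zero) root (node j zero)    e | true = z≤n
distV-edge (node i zero) root (node j (suc b)) e | true = s≤s z≤n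
... | false = ℕₚ.≤-refl
distV-edge (node i zero) (node j (suc b)) root e = s≤s z≤n
distV-edge (node i zero) (node j (suc b)) (node l c) e with refl ← ≡ᵇ-true i j e with i ≡ᵇ l
distV-edge (node i zero) (node i (suc b)) (node l zero)    e | true = z≤n
distV-edge (node i zero) (node i (suc b)) (node l (suc c)) e | true = s≤s z≤n
... | false = ℕₚ.m≤n+m (suc (depth c)) 2
distV-edge (node i (suc a)) (node j zero) root e = ℕₚ.≤-refl
distV-edge (node i (suc a)) (node j zero) (node l c) e with refl ← ≡ᵇ-true i j e with i ≡ᵇ l
distV-edge (node i (suc a)) (node i zero) (node l zero)    e | true = ℕₚ.≤-refl
distV-edge (node i (suc a)) (node i zero) (node l (suc c)) e | true = siblingDistance≤2 (suc a) (suc c)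
... | false = ℕₚ.≤-refl

data Valid (k L : ℕ) : Vertex → Set where
  root : Valid k L root
  node : ∀ {i a} → i < k → a ≤ L → Valid k L (node i a)

-- The type `Vertex` has infinitely many hubs and leaves, so the next vertex on a geodesic must also
-- be shown to lie in the finite tree. It is the root, the hub of one of the endpoints, or the
-- target itself.
distV-descent : ∀ {k L} u v n → Valid k L u → Valid k L v → distV u v ≡ suc n →
  ∃ λ w → Valid k L w × adjV u w ≡ true × distV w v ≡ n
distV-descent root (node j zero) .0 p (node q r) refl =
  node j zero , node q z≤n , refl , distV-refl (node j zero)
distV-descent root (node j (suc b)) .1 p (node q r) refl =
  node j zero , node q z≤n , refl , cong (if_then 1 else 3) (≡ᵇ-refl j)
distV-descent (node i zero) root .0 p q refl = root , root , refl , refl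
distV-descent (node i (suc a)) root .1 (node p r) q refl = node i zero , node p z≤n , ≡ᵇ-refl i , refl
distV-descent (node i zero) (node j b) n p q e with i ≡ᵇ j in eq
distV-descent (node i zero) (node j (suc b)) .0 p q refl | true =
  node j (suc b) , q , eq , distV-refl (node j (suc b))
... | false = root , root , refl , ℕₚ.suc-injective e
distV-descent (node i (suc a)) (node j b) n (node p r) q e with i ≡ᵇ j in eq
distV-descent (node i (suc a)) (node j zero) .0 (node p r) q refl | true =
  node i zero , node p z≤n , ≡ᵇ-refl i , cong (if_then 0 else 2) eq
distV-descent (node i (suc a)) (node j (suc b)) n (node p r) q e | true with a ≡ᵇ b
distV-descent (node i (suc a)) (node j (suc b)) .1 (node p r) q refl | true | false =
  node i zero , node p z≤n , ≡ᵇ-refl i , cong (if_then 1 else 3) eq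
distV-descent (node i (suc a)) (node j b) n (node p r) q e | false =
  node i zero , node p z≤n , ≡ᵇ-refl i ,
  trans (cong (if_then siblingDistance 0 b else suc (depth b)) eq) (ℕₚ.suc-injective e)

-- Enumeration of the vertices, number of edges, the tree

leaves : ℕ → ℕ → List Vertex
leaves i zero    = []
leaves i (suc l) = node i (suc l) ∷ leaves i l

-- This is the order of elimination: the newest hub, its leaves, then all earlier clusters. The
-- vertex at the head always carries a larger index than the comparable ones after it, which makes
-- distinctness and non-adjacency a matter of inequalities.
clusters : ℕ → ℕ → List Vertex
clusters zero    L = []
clusters (suc k) L = node k 0 ∷ leaves k L ++ clusters k L

vertices : ℕ → ℕ → List Vertex
vertices k L = root ∷ clusters k L

data Leaf (k l : ℕ) : Vertex → Set where
  leaf : ∀ {a} → a < l → Leaf k l (node k (suc a))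

data Below (k L : ℕ) : Vertex → Set where
  below : ∀ {i a} → i < k → a ≤ L → Below k L (node i a)

leaf-suc : ∀ {k l v} → Leaf k l v → Leaf k (suc l) v
leaf-suc (leaf lt) = leaf (ℕₚ.m<n⇒m<1+n lt)

below-suc : ∀ {k L v} → Below k L v → Below (suc k) L v
below-suc (below lt le) = below (ℕₚ.m<n⇒m<1+n lt) le

below-leaf : ∀ {k L v} → Leaf k L v → Below (suc k) L v
below-leaf (leaf lt) = below ℕₚ.≤-refl lt

below-valid : ∀ {k L v} → Below k L v → Valid k L v
below-valid (below lt le) = node lt le

all-leaves : ∀ k l → All (Leaf k l) (leaves k l)
all-leaves k zero    = []
all-leaves k (suc l) = leaf ℕₚ.≤-refl ∷ All.map leaf-suc (all-leaves k l)

all-clusters : ∀ k L → All (Below k L) (clusters k L)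
all-clusters zero    L = []
all-clusters (suc k) L = below ℕₚ.≤-refl z≤n ∷
  Allₚ.++⁺ (All.map below-leaf (all-leaves k L)) (All.map below-suc (all-clusters k L))

all-vertices : ∀ k L → All (Valid k L) (vertices k L)
all-vertices k L = root ∷ All.map below-valid (all-clusters k L)

leaf-∈ : ∀ k {a l} → a < l → node k (suc a) ∈ leaves k l
leaf-∈ k {a} {suc l} lt with ℕₚ.m≤n⇒m<n∨m≡n (ℕ.s≤s⁻¹ lt)
... | inj₁ a<l  = there (leaf-∈ k a<l)
... | inj₂ refl = here refl

cluster-∈ : ∀ {k L i a} → i < k → a ≤ L → node i a ∈ clusters k L
cluster-∈ {suc k} {L} {i} {a} lt le with ℕₚ.m≤n⇒m<n∨m≡n (ℕ.s≤s⁻¹ lt)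
... | inj₁ i<k = there (∈-++⁺ʳ (leaves k L) (cluster-∈ i<k le))
cluster-∈ {suc k} {L} {i} {zero}  lt le | inj₂ refl = here refl
cluster-∈ {suc k} {L} {i} {suc a} lt le | inj₂ refl = there (∈-++⁺ˡ (leaf-∈ k le))

valid-∈ : ∀ {k L v} → Valid k L v → v ∈ vertices k L
valid-∈ root         = here refl
valid-∈ (node lt le) = there (cluster-∈ lt le)

leaves-unique : ∀ k l (vs : List Vertex) → All (Below k l) vs → Unique vs → ∀ l′ → Unique (leaves k l′ ++ vs)
leaves-unique k l vs bs u zero     = u
leaves-unique k l vs bs u (suc l′) =
  Allₚ.++⁺ (All.map fresh (all-leaves k l′)) (All.map other bs) ∷ leaves-unique k l vs bs u l′
  where
  fresh : ∀ {v} → Leaf k l′ v → node k (suc l′) ≢ v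
  fresh (leaf lt) refl = ℕₚ.<-irrefl refl lt
  other : ∀ {v} → Below k l v → node k (suc l′) ≢ v
  other (below lt le) refl = ℕₚ.<-irrefl refl lt

clusters-unique : ∀ k L → Unique (clusters k L)
clusters-unique zero    L = []
clusters-unique (suc k) L =
  Allₚ.++⁺ (All.map (λ { (leaf lt) () }) (all-leaves k L)) (All.map other (all-clusters k L))
  ∷ leaves-unique k L (clusters k L) (all-clusters k L) (clusters-unique k L) L
  where
  other : ∀ {v} → Below k L v → node k 0 ≢ v
  other (below lt le) refl = ℕₚ.<-irrefl refl lt

vertices-unique : ∀ k L → Unique (vertices k L)
vertices-unique k L = All.map (λ { (below _ _) () }) (all-clusters k L) ∷ clusters-unique k L

unique-lookup : ∀ {vs : List Vertex} → Unique vs → ∀ i j → lookup vs i ≡ lookup vs j → i ≡ j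
unique-lookup (v∉ ∷ u) zero    zero    e = refl
unique-lookup (v∉ ∷ u) zero    (suc j) e = contradiction e (All.lookup v∉ (∈-lookup j))
unique-lookup (v∉ ∷ u) (suc i) zero    e = contradiction (≡-sym e) (All.lookup v∉ (∈-lookup i))
unique-lookup (v∉ ∷ u) (suc i) (suc j) e = cong suc (unique-lookup u i j e)

leaves-length : ∀ k l vs → List.length (leaves k l ++ vs) ≡ l ℕ.+ List.length vs
leaves-length k zero    vs = refl
leaves-length k (suc l) vs = cong suc (leaves-length k l vs)

clusters-length : ∀ k L → List.length (clusters k L) ≡ k ℕ.* suc L
clusters-length zero    L = refl
clusters-length (suc k) L = cong suc (trans (leaves-length k L (clusters k L)) (cong (L ℕ.+_) (clusters-length k L)))

count : (Vertex → Bool) → List Vertex → ℕ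
count p []       = 0
count p (v ∷ vs) = (if p v then 1 else 0) ℕ.+ count p vs

-- Each edge is counted at the endpoint that comes first in the list, as the condition
-- `toℕ i < toℕ j` in `edgeCount` demands.
laterEdges : List Vertex → ℕ
laterEdges []       = 0
laterEdges (v ∷ vs) = count (adjV v) vs ℕ.+ laterEdges vs

listGraph : (vs : List Vertex) → Graph (List.length vs)
listGraph vs = record
  { adj    = λ i j → adjV (lookup vs i) (lookup vs j)
  ; sym    = λ i j → adjV-sym (lookup vs i) (lookup vs j)
  ; irrefl = λ i → adjV-irrefl (lookup vs i)
  }

sumFin-count : ∀ (p : Vertex → Bool) vs → sumFin (λ j → if p (lookup vs j) then 1 else 0) ≡ count p vs
sumFin-count p []       = refl
sumFin-count p (v ∷ vs) = cong (_ ℕ.+_) (sumFin-count p vs)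

edgeCount-list : ∀ vs → edgeCount (listGraph vs) ≡ laterEdges vs
edgeCount-list []       = refl
-- The comparison of `toℕ` values computes: entries on and below the diagonal in the first row and
-- column reduce to 0, and the rest is the double sum for `vs`.
edgeCount-list (v ∷ vs) = cong₂ ℕ._+_ (sumFin-count (adjV v) vs) (edgeCount-list vs)

count-none : ∀ p vs → All (λ v → p v ≡ false) vs → count p vs ≡ 0
count-none p []       []       = refl
count-none p (v ∷ vs) (e ∷ es) = cong₂ ℕ._+_ (cong (if_then 1 else 0) e) (count-none p vs es)

later-leaves : ∀ k L l → laterEdges (leaves k l ++ clusters k L) ≡ laterEdges (clusters k L)
later-leaves k L zero    = refl
later-leaves k L (suc l) = cong₂ ℕ._+_
  (count-none (adjV (node k (suc l))) _ (Allₚ.++⁺ (All.map (λ { (leaf _) → refl }) (all-leaves k l)) (All.map other (all-clusters k L))))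
  (later-leaves k L l)
  where
  other : ∀ {v} → Below k L v → adjV (node k (suc l)) v ≡ false
  other (below {i} {zero}  lt le) = ≡ᵇ-false k i λ { refl → ℕₚ.<-irrefl refl lt }
  other (below {i} {suc a} lt le) = refl

count-leaves : ∀ k L l → count (adjV (node k 0)) (leaves k l ++ clusters k L) ≡ l
count-leaves k L zero    = count-none (adjV (node k 0)) _ (All.map other (all-clusters k L))
  where
  other : ∀ {v} → Below k L v → adjV (node k 0) v ≡ false
  other (below {i} {zero}  lt le) = refl
  other (below {i} {suc a} lt le) = ≡ᵇ-false k i λ { refl → ℕₚ.<-irrefl refl lt }
count-leaves k L (suc l) = cong₂ ℕ._+_ (cong (if_then 1 else 0) (≡ᵇ-refl k)) (count-leaves k L l)

later-clusters : ∀ k L → laterEdges (clusters k L) ≡ k ℕ.* L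
later-clusters zero    L = refl
later-clusters (suc k) L = cong₂ ℕ._+_ (count-leaves k L L) (trans (later-leaves k L L) (later-clusters k L))

count-children : ∀ k L → count (adjV root) (clusters k L) ≡ k
count-children zero    L = refl
count-children (suc k) L = cong suc (trans (skip L) (count-children k L))
  where
  skip : ∀ l → count (adjV root) (leaves k l ++ clusters k L) ≡ count (adjV root) (clusters k L)
  skip zero    = refl
  skip (suc l) = skip l

edgeCount-vertices : ∀ k L → edgeCount (listGraph (vertices k L)) ≡ List.length (vertices k L) ∸ 1
edgeCount-vertices k L = begin
  edgeCount (listGraph (vertices k L))  ≡⟨ edgeCount-list (vertices k L) ⟩
  laterEdges (vertices k L)             ≡⟨ cong₂ ℕ._+_ (count-children k L) (later-clusters k L) ⟩
  k ℕ.+ k ℕ.* L                         ≡⟨ ℕₚ.*-suc k L ⟨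
  k ℕ.* suc L                           ≡⟨ clusters-length k L ⟨
  List.length (clusters k L)            ∎
  where open ≡-Reasoning

module _ (k L : ℕ) where
  private
    G : Graph (List.length (vertices k L))
    G = listGraph (vertices k L)
    at : Fin (List.length (vertices k L)) → Vertex
    at = lookup (vertices k L)

  lookup-valid : ∀ u → Valid k L (at u)
  lookup-valid u = All.lookup (all-vertices k L) (∈-lookup {xs = vertices k L} u)

  lookup-distinct : ∀ u v → at u ≡ at v → u ≡ v
  lookup-distinct u v = unique-lookup (vertices-unique k L) u v

  descent : ∀ u v n → distV (at u) (at v) ≡ suc n → ∃ λ w → adj G u w ≡ true × distV (at w) (at v) ≡ n
  descent u v n e with distV-descent (at u) (at v) n (lookup-valid u) (lookup-valid v) e
  ... | w , valid , uw , wv =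
        Any.index w∈ ,
        trans (cong (adjV (at u)) (≡-sym (Anyₚ.lookup-index w∈))) uw ,
        trans (cong (λ x → distV x (at v)) (≡-sym (Anyₚ.lookup-index w∈))) wv
    where
    w∈ : w ∈ vertices k L
    w∈ = valid-∈ valid

  open GraphDistance G (λ u v → distV (at u) (at v)) (λ u → distV-refl (at u))
    (λ u v e → lookup-distinct u v (distV-zero (at u) (at v) e))
    (λ u w v → distV-edge (at u) (at w) (at v)) descent public

  tree : Tree
  tree = record
    { N         = List.length (vertices k L)
    ; graph     = G
    ; nonempty  = s≤s z≤n
    ; connected = λ u v → walk (distV (at u) (at v)) u v refl
    ; edges     = edgeCount-vertices k L
    }

  -- `dist` searches only up to the number of vertices, and the tree has distances up to 4; hence
  -- the condition on the size.
  dist-tree : 4 ≤ List.length (vertices k L) → ∀ u v → dist G u v ≡ distV (at u) (at v)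
  dist-tree le u v = dist-unique u v (ℕₚ.≤-trans (distV≤4 (at u) (at v)) le)

eqV : Vertex → Vertex → Bool
eqV root       root       = true
eqV root       (node j b) = false
eqV (node i a) root       = false
eqV (node i a) (node j b) = (i ≡ᵇ j) ∧ (a ≡ᵇ b)

eqV-refl : ∀ u → eqV u u ≡ true
eqV-refl root       = refl
eqV-refl (node i a) = cong₂ _∧_ (≡ᵇ-refl i) (≡ᵇ-refl a)

eqV-true : ∀ u v → eqV u v ≡ true → u ≡ v
eqV-true root       root       e = refl
eqV-true (node i a) (node j b) e =
  let p , q = ∧-true (i ≡ᵇ j) e in cong₂ node (≡ᵇ-true i j p) (≡ᵇ-true a b q)

-- The list has no repetitions, so the identity matrix can be described by labels instead of
-- positions.
does-≟-lookup : ∀ k L (i j : Fin (List.length (vertices k L))) →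
  does (i ≟ j) ≡ eqV (lookup (vertices k L) i) (lookup (vertices k L) j)
does-≟-lookup k L i j with i ≟ j
... | yes refl = ≡-sym (eqV-refl (lookup (vertices k L) i))
... | no  i≢j with eqV (lookup (vertices k L) i) (lookup (vertices k L) j) in eq
...   | true  = contradiction (lookup-distinct k L i j (eqV-true _ _ eq)) i≢j
...   | false = refl

-- Sums over the vertex list

⟦_⟧ : Bool → ℤ
⟦ b ⟧ = if b then + 1 else + 0

lsum-++ : {V : Set} (us vs : List V) (g : V → ℤ) → lsum (us ++ vs) g ≡ lsum us g + lsum vs g
lsum-++ []       vs g = ≡-sym (ℤₚ.+-identityˡ _)
lsum-++ (u ∷ us) vs g = trans (cong (λ z → g u + z) (lsum-++ us vs g)) (≡-sym (ℤₚ.+-assoc (g u) (lsum us g) (lsum vs g)))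

⟦≡⟧+⟦<⟧ : ∀ a l → ⟦ a ≡ᵇ l ⟧ + ⟦ a <ᵇ l ⟧ ≡ ⟦ a <ᵇ suc l ⟧
⟦≡⟧+⟦<⟧ zero    zero    = refl
⟦≡⟧+⟦<⟧ zero    (suc l) = refl
⟦≡⟧+⟦<⟧ (suc a) zero    = refl
⟦≡⟧+⟦<⟧ (suc a) (suc l) = ⟦≡⟧+⟦<⟧ a l

⟦<⟧-true : ∀ {a l} → a < l → ⟦ a <ᵇ l ⟧ ≡ + 1
⟦<⟧-true {zero}  (s≤s lt) = refl
⟦<⟧-true {suc a} (s≤s lt) = ⟦<⟧-true lt

module _ (c d : ℤ) where
  open ≡-Reasoning

  private
    step′ : ∀ l p q r → p + q ≡ r → (c + p * d) + (l * c + q * d) ≡ (+ 1 + l) * c + r * d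
    step′ l p q .(p + q) refl = lem c d l p q
      where
      lem : ∀ c d l p q → (c + p * d) + (l * c + q * d) ≡ (+ 1 + l) * c + (p + q) * d
      lem = solve-∀
    base : ∀ c d → + 0 ≡ + 0 * c + + 0 * d
    base = solve-∀

  -- In a row of the matrices considered, all entries at the leaves of a cluster agree except
  -- possibly the one on the diagonal, which deviates by `d`. Rows without such an exception use
  -- `a = 0` and `d = 0`. Keeping the bracket as a ring element avoids case distinctions in the
  -- identities that follow.
  lsum-leaves : ∀ k l a (g : Vertex → ℤ) → (∀ b → g (node k (suc b)) ≡ c + ⟦ a ≡ᵇ b ⟧ * d) →
    lsum (leaves k l) g ≡ + l * c + ⟦ a <ᵇ l ⟧ * d
  lsum-leaves k zero    a g e = base c d
  lsum-leaves k (suc l) a g e = trans (cong₂ _+_ (e l) (lsum-leaves k l a g e))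
    (step′ (+ l) ⟦ a ≡ᵇ l ⟧ ⟦ a <ᵇ l ⟧ ⟦ a <ᵇ suc l ⟧ (⟦≡⟧+⟦<⟧ a l))

  lsum-clusters : ∀ k L i (g : Vertex → ℤ) →
    (∀ j → g (node j 0) + lsum (leaves j L) g ≡ c + ⟦ i ≡ᵇ j ⟧ * d) →
    lsum (clusters k L) g ≡ + k * c + ⟦ i <ᵇ k ⟧ * d
  lsum-clusters zero    L i g e = base c d
  lsum-clusters (suc k) L i g e = begin
    g (node k 0) + lsum (leaves k L ++ clusters k L) g
      ≡⟨ cong (λ z → g (node k 0) + z) (lsum-++ (leaves k L) (clusters k L) g) ⟩
    g (node k 0) + (lsum (leaves k L) g + lsum (clusters k L) g)
      ≡⟨ ℤₚ.+-assoc (g (node k 0)) (lsum (leaves k L) g) (lsum (clusters k L) g) ⟨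
    (g (node k 0) + lsum (leaves k L) g) + lsum (clusters k L) g
      ≡⟨ cong₂ _+_ (e k) (lsum-clusters k L i g e) ⟩
    (c + ⟦ i ≡ᵇ k ⟧ * d) + (+ k * c + ⟦ i <ᵇ k ⟧ * d)
      ≡⟨ step′ (+ k) ⟦ i ≡ᵇ k ⟧ ⟦ i <ᵇ k ⟧ ⟦ i <ᵇ suc k ⟧ (⟦≡⟧+⟦<⟧ i k) ⟩
    + suc k * c + ⟦ i <ᵇ suc k ⟧ * d ∎

-- The adjacency characteristic polynomial at an integer point

charA : ℤ → Vertex → Vertex → ℤ
charA x u v = - ⟦ adjV u v ⟧ + x * (⟦ eqV u v ⟧ + x * + 0)

charA-values : ∀ x u v {p q} → adjV u v ≡ p → eqV u v ≡ q → charA x u v ≡ - ⟦ p ⟧ + x * ⟦ q ⟧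
charA-values x u v {p} {q} refl refl = lem x ⟦ adjV u v ⟧ ⟦ eqV u v ⟧
  where
  lem : ∀ x p q → - p + x * (q + x * + 0) ≡ - p + x * q
  lem = solve-∀

charA-self : ∀ x u → charA x u u ≡ x
charA-self x u = trans (charA-values x u u (adjV-irrefl u) (eqV-refl u)) (lem x)
  where
  lem : ∀ x → - (+ 0) + x * + 1 ≡ x
  lem = solve-∀

charA-none : ∀ x u v → adjV u v ≡ false → eqV u v ≡ false → charA x u v ≡ + 0
charA-none x u v p q = trans (charA-values x u v p q) (lem x)
  where
  lem : ∀ x → - (+ 0) + x * + 0 ≡ + 0
  lem = solve-∀

charA-apart : ∀ x {i k} a b → i < k → charA x (node i a) (node k b) ≡ + 0
charA-apart x {i} {k} zero    zero    lt = charA-none x (node i 0) (node k 0) refl (cong (_∧ true) (≡ᵇ-false i k (ℕₚ.<⇒≢ lt)))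
charA-apart x {i} {k} zero    (suc b) lt = charA-none x (node i 0) (node k (suc b)) (≡ᵇ-false i k (ℕₚ.<⇒≢ lt)) (cong (_∧ false) (≡ᵇ-false i k (ℕₚ.<⇒≢ lt)))
charA-apart x {i} {k} (suc a) zero    lt = charA-none x (node i (suc a)) (node k 0) (≡ᵇ-false i k (ℕₚ.<⇒≢ lt)) (cong (_∧ false) (≡ᵇ-false i k (ℕₚ.<⇒≢ lt)))
charA-apart x {i} {k} (suc a) (suc b) lt = charA-none x (node i (suc a)) (node k (suc b)) refl (cong (_∧ (a ≡ᵇ b)) (≡ᵇ-false i k (ℕₚ.<⇒≢ lt)))

charA-hubs : ∀ x i j → charA x (node i 0) (node j 0) ≡ x * ⟦ i ≡ᵇ j ⟧
charA-hubs x i j with i ≡ᵇ j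
... | true  = lem x
  where
  lem : ∀ x → - (+ 0) + x * (+ 1 + x * + 0) ≡ x * + 1
  lem = solve-∀
... | false = lem x
  where
  lem : ∀ x → - (+ 0) + x * (+ 0 + x * + 0) ≡ x * + 0
  lem = solve-∀

charA-hub-leaf′ : ∀ x i j b → charA x (node i 0) (node j (suc b)) ≡ - ⟦ i ≡ᵇ j ⟧
charA-hub-leaf′ x i j b with i ≡ᵇ j
... | true  = lem x
  where
  lem : ∀ x → - (+ 1) + x * (+ 0 + x * + 0) ≡ - + 1
  lem = solve-∀
... | false = lem x
  where
  lem : ∀ x → - (+ 0) + x * (+ 0 + x * + 0) ≡ - + 0
  lem = solve-∀

charA-leaf-hub′ : ∀ x i a j → charA x (node i (suc a)) (node j 0) ≡ - ⟦ i ≡ᵇ j ⟧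
charA-leaf-hub′ x i a j with i ≡ᵇ j
... | true  = lem x
  where
  lem : ∀ x → - (+ 1) + x * (+ 0 + x * + 0) ≡ - + 1
  lem = solve-∀
... | false = lem x
  where
  lem : ∀ x → - (+ 0) + x * (+ 0 + x * + 0) ≡ - + 0
  lem = solve-∀

charA-leaves′ : ∀ x i a j b → charA x (node i (suc a)) (node j (suc b)) ≡ x * (⟦ i ≡ᵇ j ⟧ * ⟦ a ≡ᵇ b ⟧)
charA-leaves′ x i a j b with i ≡ᵇ j
... | true  = lem x ⟦ a ≡ᵇ b ⟧
  where
  lem : ∀ x q → - (+ 0) + x * (q + x * + 0) ≡ x * (+ 1 * q)
  lem = solve-∀
... | false = lem x ⟦ a ≡ᵇ b ⟧
  where
  lem : ∀ x q → - (+ 0) + x * (+ 0 + x * + 0) ≡ x * (+ 0 * q)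
  lem = solve-∀

charA-leaves : ∀ x k a b → charA x (node k (suc a)) (node k (suc b)) ≡ x * ⟦ a ≡ᵇ b ⟧
charA-leaves x k a b = trans (charA-leaves′ x k a k b)
  (cong (λ z → x * z) (trans (cong (λ z → ⟦ z ⟧ * ⟦ a ≡ᵇ b ⟧) (≡ᵇ-refl k)) (ℤₚ.*-identityˡ ⟦ a ≡ᵇ b ⟧)))

charA-hub-leaf : ∀ x k b → charA x (node k 0) (node k (suc b)) ≡ - + 1
charA-hub-leaf x k b = trans (charA-hub-leaf′ x k k b) (cong (λ z → - ⟦ z ⟧) (≡ᵇ-refl k))

charA-leaf-hub : ∀ x k a → charA x (node k (suc a)) (node k 0) ≡ - + 1
charA-leaf-hub x k a = trans (charA-leaf-hub′ x k a k) (cong (λ z → - ⟦ z ⟧) (≡ᵇ-refl k))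

-- Once their hub is eliminated the leaves are isolated vertices, each contributing its diagonal
-- entry `x`.
adj-leaves : ∀ x k L l → listDet (charA x) (leaves k l ++ clusters k L) ≡ x ^ l * listDet (charA x) (clusters k L)
adj-leaves x k L zero    = ≡-sym (ℤₚ.*-identityˡ _)
adj-leaves x k L (suc l) = begin
  D (leaves k (suc l) ++ clusters k L)        ≡⟨ ℤₚ.*-identityˡ _ ⟨
  + 1 * D (leaves k (suc l) ++ clusters k L)  ≡⟨ cramer-block (charA x) (λ _ → + 1) x v [] (leaves k l ++ clusters k L)
      (trans (cong (λ z → z * + 1 + + 0) (charA-self x v)) (lem x)) []
      (Allₚ.++⁺ (All.map own (all-leaves k l)) (All.map other (all-clusters k L))) ⟩
  x * D (leaves k l ++ clusters k L)          ≡⟨ cong (λ z → x * z) (adj-leaves x k L l) ⟩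
  x * (x ^ l * D (clusters k L))              ≡⟨ ℤₚ.*-assoc x (x ^ l) (D (clusters k L)) ⟨
  x ^ suc l * D (clusters k L)                ∎
  where
  open ≡-Reasoning
  D : List Vertex → ℤ
  D = listDet (charA x)
  v : Vertex
  v = node k (suc l)
  lem : ∀ x → x * + 1 + + 0 ≡ x
  lem = solve-∀
  own : ∀ {u} → Leaf k l u → All (λ w → charA x u w ≡ + 0) (v ∷ [])
  own (leaf {a} lt) = trans (charA-leaves x k a l)
    (trans (cong (λ z → x * ⟦ z ⟧) (≡ᵇ-false a l (ℕₚ.<⇒≢ lt))) (ℤₚ.*-zeroʳ x)) ∷ []
  other : ∀ {u} → Below k L u → All (λ w → charA x u w ≡ + 0) (v ∷ [])
  other (below {i} {a} lt le) = charA-apart x a (suc l) lt ∷ []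

-- All hubs look alike and all leaves look alike, so a solution vector may be taken constant on each
-- level. The three arguments are its values at the root, the hubs and the leaves.
hubWeight : ℤ → ℤ → ℤ → Vertex → ℤ
hubWeight r h l root             = r
hubWeight r h l (node i zero)    = h
hubWeight r h l (node i (suc a)) = l

-- With weight `x` on the hub and 1 on its leaves, each leaf row gives `- x + x`, and the hub row
-- gives `x² - L`.
adj-cluster : ∀ x k L →
  x * listDet (charA x) (clusters (suc k) L) ≡ (x * x + - + L) * (x ^ L * listDet (charA x) (clusters k L))
adj-cluster x k L = trans
  (cramer-block (charA x) μ (x * x + - + L) (node k 0) (leaves k L) (clusters k L) row₀
    (All.map rows (all-leaves k L))
    (All.map other (all-clusters k L)))
  (cong (λ z → (x * x + - + L) * z) (adj-leaves x k L L))
  where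
  μ : Vertex → ℤ
  μ = hubWeight (+ 0) x (+ 1)
  row₀ : lsum (node k 0 ∷ leaves k L) (λ w → charA x (node k 0) w * μ w) ≡ x * x + - + L
  row₀ = trans (cong₂ (λ u v → u * x + v) (charA-self x (node k 0))
           (lsum-leaves (- + 1) (+ 0) k L 0 (λ w → charA x (node k 0) w * μ w) (λ b →
             trans (cong (λ z → z * + 1) (charA-hub-leaf x k b)) (lem ⟦ 0 ≡ᵇ b ⟧))))
           (lem′ x (+ L) ⟦ 0 <ᵇ L ⟧)
    where
    lem : ∀ p → - + 1 * + 1 ≡ - + 1 + p * + 0
    lem = solve-∀
    lem′ : ∀ x L p → x * x + (L * - + 1 + p * + 0) ≡ x * x + - L
    lem′ = solve-∀
  rows : ∀ {u} → Leaf k L u → lsum (node k 0 ∷ leaves k L) (λ w → charA x u w * μ w) ≡ + 0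
  rows (leaf {a} lt) = trans (cong₂ (λ u v → u * x + v) (charA-leaf-hub x k a)
      (lsum-leaves (+ 0) x k L a (λ w → charA x (node k (suc a)) w * μ w) (λ b →
        trans (cong (λ z → z * + 1) (charA-leaves x k a b)) (lem x ⟦ a ≡ᵇ b ⟧))))
    (trans (cong (λ z → - + 1 * x + (+ L * + 0 + z * x)) (⟦<⟧-true lt)) (lem′ x (+ L)))
    where
    lem : ∀ x p → x * p * + 1 ≡ + 0 + p * x
    lem = solve-∀
    lem′ : ∀ x L → - + 1 * x + (L * + 0 + + 1 * x) ≡ + 0
    lem′ = solve-∀
  other : ∀ {u} → Below k L u → All (λ w → charA x u w ≡ + 0) (node k 0 ∷ leaves k L)
  other (below {i} {a} lt le) = charA-apart x a 0 lt ∷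
    All.map (λ { (leaf {b} _) → charA-apart x a (suc b) lt }) (all-leaves k L)

adj-root : ∀ x k L →
  (x * x + - + L) * listDet (charA x) (vertices k L) ≡ (x * (x * x + - (+ L + + k))) * listDet (charA x) (clusters k L)
adj-root x k L = subst (λ vs → (x * x + - + L) * listDet (charA x) (root ∷ vs) ≡ c * listDet (charA x) vs)
  (Listₚ.++-identityʳ (clusters k L))
  (cramer-block (charA x) μ c root (clusters k L) [] row₀ (All.map rows (all-clusters k L)) [])
  where
  c : ℤ
  c = x * (x * x + - (+ L + + k))
  μ : Vertex → ℤ
  -- Determined from the bottom up: a leaf row forces hub weight `x` for leaf weight 1, and a hub
  -- row then forces `x² - L` at the root. The root row leaves `x (x² - L) - k x`.
  μ = hubWeight (x * x + - + L) x (+ 1)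
  row₀ : lsum (root ∷ clusters k L) (λ w → charA x root w * μ w) ≡ c
  row₀ = trans (cong₂ (λ u v → u * (x * x + - + L) + v) (charA-self x root)
      (lsum-clusters (- x) (+ 0) k L 0 (λ w → charA x root w * μ w) (λ j →
        trans (cong (λ z → (- + 1 + x * (+ 0 + x * + 0)) * x + z)
                (lsum-leaves (+ 0) (+ 0) j L 0 (λ w → charA x root w * μ w) (λ b → lem₀ x ⟦ 0 ≡ᵇ b ⟧)))
              (lem₁ x (+ L) ⟦ 0 <ᵇ L ⟧ ⟦ 0 ≡ᵇ j ⟧))))
    (lem₂ x (+ L) (+ k) ⟦ 0 <ᵇ k ⟧)
    where
    lem₀ : ∀ x p → (- + 0 + x * (+ 0 + x * + 0)) * + 1 ≡ + 0 + p * + 0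
    lem₀ = solve-∀
    lem₁ : ∀ x L p q → (- + 1 + x * (+ 0 + x * + 0)) * x + (L * + 0 + p * + 0) ≡ - x + q * + 0
    lem₁ = solve-∀
    lem₂ : ∀ x L k p → x * (x * x + - L) + (k * - x + p * + 0) ≡ x * (x * x + - (L + k))
    lem₂ = solve-∀
  rows : ∀ {u} → Below k L u → lsum (root ∷ clusters k L) (λ w → charA x u w * μ w) ≡ + 0
  rows (below {i} {zero} lt le) = trans (cong (λ v → (- + 1 + x * (+ 0 + x * + 0)) * (x * x + - + L) + v)
      (lsum-clusters (+ 0) (x * x + - + L) k L i g (λ j →
        trans (cong₂ (λ u v → u * x + v) (charA-hubs x i j)
                (lsum-leaves (- ⟦ i ≡ᵇ j ⟧) (+ 0) j L 0 g (λ b →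
                  trans (cong (λ z → z * + 1) (charA-hub-leaf′ x i j b)) (lem₀ ⟦ i ≡ᵇ j ⟧ ⟦ 0 ≡ᵇ b ⟧))))
              (lem₁ x (+ L) ⟦ i ≡ᵇ j ⟧ ⟦ 0 <ᵇ L ⟧))))
    (trans (cong (λ z → (- + 1 + x * (+ 0 + x * + 0)) * (x * x + - + L) + (+ k * + 0 + z * (x * x + - + L))) (⟦<⟧-true lt))
           (lem₂ x (+ L) (+ k)))
    where
    g : Vertex → ℤ
    g w = charA x (node i 0) w * μ w
    lem₀ : ∀ p q → - p * + 1 ≡ - p + q * + 0
    lem₀ = solve-∀
    lem₁ : ∀ x L p q → x * p * x + (L * - p + q * + 0) ≡ + 0 + p * (x * x + - L)
    lem₁ = solve-∀
    lem₂ : ∀ x L k → (- + 1 + x * (+ 0 + x * + 0)) * (x * x + - L) + (k * + 0 + + 1 * (x * x + - L)) ≡ + 0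
    lem₂ = solve-∀
  rows (below {i} {suc a} lt le) = trans (cong (λ v → (- + 0 + x * (+ 0 + x * + 0)) * (x * x + - + L) + v)
      (lsum-clusters (+ 0) (+ 0) k L i g (λ j →
        trans (cong₂ (λ u v → u * x + v) (charA-leaf-hub′ x i a j)
                (lsum-leaves (+ 0) (x * ⟦ i ≡ᵇ j ⟧) j L a g (λ b →
                  trans (cong (λ z → z * + 1) (charA-leaves′ x i a j b)) (lem₀ x ⟦ i ≡ᵇ j ⟧ ⟦ a ≡ᵇ b ⟧))))
              (trans (cong (λ z → - ⟦ i ≡ᵇ j ⟧ * x + (+ L * + 0 + z * (x * ⟦ i ≡ᵇ j ⟧))) (⟦<⟧-true le))
                     (lem₁ x (+ L) ⟦ i ≡ᵇ j ⟧)))))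
    (lem₂ x (+ L) (+ k) ⟦ i <ᵇ k ⟧)
    where
    g : Vertex → ℤ
    g w = charA x (node i (suc a)) w * μ w
    lem₀ : ∀ x p q → x * (p * q) * + 1 ≡ + 0 + q * (x * p)
    lem₀ = solve-∀
    lem₁ : ∀ x L p → - p * x + (L * + 0 + + 1 * (x * p)) ≡ + 0 + p * + 0
    lem₁ = solve-∀
    lem₂ : ∀ x L k p → (- + 0 + x * (+ 0 + x * + 0)) * (x * x + - L) + (k * + 0 + p * + 0) ≡ + 0
    lem₂ = solve-∀

cancel-nonzero : ∀ a {b c} → a ≢ + 0 → a * b ≡ a * c → b ≡ c
cancel-nonzero a {b} {c} ne e = ℤₚ.*-cancelˡ-≡ a b c {{ℤ.≢-nonZero ne}} e

^-distrib-* : ∀ a b n → (a * b) ^ n ≡ a ^ n * b ^ n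
^-distrib-* a b zero    = refl
^-distrib-* a b (suc n) = trans (cong (λ z → a * b * z) (^-distrib-* a b n)) (lem a b (a ^ n) (b ^ n))
  where
  lem : ∀ a b x y → a * b * (x * y) ≡ a * x * (b * y)
  lem = solve-∀

module _ (x : ℤ) (x≢0 : x ≢ + 0) where
  open ≡-Reasoning

  adj-clusters : ∀ k L → listDet (charA x) (clusters k (suc L)) ≡ ((x * x + - + suc L) * x ^ L) ^ k
  adj-clusters zero    L = refl
  adj-clusters (suc k) L = cancel-nonzero x x≢0 (begin
    x * listDet (charA x) (clusters (suc k) (suc L))
      ≡⟨ adj-cluster x k (suc L) ⟩
    q * (x * x ^ L * D)
      ≡⟨ cong (λ z → q * (x * x ^ L * z)) (adj-clusters k L) ⟩
    q * (x * x ^ L * (q * x ^ L) ^ k)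
      ≡⟨ lem x q (x ^ L) ((q * x ^ L) ^ k) ⟩
    x * (q * x ^ L * (q * x ^ L) ^ k) ∎)
    where
    q D : ℤ
    q = x * x + - + suc L
    D = listDet (charA x) (clusters k (suc L))
    lem : ∀ x q y z → q * (x * y * z) ≡ x * (q * y * z)
    lem = solve-∀

  adj-vertices : ∀ k L → x * x + - + suc L ≢ + 0 →
    listDet (charA x) (vertices (suc k) (suc L))
      ≡ x ^ suc (L ℕ.* suc k) * ((x * x + - + (suc L ℕ.+ suc k)) * (x * x + - + suc L) ^ k)
  adj-vertices k L q≢0 = cancel-nonzero q q≢0 (begin
    q * listDet (charA x) (vertices (suc k) (suc L))
      ≡⟨ adj-root x (suc k) (suc L) ⟩
    x * (x * x + - (+ suc L + + suc k)) * listDet (charA x) (clusters (suc k) (suc L))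
      ≡⟨ cong (λ z → x * w * z) (adj-clusters (suc k) L) ⟩
    x * w * (q * x ^ L) ^ suc k
      ≡⟨ cong (λ z → x * w * z) (^-distrib-* q (x ^ L) (suc k)) ⟩
    x * w * (q * q ^ k * (x ^ L) ^ suc k)
      ≡⟨ cong (λ z → x * w * (q * q ^ k * z)) (ℤₚ.^-*-assoc x L (suc k)) ⟩
    x * w * (q * q ^ k * x ^ (L ℕ.* suc k))
      ≡⟨ lem x w q (q ^ k) (x ^ (L ℕ.* suc k)) ⟩
    q * (x * x ^ (L ℕ.* suc k) * (w * q ^ k)) ∎)
    where
    q w : ℤ
    q = x * x + - + suc L
    w = x * x + - + (suc L ℕ.+ suc k)
    lem : ∀ x w q y z → x * w * (q * y * z) ≡ q * (x * z * (w * y))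
    lem = solve-∀

-- `charA` has the shape to which `eval` unfolds on a list of two coefficients, including the final
-- `x * + 0`. Only the test for the diagonal has to be translated from positions to vertices.
eval-CPA : ∀ k L x → eval (CPA (tree k L)) x ≡ listDet (charA x) (vertices k L)
eval-CPA k L x = trans
  (eval-detP (List.length (vertices k L)) (λ i j → - Amat (tree k L) i j ∷ δij i j ∷ []) x)
  (det-cong (List.length (vertices k L)) {λ i j → eval (- Amat (tree k L) i j ∷ δij i j ∷ []) x} {listMatrix (charA x) (vertices k L)}
    (λ i j → cong (λ b → - Amat (tree k L) i j + x * (⟦ b ⟧ + x * + 0)) (does-≟-lookup k L i j)))

-- Coefficients and peak of the adjacency polynomial

shiftP : ℕ → Poly → Poly
shiftP n p = replicate n (+ 0) ++ p

eval-shiftP : ∀ n p x → eval (shiftP n p) x ≡ x ^ n * eval p x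
eval-shiftP zero    p x = ≡-sym (ℤₚ.*-identityˡ _)
eval-shiftP (suc n) p x = trans (cong (λ z → + 0 + x * z) (eval-shiftP n p x)) (lem x (x ^ n) (eval p x))
  where
  lem : ∀ x y p → + 0 + x * (y * p) ≡ x * y * p
  lem = solve-∀

-- p(x²)
spread : Poly → Poly
spread []          = []
spread (a ∷ [])    = a ∷ []
spread (a ∷ b ∷ p) = a ∷ + 0 ∷ spread (b ∷ p)

eval-spread : ∀ p x → eval (spread p) x ≡ eval p (x * x)
eval-spread []          x = refl
eval-spread (a ∷ [])    x = cong (λ z → a + z) (trans (ℤₚ.*-zeroʳ x) (≡-sym (ℤₚ.*-zeroʳ (x * x))))
eval-spread (a ∷ b ∷ p) x = trans (cong (λ z → a + x * (+ 0 + x * z)) (eval-spread (b ∷ p) x)) (lem a x (eval (b ∷ p) (x * x)))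
  where
  lem : ∀ a x y → a + x * (+ 0 + x * y) ≡ a + x * x * y
  lem = solve-∀

spread-length : ∀ a p → List.length (spread (a ∷ p)) ≡ suc (List.length p ℕ.+ List.length p)
spread-length a []      = refl
spread-length a (b ∷ p) = cong (λ z → suc (suc z)) (trans (spread-length b p) (≡-sym (ℕₚ.+-suc (List.length p) (List.length p))))

nonzeros-shiftP : ∀ n p → nonzeros (shiftP n p) ≡ nonzeros p
nonzeros-shiftP zero    p = refl
nonzeros-shiftP (suc n) p = nonzeros-shiftP n p

nonzeros-spread : ∀ p → nonzeros (spread p) ≡ nonzeros p
nonzeros-spread []                   = refl
nonzeros-spread (a ∷ [])             = refl
nonzeros-spread (+ zero   ∷ b ∷ p) = nonzeros-spread (b ∷ p)
nonzeros-spread (+ suc n  ∷ b ∷ p) = cong (λ z → + suc n ∷ z) (nonzeros-spread (b ∷ p))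
nonzeros-spread (-[1+ n ] ∷ b ∷ p) = cong (λ z → -[1+ n ] ∷ z) (nonzeros-spread (b ∷ p))

applyUpTo-coeff : ∀ p → applyUpTo (coeff p) (List.length p) ≡ p
applyUpTo-coeff []      = refl
applyUpTo-coeff (a ∷ p) = cong (λ z → a ∷ z) (applyUpTo-coeff p)

linear : ℕ → Poly → Poly
linear a p = addP (scaleP (- + a) p) (+ 0 ∷ p)

eval-linear : ∀ a p x → eval (linear a p) x ≡ (x + - + a) * eval p x
eval-linear a p x = trans (eval-addP (scaleP (- + a) p) (+ 0 ∷ p) x)
  (trans (cong (λ z → z + (+ 0 + x * eval p x)) (eval-scaleP (- + a) p x)) (lem (+ a) x (eval p x)))
  where
  lem : ∀ a x p → - a * p + (+ 0 + x * p) ≡ (x + - a) * p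
  lem = solve-∀

-- A product of factors `x - a` with natural `a` has coefficients of alternating sign. Separating
-- the signs from the absolute values turns multiplication by such a factor into a computation in
-- the naturals, without cancellation.
alternate : ℤ → List ℕ → Poly
alternate s []       = []
alternate s (c ∷ cs) = s * + c ∷ alternate (- s) cs

-- The absolute values of the coefficients of c + x p(x) - a p(x) for alternating coefficients cs of p.
linearAbs : ℕ → ℕ → List ℕ → List ℕ
linearAbs a c []       = c ∷ []
linearAbs a c (d ∷ cs) = (c ℕ.+ a ℕ.* d) ∷ linearAbs a d cs

alternate-linearAbs : ∀ a s c cs →
  addP (scaleP (- + a) (alternate s cs)) (- s * + c ∷ alternate s cs) ≡ alternate (- s) (linearAbs a c cs)
alternate-linearAbs a s c []       = refl
alternate-linearAbs a s c (d ∷ cs) = cong₂ _∷_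
  (trans (lem s (+ a) (+ c) (+ d)) (cong (λ z → - s * z) (trans (cong (λ z → + c + z) (≡-sym (ℤₚ.pos-* a d))) (≡-sym (ℤₚ.pos-+ c (a ℕ.* d))))))
  (trans (cong (λ z → addP (scaleP (- + a) (alternate (- s) cs)) (z * + d ∷ alternate (- s) cs)) (≡-sym (ℤₚ.neg-involutive s)))
         (alternate-linearAbs a (- s) d cs))
  where
  lem : ∀ s a c d → - a * (s * d) + - s * c ≡ - s * (c + a * d)
  lem = solve-∀

linear-alternate : ∀ a s cs → linear a (alternate s cs) ≡ alternate (- s) (linearAbs a 0 cs)
linear-alternate a s cs = trans
  (cong (λ z → addP (scaleP (- + a) (alternate s cs)) (z ∷ alternate s cs)) (≡-sym (ℤₚ.*-zeroʳ (- s))))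
  (alternate-linearAbs a s 0 cs)

abs-alternate : ∀ s cs → ∣ s ∣ ≡ 1 → map ∣_∣ (alternate s cs) ≡ cs
abs-alternate s []       e = refl
abs-alternate s (c ∷ cs) e = cong₂ _∷_
  (trans (ℤₚ.abs-* s (+ c)) (trans (cong (ℕ._* c) e) (ℕₚ.*-identityˡ c)))
  (abs-alternate (- s) cs (trans (ℤₚ.∣-i∣≡∣i∣ s) e))

nonzeros-nonzero : ∀ p → All (λ n → 1 ≤ n) (map ∣_∣ p) → nonzeros p ≡ p
nonzeros-nonzero []             ps       = refl
nonzeros-nonzero (+ zero ∷ p)   (() ∷ ps)
nonzeros-nonzero (+ suc n ∷ p)  (_ ∷ ps) = cong (λ z → + suc n ∷ z) (nonzeros-nonzero p ps)
nonzeros-nonzero (-[1+ n ] ∷ p) (_ ∷ ps) = cong (λ z → -[1+ n ] ∷ z) (nonzeros-nonzero p ps)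

Descending : ℕ → List ℕ → Set
Descending c []       = ⊤
Descending c (d ∷ cs) = d ≤ c × Descending d cs

descending-bounded : ∀ c d cs → d ≤ c → Descending d cs → All (_≤ c) cs
descending-bounded c d []       d≤c tt         = []
descending-bounded c d (e ∷ cs) d≤c (e≤d , ds) = ℕₚ.≤-trans e≤d d≤c ∷ descending-bounded c e cs (ℕₚ.≤-trans e≤d d≤c) ds

headOrZero : List ℕ → ℕ
headOrZero []      = 0
headOrZero (c ∷ _) = c

descending-linearAbs : ∀ a c d cs → 1 ≤ a → d ≤ c → Descending d cs → Descending (c ℕ.+ a ℕ.* d) (linearAbs a d cs)
descending-linearAbs a c d []       1≤a d≤c tt         = ℕₚ.≤-trans d≤c (ℕₚ.m≤m+n c _) , tt
descending-linearAbs a c d (e ∷ cs) 1≤a d≤c (e≤d , ds) =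
  ℕₚ.+-mono-≤ d≤c (ℕₚ.*-monoʳ-≤ a e≤d) , descending-linearAbs a d e cs 1≤a e≤d ds

-- Satisfied by the coefficients of a product of j factors (x + a) with a ≥ n ≥ j; ratio keeps the next product descending.
record Profile (n j : ℕ) (cs : List ℕ) : Set where
  constructor profile
  field
    {constant}  : ℕ
    {others}    : List ℕ
    cons        : cs ≡ constant ∷ others
    descending  : Descending constant others
    ratio       : n ℕ.* headOrZero others ≤ j ℕ.* constant
    positive    : All (1 ≤_) cs
    degree      : List.length others ≡ j

positive-linearAbs : ∀ a c cs → 1 ≤ a → 1 ≤ c → All (1 ≤_) cs → All (1 ≤_) (linearAbs a c cs)
positive-linearAbs a c []       1≤a 1≤c ps       = 1≤c ∷ []
positive-linearAbs a c (d ∷ cs) 1≤a 1≤c (p ∷ ps) = ℕₚ.≤-trans 1≤c (ℕₚ.m≤m+n c _) ∷ positive-linearAbs a d cs 1≤a p ps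

length-linearAbs : ∀ a c cs → List.length (linearAbs a c cs) ≡ suc (List.length cs)
length-linearAbs a c []       = refl
length-linearAbs a c (d ∷ cs) = cong suc (length-linearAbs a d cs)

head-linearAbs : ∀ a c cs → headOrZero (linearAbs a c cs) ≡ c ℕ.+ a ℕ.* headOrZero cs
head-linearAbs a c []       = ≡-sym (trans (cong (c ℕ.+_) (ℕₚ.*-zeroʳ a)) (ℕₚ.+-identityʳ c))
head-linearAbs a c (d ∷ cs) = refl

-- The quotient of the two lowest coefficients is the sum of the reciprocals `1 / a` over all
-- factors, hence at most `j / n`; this is what `ratio` records. From the second coefficient on, the
-- new sequence is a sum of two descending ones, so only the first comparison requires `ratio`.
profile-linearAbs : ∀ n j a cs → suc j ≤ n → n ≤ a → Profile n j cs → Profile n (suc j) (linearAbs a 0 cs)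
profile-linearAbs n j a .(c ∷ cs) j<n n≤a (profile {c} {cs} refl desc ratio (p ∷ ps) deg) =
  profile refl (descends cs refl) newRatio
    (ℕₚ.*-mono-≤ 1≤a p ∷ positive-linearAbs a c cs 1≤a p ps)
    (trans (length-linearAbs a c cs) (cong suc deg))
  where
  open ℕₚ.≤-Reasoning
  1≤a : 1 ≤ a
  1≤a = ℕₚ.≤-trans (s≤s z≤n) (ℕₚ.≤-trans j<n n≤a)
  h : ℕ
  h = headOrZero cs
  head≤ : ∀ cs → Descending c cs → headOrZero cs ≤ c
  head≤ []       _         = z≤n
  head≤ (d ∷ cs) (d≤c , _) = d≤c
  -- Split `a` as `n + (a - n)`: the first part is controlled by `ratio` and absorbs the extra `c`
  -- because `suc j ≤ n`, the second by `h ≤ c`.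
  second : c ℕ.+ a ℕ.* h ≤ a ℕ.* c
  second = begin
    c ℕ.+ a ℕ.* h                          ≡⟨ cong (λ z → c ℕ.+ z ℕ.* h) (ℕₚ.m+[n∸m]≡n n≤a) ⟨
    c ℕ.+ (n ℕ.+ (a ∸ n)) ℕ.* h            ≡⟨ lem c n (a ∸ n) h ⟩
    c ℕ.+ n ℕ.* h ℕ.+ (a ∸ n) ℕ.* h        ≤⟨ ℕₚ.+-mono-≤ (ℕₚ.+-monoʳ-≤ c ratio) (ℕₚ.*-monoʳ-≤ (a ∸ n) (head≤ cs desc)) ⟩
    suc j ℕ.* c ℕ.+ (a ∸ n) ℕ.* c          ≤⟨ ℕₚ.+-monoˡ-≤ _ (ℕₚ.*-monoˡ-≤ c j<n) ⟩
    n ℕ.* c ℕ.+ (a ∸ n) ℕ.* c              ≡⟨ ℕₚ.*-distribʳ-+ c n (a ∸ n) ⟨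
    (n ℕ.+ (a ∸ n)) ℕ.* c                  ≡⟨ cong (ℕ._* c) (ℕₚ.m+[n∸m]≡n n≤a) ⟩
    a ℕ.* c                                ∎
    where
    lem : ∀ c n e h → c ℕ.+ (n ℕ.+ e) ℕ.* h ≡ c ℕ.+ n ℕ.* h ℕ.+ e ℕ.* h
    lem = ℕSolver.solve-∀
  descends : ∀ cs′ → cs′ ≡ cs → Descending (a ℕ.* c) (linearAbs a c cs′)
  descends []        e    = ℕₚ.m≤n*m c a {{ℕ.>-nonZero 1≤a}} , tt
  descends (d ∷ cs′) refl = second , descending-linearAbs a c d cs′ 1≤a (proj₁ desc) (proj₂ desc)
  newRatio : n ℕ.* headOrZero (linearAbs a c cs) ≤ suc j ℕ.* (a ℕ.* c)
  newRatio = begin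
    n ℕ.* headOrZero (linearAbs a c cs)  ≡⟨ cong (n ℕ.*_) (head-linearAbs a c cs) ⟩
    n ℕ.* (c ℕ.+ a ℕ.* h)                ≡⟨ lem n c a h ⟩
    n ℕ.* c ℕ.+ a ℕ.* (n ℕ.* h)          ≤⟨ ℕₚ.+-mono-≤ (ℕₚ.*-monoˡ-≤ c n≤a) (ℕₚ.*-monoʳ-≤ a ratio) ⟩
    a ℕ.* c ℕ.+ a ℕ.* (j ℕ.* c)          ≡⟨ lem′ a c j ⟩
    suc j ℕ.* (a ℕ.* c)                  ∎
    where
    lem : ∀ n c a h → n ℕ.* (c ℕ.+ a ℕ.* h) ≡ n ℕ.* c ℕ.+ a ℕ.* (n ℕ.* h)
    lem = ℕSolver.solve-∀
    lem′ : ∀ a c j → a ℕ.* c ℕ.+ a ℕ.* (j ℕ.* c) ≡ (1 ℕ.+ j) ℕ.* (a ℕ.* c)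
    lem′ = ℕSolver.solve-∀

linearPower : ℕ → ℕ → Poly
linearPower a zero    = + 1 ∷ []
linearPower a (suc k) = linear a (linearPower a k)

eval-linearPower : ∀ a k x → eval (linearPower a k) x ≡ (x + - + a) ^ k
eval-linearPower a zero    x = cong (λ z → + 1 + z) (ℤₚ.*-zeroʳ x)
eval-linearPower a (suc k) x = trans (eval-linear a (linearPower a k) x) (cong (λ z → (x + - + a) * z) (eval-linearPower a k x))

record Alternating (n j : ℕ) (p : Poly) : Set where
  constructor alternating
  field
    {sgn₀}   : ℤ
    {coeffs} : List ℕ
    unit     : ∣ sgn₀ ∣ ≡ 1
    equal    : p ≡ alternate sgn₀ coeffs
    shape    : Profile n j coeffs

alternating-linear : ∀ n j a p → suc j ≤ n → n ≤ a → Alternating n j p → Alternating n (suc j) (linear a p)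
alternating-linear n j a p j<n n≤a (alternating {s} {cs} u refl sh) =
  alternating (trans (ℤₚ.∣-i∣≡∣i∣ s) u) (linear-alternate a s cs) (profile-linearAbs n j a cs j<n n≤a sh)

alternating-linearPower : ∀ a k → k ≤ a → Alternating a k (linearPower a k)
alternating-linearPower a zero    le = alternating {sgn₀ = + 1} {coeffs = 1 ∷ []} refl refl
  (profile refl tt (ℕₚ.≤-reflexive (ℕₚ.*-zeroʳ a)) (s≤s z≤n ∷ []) refl)
alternating-linearPower a (suc k) le =
  alternating-linear a k a _ le ℕₚ.≤-refl (alternating-linearPower a k (ℕₚ.≤-trans (ℕₚ.n≤1+n k) le))

-- The search loop of argmaxℕ is a local function of Defs, recovered by unification as for detP.
mutual
  loopℕ : (x : ℕ) (xs : List ℕ) (bi bv i : ℕ) → List ℕ → ℕ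
  loopℕ = _

  loopℕ-spec : ∀ x y ys → argmaxℕ (x ∷ y ∷ ys)
    ≡ (if x <ᵇ y then loopℕ x (y ∷ ys) 1 y 2 ys else loopℕ x (y ∷ ys) 0 x 2 ys)
  loopℕ-spec x y ys with y ∷ ys | 2 | 1 | 0
  ... | zs | two | one | nil = refl

loopℕ-max : ∀ x xs bi bv i ys → All (_≤ bv) ys → loopℕ x xs bi bv i ys ≡ bi
loopℕ-max x xs bi bv i []       []       = refl
loopℕ-max x xs bi bv i (y ∷ ys) (p ∷ ps) with bv <ᵇ y in eq
... | true  = contradiction (ℕₚ.<ᵇ⇒< bv y (subst T (≡-sym eq) tt)) (ℕₚ.≤⇒≯ p)
... | false = loopℕ-max x xs bi bv (suc i) ys ps

argmaxℕ-head : ∀ c cs → All (_≤ c) cs → argmaxℕ (c ∷ cs) ≡ 0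
argmaxℕ-head c cs ps = loopℕ-max c cs 0 c 1 cs ps

module _ (k L : ℕ) (k≤L : suc k ≤ suc L) where
  private
    T′ : Tree
    T′ = tree (suc k) (suc L)
    base : Poly
    base = linear (suc L ℕ.+ suc k) (linearPower (suc L) k)
    E : Poly
    E = shiftP (suc (L ℕ.* suc k)) (spread base)

  -- From `L + 2` on, `n` is positive and its square exceeds `L + 1`, so both multipliers cancelled
  -- in `adj-vertices` are nonzero.
  eval-E : ∀ n → suc (suc L) ≤ n → eval (CPA T′) (+ n) ≡ eval E (+ n)
  eval-E n le = begin
    eval (CPA T′) x
      ≡⟨ eval-CPA (suc k) (suc L) x ⟩
    listDet (charA x) (vertices (suc k) (suc L))
      ≡⟨ adj-vertices x x≢0 k L q≢0 ⟩
    x ^ suc (L ℕ.* suc k) * ((x * x + - + (suc L ℕ.+ suc k)) * (x * x + - + suc L) ^ k)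
      ≡⟨ cong (λ z → x ^ suc (L ℕ.* suc k) * ((x * x + - + (suc L ℕ.+ suc k)) * z)) (eval-linearPower (suc L) k (x * x)) ⟨
    x ^ suc (L ℕ.* suc k) * ((x * x + - + (suc L ℕ.+ suc k)) * eval (linearPower (suc L) k) (x * x))
      ≡⟨ cong (λ z → x ^ suc (L ℕ.* suc k) * z) (eval-linear (suc L ℕ.+ suc k) (linearPower (suc L) k) (x * x)) ⟨
    x ^ suc (L ℕ.* suc k) * eval base (x * x)
      ≡⟨ cong (λ z → x ^ suc (L ℕ.* suc k) * z) (eval-spread base x) ⟨
    x ^ suc (L ℕ.* suc k) * eval (spread base) x
      ≡⟨ eval-shiftP (suc (L ℕ.* suc k)) (spread base) x ⟨
    eval E x ∎
    where
    open ≡-Reasoning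
    x : ℤ
    x = + n
    1≤n : 1 ≤ n
    1≤n = ℕₚ.≤-trans (s≤s z≤n) le
    x≢0 : x ≢ + 0
    x≢0 e = ℕₚ.<⇒≢ 1≤n (≡-sym (ℤₚ.+-injective e))
    move : ∀ a b → a ≡ (a + - b) + b
    move = solve-∀
    q≢0 : x * x + - + suc L ≢ + 0
    q≢0 e = ℕₚ.<-irrefl (≡-sym square) (ℕₚ.<-≤-trans le (ℕₚ.m≤m*n n n {{ℕ.>-nonZero 1≤n}}))
      where
      square : n ℕ.* n ≡ suc L
      square = ℤₚ.+-injective (trans (ℤₚ.pos-* n n) (trans (move (x * x) (+ suc L)) (trans (cong (λ z → z + + suc L) e) (ℤₚ.+-identityˡ (+ suc L)))))

  coeff-E : ∀ i → coeff (CPA T′) i ≡ coeff E i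
  coeff-E = eventually-equal (CPA T′) E (suc (suc L)) eval-E

  base-alternating : Alternating (suc L) (suc k) base
  base-alternating = alternating-linear (suc L) k (suc L ℕ.+ suc k) (linearPower (suc L) k) k≤L (ℕₚ.m≤m+n (suc L) (suc k))
    (alternating-linearPower (suc L) k (ℕₚ.≤-trans (ℕₚ.n≤1+n k) k≤L))

  -- `cpaNonzero` reads one coefficient more than there are vertices. A list of exactly this length
  -- is reproduced by the reading, neither cut nor padded.
  length-E : ∀ {a p} → base ≡ a ∷ p → List.length p ≡ suc k → List.length E ≡ suc (N T′)
  length-E {a} {p} e len = begin
    List.length E
      ≡⟨ Listₚ.length-++ (replicate (suc (L ℕ.* suc k)) (+ 0)) ⟩
    List.length (replicate (suc (L ℕ.* suc k)) (+ 0)) ℕ.+ List.length (spread base)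
      ≡⟨ cong₂ ℕ._+_ (Listₚ.length-replicate (suc (L ℕ.* suc k))) (trans (cong (λ z → List.length (spread z)) e) (spread-length a p)) ⟩
    suc (L ℕ.* suc k) ℕ.+ suc (List.length p ℕ.+ List.length p)
      ≡⟨ cong (λ z → suc (L ℕ.* suc k) ℕ.+ suc (z ℕ.+ z)) len ⟩
    suc (L ℕ.* suc k) ℕ.+ suc (suc k ℕ.+ suc k)
      ≡⟨ lem L k ⟩
    suc (suc (suc k ℕ.* suc (suc L)))
      ≡⟨ cong (λ z → suc (suc z)) (clusters-length (suc k) (suc L)) ⟨
    suc (N T′) ∎
    where
    open ≡-Reasoning
    lem : ∀ L k → 1 ℕ.+ L ℕ.* (1 ℕ.+ k) ℕ.+ (1 ℕ.+ (1 ℕ.+ k ℕ.+ (1 ℕ.+ k))) ≡ 1 ℕ.+ (1 ℕ.+ (1 ℕ.+ k) ℕ.* (1 ℕ.+ (1 ℕ.+ L)))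
    lem = ℕSolver.solve-∀

  coefficients : ∀ {n} → List.length E ≡ n → map (coeff (CPA T′)) (upTo n) ≡ E
  coefficients refl = trans (Listₚ.map-cong coeff-E (upTo (List.length E))) (trans (Listₚ.map-upTo (coeff E) (List.length E)) (applyUpTo-coeff E))

  -- The power of `x` and the substitution of `x²` only insert zero coefficients, which `nonzeros`
  -- removes again; all coefficients of `base` are nonzero. Since there are at most as many factors
  -- as the smallest constant in them, the absolute values descend from the first.
  cpaNonzero-tree : ∃ λ c → ∃ λ cs → map ∣_∣ (cpaNonzero T′) ≡ c ∷ cs × All (_≤ c) cs × List.length cs ≡ suc k
  cpaNonzero-tree with base-alternating
  ... | alternating {s} {.(c ∷ cs)} u eq (profile {c} {cs} refl desc ratio pos deg) =
        c , cs , trans (cong (map ∣_∣) nz) (trans (cong (map ∣_∣) eq) abs) , descending-bounded c c cs ℕₚ.≤-refl desc , deg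
    where
    abs : map ∣_∣ (alternate s (c ∷ cs)) ≡ c ∷ cs
    abs = abs-alternate s (c ∷ cs) u
    len : List.length (alternate (- s) cs) ≡ suc k
    len = trans (≡-sym (Listₚ.length-map ∣_∣ (alternate (- s) cs)))
                (trans (cong List.length (abs-alternate (- s) cs (trans (ℤₚ.∣-i∣≡∣i∣ s) u))) deg)
    nz : cpaNonzero T′ ≡ base
    nz = trans (cong nonzeros (coefficients (length-E eq len)))
      (trans (nonzeros-shiftP (suc (L ℕ.* suc k)) (spread base)) (trans (nonzeros-spread base)
        (nonzeros-nonzero base (subst (All (1 ≤_)) (≡-sym (trans (cong (map ∣_∣) eq) abs)) pos))))

  pA-tree : pA T′ ≡ 1
  pA-tree with cpaNonzero-tree
  ... | c , cs , e , le , _ = cong suc (trans (cong argmaxℕ e) (argmaxℕ-head c cs le))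

  mA-tree : mA T′ ≡ suc (suc k)
  mA-tree with cpaNonzero-tree
  ... | c , cs , e , _ , len = trans (lengths (cpaNonzero T′)) (trans (cong List.length e) (cong suc len))
    where
    lengths : ∀ p → Defs.length p ≡ List.length (map ∣_∣ p)
    lengths []      = refl
    lengths (a ∷ p) = cong suc (lengths p)

-- The distance matrix as a rank-two update

charD : ℤ → Vertex → Vertex → ℤ
charD x u v = + distV u v + x * (- ⟦ eqV u v ⟧ + x * + 0)

eval-CPD : ∀ k L x → 4 ≤ N (tree k L) → eval (CPD (tree k L)) x ≡ listDet (charD x) (vertices k L)
eval-CPD k L x le = trans
  (eval-detP (List.length (vertices k L)) (λ i j → Dmat (tree k L) i j ∷ - δij i j ∷ []) x)
  (det-cong (List.length (vertices k L))
    {λ i j → eval (Dmat (tree k L) i j ∷ - δij i j ∷ []) x} {listMatrix (charD x) (vertices k L)}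
    (λ i j → cong₂ (λ d b → + d + x * (- ⟦ b ⟧ + x * + 0)) (dist-tree k L le i j) (does-≟-lookup k L i j)))

depthV : Vertex → ℤ
depthV root       = + 0
depthV (node i a) = + depth a

private
  -- The surplus of the diagonal over 2, twice the depth of the hub. A hub meets itself at depth 1,
  -- which leaves only `x`; a leaf meets itself at depth 2, which adds another 2.
  shifted : ℤ → ℕ → ℤ
  shifted x zero    = x
  shifted x (suc a) = x + + 2

-- Minus x on the diagonal, minus twice the depth of the meet of u and v: D - x = negMeet + depth 1ᵀ + 1 depthᵀ.
negMeet : ℤ → Vertex → Vertex → ℤ
negMeet x root       root       = - x
negMeet x root       (node j b) = + 0
negMeet x (node i a) root       = + 0
negMeet x (node i a) (node j b) = - (⟦ i ≡ᵇ j ⟧ * (+ 2 + ⟦ a ≡ᵇ b ⟧ * shifted x a))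

-- In a rooted tree the distance is the sum of the depths minus twice the depth of the meet. The
-- factors `+ 1` put the right side into the form `P + a rᵀ + b tᵀ` of `det-rank-two`.
charD-negMeet : ∀ x u v → charD x u v ≡ (negMeet x u v + + 1 * depthV u) + depthV v * + 1
charD-negMeet x root       root       = lem x
  where
  lem : ∀ x → + 0 + x * (- + 1 + x * + 0) ≡ (- x + + 1 * + 0) + + 0 * + 1
  lem = solve-∀
charD-negMeet x root       (node j b) = lem x (+ depth b)
  where
  lem : ∀ x d → d + x * (- + 0 + x * + 0) ≡ (+ 0 + + 1 * + 0) + d * + 1
  lem = solve-∀
charD-negMeet x (node i a) root       = lem x (+ depth a)
  where
  lem : ∀ x d → d + x * (- + 0 + x * + 0) ≡ (+ 0 + + 1 * d) + + 0 * + 1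
  lem = solve-∀
charD-negMeet x (node i a) (node j b) with i ≡ᵇ j
... | false = lem x (+ depth a) (+ depth b) (+ 2 + ⟦ a ≡ᵇ b ⟧ * shifted x a)
  where
  lem : ∀ x d e m → (d + e) + x * (- + 0 + x * + 0) ≡ (- (+ 0 * m) + + 1 * d) + e * + 1
  lem = solve-∀
charD-negMeet x (node i zero) (node j zero) | true = lem x
  where
  lem : ∀ x → + 0 + x * (- + 1 + x * + 0) ≡ (- (+ 1 * (+ 2 + + 1 * x)) + + 1 * + 1) + + 1 * + 1
  lem = solve-∀
charD-negMeet x (node i zero) (node j (suc b)) | true = lem x
  where
  lem : ∀ x → + 1 + x * (- + 0 + x * + 0) ≡ (- (+ 1 * (+ 2 + + 0 * x)) + + 1 * + 1) + + 2 * + 1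
  lem = solve-∀
charD-negMeet x (node i (suc a)) (node j zero) | true = lem x
  where
  lem : ∀ x → + 1 + x * (- + 0 + x * + 0) ≡ (- (+ 1 * (+ 2 + + 0 * (x + + 2))) + + 1 * + 2) + + 1 * + 1
  lem = solve-∀
charD-negMeet x (node i (suc a)) (node j (suc b)) | true with a ≡ᵇ b
... | true = lem x
  where
  lem : ∀ x → + 0 + x * (- + 1 + x * + 0) ≡ (- (+ 1 * (+ 2 + + 1 * (x + + 2))) + + 1 * + 2) + + 2 * + 1
  lem = solve-∀
... | false = lem x
  where
  lem : ∀ x → + 2 + x * (- + 0 + x * + 0) ≡ (- (+ 1 * (+ 2 + + 0 * (x + + 2))) + + 1 * + 2) + + 2 * + 1
  lem = solve-∀

-- Row sums against vectors that are constant on hubs and on leaves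

negMeet-root : ∀ x k L r h l →
  lsum (vertices k L) (λ w → negMeet x root w * hubWeight r h l w) ≡ - (x * r)
negMeet-root x k L r h l = trans
  (cong (λ z → - x * r + z) (lsum-clusters (+ 0) (+ 0) k L 0 g (λ j →
    trans (cong (λ z → + 0 * h + z) (lsum-leaves (+ 0) (+ 0) j L 0 g (λ b → lem₀ l ⟦ 0 ≡ᵇ b ⟧)))
          (lem₁ h (+ L) ⟦ 0 <ᵇ L ⟧ ⟦ 0 ≡ᵇ j ⟧))))
  (lem₂ x r (+ k) ⟦ 0 <ᵇ k ⟧)
  where
  g : Vertex → ℤ
  g w = negMeet x root w * hubWeight r h l w
  lem₀ : ∀ l p → + 0 * l ≡ + 0 + p * + 0
  lem₀ = solve-∀
  lem₁ : ∀ h L p q → + 0 * h + (L * + 0 + p * + 0) ≡ + 0 + q * + 0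
  lem₁ = solve-∀
  lem₂ : ∀ x r k p → - x * r + (k * + 0 + p * + 0) ≡ - (x * r)
  lem₂ = solve-∀

negMeet-hub : ∀ x k L r h l {i} → i < k →
  lsum (vertices k L) (λ w → negMeet x (node i 0) w * hubWeight r h l w) ≡ - (+ 2 * (h + + L * l) + x * h)
negMeet-hub x k L r h l {i} lt = trans
  (cong (λ z → + 0 * r + z) (lsum-clusters (+ 0) d k L i g (λ j →
    trans (cong (λ z → - (⟦ i ≡ᵇ j ⟧ * (+ 2 + + 1 * x)) * h + z)
            (lsum-leaves (- (⟦ i ≡ᵇ j ⟧ * (+ 2 + + 0 * x)) * l) (+ 0) j L 0 g (λ b → lem₀ (- (⟦ i ≡ᵇ j ⟧ * (+ 2 + + 0 * x)) * l) ⟦ 0 ≡ᵇ b ⟧)))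
          (lem₁ x h l (+ L) ⟦ i ≡ᵇ j ⟧ ⟦ 0 <ᵇ L ⟧))))
  (trans (cong (λ z → + 0 * r + (+ k * + 0 + z * d)) (⟦<⟧-true lt)) (lem₂ r (+ k) d))
  where
  g : Vertex → ℤ
  g w = negMeet x (node i 0) w * hubWeight r h l w
  d : ℤ
  d = - (+ 2 * (h + + L * l) + x * h)
  lem₀ : ∀ c p → c ≡ c + p * + 0
  lem₀ = solve-∀
  lem₁ : ∀ x h l L p q → - (p * (+ 2 + + 1 * x)) * h + (L * (- (p * (+ 2 + + 0 * x)) * l) + q * + 0)
    ≡ + 0 + p * - (+ 2 * (h + L * l) + x * h)
  lem₁ = solve-∀
  lem₂ : ∀ r k d → + 0 * r + (k * + 0 + + 1 * d) ≡ d
  lem₂ = solve-∀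

negMeet-leaf : ∀ x k L r h l {i a} → i < k → a < L →
  lsum (vertices k L) (λ w → negMeet x (node i (suc a)) w * hubWeight r h l w) ≡ - (+ 2 * (h + + L * l) + (x + + 2) * l)
negMeet-leaf x k L r h l {i} {a} lt le = trans
  (cong (λ z → + 0 * r + z) (lsum-clusters (+ 0) d k L i g (λ j →
    trans (cong (λ z → - (⟦ i ≡ᵇ j ⟧ * (+ 2 + + 0 * (x + + 2))) * h + z)
            (lsum-leaves (- (⟦ i ≡ᵇ j ⟧ * + 2) * l) (- (⟦ i ≡ᵇ j ⟧ * (x + + 2)) * l) j L a g (λ b → lem₀ x l ⟦ i ≡ᵇ j ⟧ ⟦ a ≡ᵇ b ⟧)))
          (trans (cong (λ z → - (⟦ i ≡ᵇ j ⟧ * (+ 2 + + 0 * (x + + 2))) * h + (+ L * (- (⟦ i ≡ᵇ j ⟧ * + 2) * l) + z * (- (⟦ i ≡ᵇ j ⟧ * (x + + 2)) * l))) (⟦<⟧-true le))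
                 (lem₁ x h l (+ L) ⟦ i ≡ᵇ j ⟧)))))
  (trans (cong (λ z → + 0 * r + (+ k * + 0 + z * d)) (⟦<⟧-true lt)) (lem₂ r (+ k) d))
  where
  g : Vertex → ℤ
  g w = negMeet x (node i (suc a)) w * hubWeight r h l w
  d : ℤ
  d = - (+ 2 * (h + + L * l) + (x + + 2) * l)
  lem₀ : ∀ x l p q → - (p * (+ 2 + q * (x + + 2))) * l ≡ - (p * + 2) * l + q * (- (p * (x + + 2)) * l)
  lem₀ = solve-∀
  lem₁ : ∀ x h l L p → - (p * (+ 2 + + 0 * (x + + 2))) * h + (L * (- (p * + 2) * l) + + 1 * (- (p * (x + + 2)) * l))
    ≡ + 0 + p * - (+ 2 * (h + L * l) + (x + + 2) * l)
  lem₁ = solve-∀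
  lem₂ : ∀ r k d → + 0 * r + (k * + 0 + + 1 * d) ≡ d
  lem₂ = solve-∀

lsum-hubWeight : ∀ k L r h l (g : Vertex → ℤ) (g₀ g₁ g₂ : ℤ) →
  g root ≡ g₀ → (∀ j → g (node j 0) ≡ g₁) → (∀ j b → g (node j (suc b)) ≡ g₂) →
  lsum (vertices k L) (λ w → g w * hubWeight r h l w) ≡ g₀ * r + + k * (g₁ * h + + L * (g₂ * l))
lsum-hubWeight k L r h l g g₀ g₁ g₂ e₀ e₁ e₂ = trans
  (cong₂ (λ u v → u * r + v) e₀ (lsum-clusters (g₁ * h + + L * (g₂ * l)) (+ 0) k L 0 g′ (λ j →
    trans (cong₂ (λ u v → u * h + v) (e₁ j) (lsum-leaves (g₂ * l) (+ 0) j L 0 g′ (λ b →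
             trans (cong (λ z → z * l) (e₂ j b)) (lem₀ (g₂ * l) ⟦ 0 ≡ᵇ b ⟧))))
          (lem₁ (g₁ * h) (+ L) (g₂ * l) ⟦ 0 <ᵇ L ⟧ ⟦ 0 ≡ᵇ j ⟧))))
  (lem₂ (g₀ * r) (+ k) (g₁ * h + + L * (g₂ * l)) ⟦ 0 <ᵇ k ⟧)
  where
  g′ : Vertex → ℤ
  g′ w = g w * hubWeight r h l w
  lem₀ : ∀ c p → c ≡ c + p * + 0
  lem₀ = solve-∀
  lem₁ : ∀ a L b p q → a + (L * b + p * + 0) ≡ a + L * b + q * + 0
  lem₁ = solve-∀
  lem₂ : ∀ a k b p → a + (k * b + p * + 0) ≡ a + k * b
  lem₂ = solve-∀

-- The determinant of negMeet

quadratic : ℤ → ℕ → ℤ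
quadratic x L = x * (x + + 2) + + 2 * (x + + 2) + + 2 * + L * x

negMeet-apart : ∀ x {i k} a b → i < k → negMeet x (node i a) (node k b) ≡ + 0
negMeet-apart x {i} {k} a b lt = trans (cong (λ z → - (⟦ z ⟧ * (+ 2 + ⟦ a ≡ᵇ b ⟧ * shifted x a))) (≡ᵇ-false i k (ℕₚ.<⇒≢ lt)))
  (lem (+ 2 + ⟦ a ≡ᵇ b ⟧ * shifted x a))
  where
  lem : ∀ a → - (+ 0 * a) ≡ + 0
  lem = solve-∀

negMeet-same : ∀ x k a b → negMeet x (node k a) (node k b) ≡ - (+ 2 + ⟦ a ≡ᵇ b ⟧ * shifted x a)
negMeet-same x k a b = trans (cong (λ z → - (⟦ z ⟧ * (+ 2 + ⟦ a ≡ᵇ b ⟧ * shifted x a))) (≡ᵇ-refl k))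
  (cong -_ (ℤₚ.*-identityˡ _))

lsum-cong : ∀ {g g′ : Vertex → ℤ} vs → All (λ v → g v ≡ g′ v) vs → lsum vs g ≡ lsum vs g′
lsum-cong []       []       = refl
lsum-cong (v ∷ vs) (e ∷ es) = cong₂ _+_ e (lsum-cong vs es)

module _ (x : ℤ) where
  private
    D : List Vertex → ℤ
    D = listDet (negMeet x)
    y : ℤ
    y = x + + 2

  meet-root : ∀ k L → D (vertices k L) ≡ - x * D (clusters k L)
  meet-root k L = trans (≡-sym (ℤₚ.*-identityˡ _))
    (cramer-block (negMeet x) (λ _ → + 1) (- x) root [] (clusters k L) (lem x) [] (All.map (λ { (below _ _) → refl ∷ [] }) (all-clusters k L)))
    where
    lem : ∀ x → - x * + 1 + + 0 ≡ - x
    lem = solve-∀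

  -- Among the leaves of one cluster the matrix is `-(y I + 2 J)` with `J` the all-ones matrix. Its
  -- first equation is isolated by the vector with `-(y + 2 l)` at the head and 2 elsewhere, up to
  -- scale the first column of the inverse.
  meet-leaf : ∀ k L l → - (y + + 2 * + l) * D (leaves k (suc l) ++ clusters k L)
    ≡ y * (y + + 2 * + suc l) * D (leaves k l ++ clusters k L)
  meet-leaf k L l = trans
    (cong (λ z → z * D (leaves k (suc l) ++ clusters k L)) (≡-sym μ-front))
    (cramer-block (negMeet x) μ (y * (y + + 2 * + suc l)) v (leaves k l) (clusters k L) row₀
      (All.map rows (all-leaves k l)) (All.map other (all-clusters k L)))
    where
    v : Vertex
    v = node k (suc l)
    μ : Vertex → ℤ
    μ w = if eqV w v then - (y + + 2 * + l) else + 2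
    μ-front : μ v ≡ - (y + + 2 * + l)
    μ-front = cong (λ b → if b then - (y + + 2 * + l) else + 2) (eqV-refl v)
    μ-leaf : ∀ b → b < l → μ (node k (suc b)) ≡ + 2
    μ-leaf b lt = cong (λ b → if b then - (y + + 2 * + l) else + 2)
      (trans (cong₂ _∧_ (≡ᵇ-refl k) (≡ᵇ-false b l (ℕₚ.<⇒≢ lt))) refl)
    tail-sum : ∀ a → lsum (leaves k l) (λ w → negMeet x (node k (suc a)) w * μ w) ≡ + l * - + 4 + ⟦ a <ᵇ l ⟧ * - (+ 2 * y)
    tail-sum a = trans
      (lsum-cong (leaves k l) (All.map (λ { (leaf {b} lt) → cong (λ z → negMeet x (node k (suc a)) (node k (suc b)) * z) (μ-leaf b lt) }) (all-leaves k l)))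
      (lsum-leaves (- + 4) (- (+ 2 * y)) k l a (λ w → negMeet x (node k (suc a)) w * + 2) (λ b →
        trans (cong (λ z → z * + 2) (negMeet-same x k (suc a) (suc b))) (lem x ⟦ a ≡ᵇ b ⟧)))
      where
      lem : ∀ x p → - (+ 2 + p * (x + + 2)) * + 2 ≡ - + 4 + p * - (+ 2 * (x + + 2))
      lem = solve-∀
    not-below : ∀ l → ⟦ l <ᵇ l ⟧ ≡ + 0
    not-below zero    = refl
    not-below (suc l) = not-below l
    row₀ : lsum (v ∷ leaves k l) (λ w → negMeet x v w * μ w) ≡ y * (y + + 2 * + suc l)
    row₀ = trans (cong₂ _+_ (cong₂ _*_ (trans (negMeet-same x k (suc l) (suc l)) (cong (λ b → - (+ 2 + ⟦ b ⟧ * y)) (≡ᵇ-refl l))) μ-front)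
                   (trans (tail-sum l) (cong (λ z → + l * - + 4 + z * - (+ 2 * y)) (not-below l))))
                 (lem y (+ l))
      where
      lem : ∀ y l → - (+ 2 + + 1 * y) * - (y + + 2 * l) + (l * - + 4 + + 0 * - (+ 2 * y)) ≡ y * (y + + 2 * (+ 1 + l))
      lem = solve-∀
    rows : ∀ {u} → Leaf k l u → lsum (v ∷ leaves k l) (λ w → negMeet x u w * μ w) ≡ + 0
    rows (leaf {a} lt) = trans (cong₂ _+_ (cong₂ _*_ (trans (negMeet-same x k (suc a) (suc l)) (cong (λ b → - (+ 2 + ⟦ b ⟧ * y)) (≡ᵇ-false a l (ℕₚ.<⇒≢ lt)))) μ-front)
                                   (trans (tail-sum a) (cong (λ z → + l * - + 4 + z * - (+ 2 * y)) (⟦<⟧-true lt))))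
                               (lem y (+ l))
      where
      lem : ∀ y l → - (+ 2 + + 0 * y) * - (y + + 2 * l) + (l * - + 4 + + 1 * - (+ 2 * y)) ≡ + 0
      lem = solve-∀
    other : ∀ {u} → Below k L u → All (λ w → negMeet x u w ≡ + 0) (v ∷ leaves k l)
    other (below {i} {a} lt le) = negMeet-apart x a (suc l) lt ∷
      All.map (λ { (leaf {b} _) → negMeet-apart x a (suc b) lt }) (all-leaves k l)

  -- The entry between a hub and any vertex of its cluster is that between two different leaves, so
  -- the vector of `meet-leaf` works again; only the diagonal entry of the head row differs, which
  -- turns the product into the quadratic factor.
  meet-hub : ∀ k L → - (y + + 2 * + L) * D (clusters (suc k) L) ≡ quadratic x L * D (leaves k L ++ clusters k L)
  meet-hub k L = cramer-block (negMeet x) μ (quadratic x L) (node k 0) (leaves k L) (clusters k L) row₀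
    (All.map rows (all-leaves k L)) (All.map other (all-clusters k L))
    where
    μ : Vertex → ℤ
    μ = hubWeight (+ 0) (- (y + + 2 * + L)) (+ 2)
    row₀ : lsum (node k 0 ∷ leaves k L) (λ w → negMeet x (node k 0) w * μ w) ≡ quadratic x L
    row₀ = trans (cong₂ (λ u v → u * - (y + + 2 * + L) + v) (negMeet-same x k 0 0)
        (lsum-leaves (- + 4) (+ 0) k L 0 (λ w → negMeet x (node k 0) w * μ w) (λ b →
          trans (cong (λ z → z * + 2) (negMeet-same x k 0 (suc b))) (lem₀ x ⟦ 0 ≡ᵇ b ⟧))))
      (lem₁ x (+ L) ⟦ 0 <ᵇ L ⟧)
      where
      lem₀ : ∀ x p → - (+ 2 + + 0 * x) * + 2 ≡ - + 4 + p * + 0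
      lem₀ = solve-∀
      lem₁ : ∀ x L p → - (+ 2 + + 1 * x) * - ((x + + 2) + + 2 * L) + (L * - + 4 + p * + 0)
        ≡ x * (x + + 2) + + 2 * (x + + 2) + + 2 * L * x
      lem₁ = solve-∀
    rows : ∀ {u} → Leaf k L u → lsum (node k 0 ∷ leaves k L) (λ w → negMeet x u w * μ w) ≡ + 0
    rows (leaf {a} lt) = trans (cong₂ (λ u v → u * - (y + + 2 * + L) + v) (negMeet-same x k (suc a) 0)
        (lsum-leaves (- + 4) (- (+ 2 * y)) k L a (λ w → negMeet x (node k (suc a)) w * μ w) (λ b →
          trans (cong (λ z → z * + 2) (negMeet-same x k (suc a) (suc b))) (lem₀ x ⟦ a ≡ᵇ b ⟧))))
      (trans (cong (λ z → - (+ 2 + + 0 * y) * - (y + + 2 * + L) + (+ L * - + 4 + z * - (+ 2 * y))) (⟦<⟧-true lt))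
             (lem₁ y (+ L)))
      where
      lem₀ : ∀ x p → - (+ 2 + p * (x + + 2)) * + 2 ≡ - + 4 + p * - (+ 2 * (x + + 2))
      lem₀ = solve-∀
      lem₁ : ∀ y L → - (+ 2 + + 0 * y) * - (y + + 2 * L) + (L * - + 4 + + 1 * - (+ 2 * y)) ≡ + 0
      lem₁ = solve-∀
    other : ∀ {u} → Below k L u → All (λ w → negMeet x u w ≡ + 0) (node k 0 ∷ leaves k L)
    other (below {i} {a} lt le) = negMeet-apart x a 0 lt ∷
      All.map (λ { (leaf {b} _) → negMeet-apart x a (suc b) lt }) (all-leaves k L)

  module _ (y+2l≢0 : ∀ l → y + + 2 * + l ≢ + 0) where
    open ≡-Reasoning

    -- This is the value `(-y)^l (1 + 2 l / y)` of the determinant of `-(y I + 2 J)`, with the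
    -- denominator cleared. The factors `y + 2 l` telescope along the induction, and each must be
    -- nonzero to be cancelled.
    meet-leaves : ∀ k L l → y * D (leaves k l ++ clusters k L) ≡ (- y) ^ l * (y + + 2 * + l) * D (clusters k L)
    meet-leaves k L zero    = lem y (D (clusters k L))
      where
      lem : ∀ y d → y * d ≡ + 1 * (y + + 2 * + 0) * d
      lem = solve-∀
    meet-leaves k L (suc l) = cancel-nonzero (y + + 2 * + l) (y+2l≢0 l) (begin
      (y + + 2 * + l) * (y * D (leaves k (suc l) ++ clusters k L))
        ≡⟨ lem₀ y (+ l) (D (leaves k (suc l) ++ clusters k L)) ⟩
      - y * (- (y + + 2 * + l) * D (leaves k (suc l) ++ clusters k L))
        ≡⟨ cong (λ z → - y * z) (meet-leaf k L l) ⟩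
      - y * (y * (y + + 2 * + suc l) * D (leaves k l ++ clusters k L))
        ≡⟨ lem₁ y (+ suc l) (D (leaves k l ++ clusters k L)) ⟩
      - y * (y + + 2 * + suc l) * (y * D (leaves k l ++ clusters k L))
        ≡⟨ cong (λ z → - y * (y + + 2 * + suc l) * z) (meet-leaves k L l) ⟩
      - y * (y + + 2 * + suc l) * ((- y) ^ l * (y + + 2 * + l) * D (clusters k L))
        ≡⟨ lem₂ y (+ suc l) ((- y) ^ l) (y + + 2 * + l) (D (clusters k L)) ⟩
      (y + + 2 * + l) * ((- y) ^ suc l * (y + + 2 * + suc l) * D (clusters k L)) ∎)
      where
      lem₀ : ∀ y l d → (y + + 2 * l) * (y * d) ≡ - y * (- (y + + 2 * l) * d)
      lem₀ = solve-∀
      lem₁ : ∀ y s d → - y * (y * (y + + 2 * s) * d) ≡ - y * (y + + 2 * s) * (y * d)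
      lem₁ = solve-∀
      lem₂ : ∀ y s p w d → - y * (y + + 2 * s) * (p * w * d) ≡ w * (- y * p * (y + + 2 * s) * d)
      lem₂ = solve-∀

    meet-clusters : ∀ k L → D (clusters k (suc L)) ≡ (quadratic x (suc L) * (- y) ^ L) ^ k
    meet-clusters zero    L = refl
    meet-clusters (suc k) L = cancel-nonzero (y + + 2 * + suc L) (y+2l≢0 (suc L)) (cancel-nonzero y y≢0 (begin
      y * (w * D (clusters (suc k) (suc L)))
        ≡⟨ lem₀ y w (D (clusters (suc k) (suc L))) ⟩
      - y * (- w * D (clusters (suc k) (suc L)))
        ≡⟨ cong (λ z → - y * z) (meet-hub k (suc L)) ⟩
      - y * (q * D (leaves k (suc L) ++ clusters k (suc L)))
        ≡⟨ lem₁ y q (D (leaves k (suc L) ++ clusters k (suc L))) ⟩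
      - q * (y * D (leaves k (suc L) ++ clusters k (suc L)))
        ≡⟨ cong (λ z → - q * z) (trans (meet-leaves k (suc L) (suc L)) (cong (λ z → (- y) ^ suc L * w * z) (meet-clusters k L))) ⟩
      - q * ((- y) ^ suc L * w * (q * (- y) ^ L) ^ k)
        ≡⟨ lem₂ y w q ((- y) ^ L) ((q * (- y) ^ L) ^ k) ⟩
      y * (w * (q * (- y) ^ L) ^ suc k) ∎))
      where
      w q : ℤ
      w = y + + 2 * + suc L
      q = quadratic x (suc L)
      y≢0 : y ≢ + 0
      y≢0 e = y+2l≢0 0 (trans (ℤₚ.+-identityʳ y) e)
      lem₀ : ∀ y w d → y * (w * d) ≡ - y * (- w * d)
      lem₀ = solve-∀
      lem₁ : ∀ y q d → - y * (q * d) ≡ - q * (y * d)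
      lem₁ = solve-∀
      lem₂ : ∀ y w q p d → - q * (- y * p * w * d) ≡ y * (w * (q * p * d))
      lem₂ = solve-∀

-- The determinant of D - x

quad : ℤ → ℤ → ℤ
quad x L = x * (x + + 2) + + 2 * (x + + 2) + + 2 * L * x

cubic : ℤ → ℤ → ℤ → ℤ
cubic x k L = + 2 * k * (L + + 1) + x * ((k * k * L + + 4 * k * L + + 5 * k + - + 4) + x * ((+ 4 * k * L + + 2 * k + - (+ 2 * L) + - + 4) + x * - + 1))

-- This is `s - tν` of `det-rank-two`, left unsimplified in the form that `lsum-hubWeight` produces,
-- so that it agrees with `c₁` by computation. It is a multiplier to be cancelled and does not occur
-- in the final formula.
corner : ℤ → ℤ → ℤ → ℤ
corner x k L = x * quad x L + - (+ 0 * quad x L + k * (+ 1 * (x * (x + + 2)) + L * (+ 2 * (x * x))))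

module _ (x : ℤ) (k L : ℕ) where
  private
    y q s h₁ l₁ h₂ l₂ rμ rν tμ tν : ℤ
    y = x + + 2
    q = quad x (+ L)
    s = x * q
    -- For vectors constant on levels, the equations with right sides `- s` times the depths and
    -- `- s` times the all-ones vector reduce to a two-by-two system for the hub and leaf values.
    -- Its determinant is `q`, the root equation brings a factor `x`, and `s = x * q` clears both
    -- denominators.
    h₁ = x * (y + - (+ 2 * + L))
    l₁ = + 2 * x * (x + + 1)
    h₂ = x * y
    l₂ = x * x
    rμ = + 1 * + 0 + + k * (+ 1 * h₁ + + L * (+ 1 * l₁))
    rν = + 1 * q + + k * (+ 1 * h₂ + + L * (+ 1 * l₂))
    tμ = + 0 * + 0 + + k * (+ 1 * h₁ + + L * (+ 2 * l₁))
    tν = + 0 * q + + k * (+ 1 * h₂ + + L * (+ 2 * l₂))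
    n : ℕ
    n = List.length (vertices k L)
    at : Fin n → Vertex
    at = lookup (vertices k L)
    μ ν : Vertex → ℤ
    μ = hubWeight (+ 0) h₁ l₁
    ν = hubWeight q h₂ l₂
    c₁ : ℤ
    c₁ = s + - tν

    row-μ : ∀ {u} → Valid k L u → lsum (vertices k L) (λ w → negMeet x u w * μ w) ≡ - (s * depthV u)
    row-μ root = trans (negMeet-root x k L (+ 0) h₁ l₁) (lem x s)
      where
      lem : ∀ x s → - (x * + 0) ≡ - (s * + 0)
      lem = solve-∀
    row-μ (node {i} {zero} lt le) = trans (negMeet-hub x k L (+ 0) h₁ l₁ lt) (lem x (+ L))
      where
      lem : ∀ x L → - (+ 2 * (x * ((x + + 2) + - (+ 2 * L)) + L * (+ 2 * x * (x + + 1))) + x * (x * ((x + + 2) + - (+ 2 * L))))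
        ≡ - (x * (x * (x + + 2) + + 2 * (x + + 2) + + 2 * L * x) * + 1)
      lem = solve-∀
    row-μ (node {i} {suc a} lt le) = trans (negMeet-leaf x k L (+ 0) h₁ l₁ lt le) (lem x (+ L))
      where
      lem : ∀ x L → - (+ 2 * (x * ((x + + 2) + - (+ 2 * L)) + L * (+ 2 * x * (x + + 1))) + (x + + 2) * (+ 2 * x * (x + + 1)))
        ≡ - (x * (x * (x + + 2) + + 2 * (x + + 2) + + 2 * L * x) * + 2)
      lem = solve-∀

    row-ν : ∀ {u} → Valid k L u → lsum (vertices k L) (λ w → negMeet x u w * ν w) ≡ - (s * + 1)
    row-ν root = trans (negMeet-root x k L q h₂ l₂) (lem x q)
      where
      lem : ∀ x q → - (x * q) ≡ - (x * q * + 1)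
      lem = solve-∀
    row-ν (node {i} {zero} lt le) = trans (negMeet-hub x k L q h₂ l₂ lt) (lem x (+ L))
      where
      lem : ∀ x L → - (+ 2 * (x * (x + + 2) + L * (x * x)) + x * (x * (x + + 2)))
        ≡ - (x * (x * (x + + 2) + + 2 * (x + + 2) + + 2 * L * x) * + 1)
      lem = solve-∀
    row-ν (node {i} {suc a} lt le) = trans (negMeet-leaf x k L q h₂ l₂ lt le) (lem x (+ L))
      where
      lem : ∀ x L → - (+ 2 * (x * (x + + 2) + L * (x * x)) + (x + + 2) * (x * x))
        ≡ - (x * (x * (x + + 2) + + 2 * (x + + 2) + + 2 * L * x) * + 1)
      lem = solve-∀

  rank-two : (s * s * corner x (+ k) (+ L)) * listDet (charD x) (vertices k L)
    ≡ (corner x (+ k) (+ L) * ((s + - rμ) * corner x (+ k) (+ L) + - (rν * tμ))) * listDet (negMeet x) (vertices k L)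
  rank-two = trans
    (cong (λ z → (s * s * c₁) * z) (det-cong n {listMatrix (charD x) (vertices k L)}
      {λ i j → (negMeet x (at i) (at j) + + 1 * depthV (at i)) + depthV (at j) * + 1}
      (λ i j → charD-negMeet x (at i) (at j))))
    (det-rank-two n (listMatrix (negMeet x) (vertices k L)) (λ i → depthV (at i)) (λ _ → + 1) (λ _ → + 1) (λ j → depthV (at j))
      (λ j → μ (at j)) (λ j → ν (at j)) s rμ rν tμ tν
      (λ i → trans (sum-lookup (vertices k L) (λ w → negMeet x (at i) w * μ w)) (row-μ (lookup-valid k L i)))
      (λ i → trans (sum-lookup (vertices k L) (λ w → negMeet x (at i) w * ν w)) (row-ν (lookup-valid k L i)))
      (trans (sum-lookup (vertices k L) (λ w → + 1 * μ w))
        (lsum-hubWeight k L (+ 0) h₁ l₁ (λ _ → + 1) (+ 1) (+ 1) (+ 1) refl (λ _ → refl) (λ _ _ → refl)))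
      (trans (sum-lookup (vertices k L) (λ w → + 1 * ν w))
        (lsum-hubWeight k L q h₂ l₂ (λ _ → + 1) (+ 1) (+ 1) (+ 1) refl (λ _ → refl) (λ _ _ → refl)))
      (trans (sum-lookup (vertices k L) (λ w → depthV w * μ w))
        (lsum-hubWeight k L (+ 0) h₁ l₁ depthV (+ 0) (+ 1) (+ 2) refl (λ _ → refl) (λ _ _ → refl)))
      (trans (sum-lookup (vertices k L) (λ w → depthV w * ν w))
        (lsum-hubWeight k L q h₂ l₂ depthV (+ 0) (+ 1) (+ 2) refl (λ _ → refl) (λ _ _ → refl))))

  -- The two-by-two determinant left by the rank-two update is divisible by `x q`, with the cubic as
  -- quotient. Its minus sign cancels the one that the root contributes in `meet-root`.
  corner-det : (s + - rμ) * corner x (+ k) (+ L) + - (rν * tμ) ≡ - (x * q * cubic x (+ k) (+ L))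
  corner-det = lem x (+ k) (+ L)
    where
    lem : ∀ x k L →
      (x * (x * (x + + 2) + + 2 * (x + + 2) + + 2 * L * x)
        + - (+ 1 * + 0 + k * (+ 1 * (x * ((x + + 2) + - (+ 2 * L))) + L * (+ 1 * (+ 2 * x * (x + + 1))))))
      * (x * (x * (x + + 2) + + 2 * (x + + 2) + + 2 * L * x)
        + - (+ 0 * (x * (x + + 2) + + 2 * (x + + 2) + + 2 * L * x) + k * (+ 1 * (x * (x + + 2)) + L * (+ 2 * (x * x)))))
      + - ((+ 1 * (x * (x + + 2) + + 2 * (x + + 2) + + 2 * L * x) + k * (+ 1 * (x * (x + + 2)) + L * (+ 1 * (x * x))))
        * (+ 0 * + 0 + k * (+ 1 * (x * ((x + + 2) + - (+ 2 * L))) + L * (+ 2 * (+ 2 * x * (x + + 1))))))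
      ≡ - (x * (x * (x + + 2) + + 2 * (x + + 2) + + 2 * L * x)
        * (+ 2 * k * (L + + 1) + x * ((k * k * L + + 4 * k * L + + 5 * k + - + 4) + x * ((+ 4 * k * L + + 2 * k + - (+ 2 * L) + - + 4) + x * - + 1))))
    lem = solve-∀

distance-det : ∀ x k L →
  x ≢ + 0 → (∀ l → (x + + 2) + + 2 * + l ≢ + 0) → quad x (+ suc L) ≢ + 0 → corner x (+ suc k) (+ suc L) ≢ + 0 →
  listDet (charD x) (vertices (suc k) (suc L))
    ≡ cubic x (+ suc k) (+ suc L) * (((- (x + + 2)) ^ L) ^ suc k * quad x (+ suc L) ^ k)
distance-det x k L x≢0 y≢0 q≢0 c≢0 =
  -- The multiplier `s * s * corner` is `x² q² corner`. On the right, `x` and one `q` come from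
  -- `corner-det`, another `x` from the root and another `q` from the clusters, which lowers the
  -- exponent of the quadratic to `k`.
  cancel-nonzero q q≢0 (cancel-nonzero (x * x) xx≢0 (cancel-nonzero q q≢0 (cancel-nonzero c c≢0 (begin
    c * (q * (x * x * (q * D)))
      ≡⟨ lem₀ c q x D ⟩
    (x * q * (x * q) * c) * D
      ≡⟨ rank-two x (suc k) (suc L) ⟩
    (c * _) * listDet (negMeet x) (vertices (suc k) (suc L))
      ≡⟨ cong₂ (λ u v → (c * u) * v) (corner-det x (suc k) (suc L)) (trans (meet-root x (suc k) (suc L))
           (cong (λ z → - x * z) (trans (meet-clusters x y≢0 (suc k) L) (^-distrib-* q Y (suc k))))) ⟩
    (c * - (x * q * w)) * (- x * (q * q ^ k * Y ^ suc k))
      ≡⟨ lem₁ c x q w (q ^ k) (Y ^ suc k) ⟩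
    c * (q * (x * x * (q * (w * (Y ^ suc k * q ^ k))))) ∎))))
  where
  open ≡-Reasoning
  q c w D Y : ℤ
  q = quad x (+ suc L)
  c = corner x (+ suc k) (+ suc L)
  w = cubic x (+ suc k) (+ suc L)
  D = listDet (charD x) (vertices (suc k) (suc L))
  Y = (- (x + + 2)) ^ L
  xx≢0 : x * x ≢ + 0
  xx≢0 e = x≢0 (cancel-nonzero x x≢0 (trans e (≡-sym (ℤₚ.*-zeroʳ x))))
  lem₀ : ∀ c q x d → c * (q * (x * x * (q * d))) ≡ (x * q * (x * q) * c) * d
  lem₀ = solve-∀
  lem₁ : ∀ c x q w a b → (c * - (x * q * w)) * (- x * (q * a * b)) ≡ c * (q * (x * x * (q * (w * (b * a)))))
  lem₁ = solve-∀

-- Symmetric unimodal coefficient sequences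

infix 4 _⊑_
_⊑_ : ℤ → ℤ → Set
_⊑_ = ℤ._≤_

+-nonneg : ∀ {a b} → + 0 ⊑ a → + 0 ⊑ b → + 0 ⊑ a + b
+-nonneg p q = ℤₚ.+-mono-≤ p q

*-nonneg : ∀ {a b} → + 0 ⊑ a → + 0 ⊑ b → + 0 ⊑ a * b
*-nonneg {+ m} {+ n} p q = subst (λ z → + 0 ⊑ z) (ℤₚ.pos-* m n) (ℤ.+≤+ z≤n)

natural-nonneg : ∀ n → + 0 ⊑ + n
natural-nonneg n = ℤ.+≤+ z≤n

difference-nonneg : ∀ {a b} → a ⊑ b → + 0 ⊑ b + - a
difference-nonneg = ℤₚ.i≤j⇒0≤j-i

nonneg-difference : ∀ {a b} → + 0 ⊑ b + - a → a ⊑ b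
nonneg-difference = ℤₚ.0≤i-j⇒j≤i

nonneg-shifted : ∀ {a c} n → + 0 ⊑ c → a ≡ c + + suc n → a ≢ + 0
nonneg-shifted {c = + m} n p e z with trans (≡-sym z) e
... | w = ℕₚ.m+1+n≢0 m (≡-sym (ℤₚ.+-injective w))

-- Coefficients symmetric about n/2 and unimodal, stated for pairs of indices.
record SymmetricUnimodal (n : ℕ) (p : Poly) : Set where
  field
    increasing : ∀ i j → i ≤ j → i ℕ.+ j ≤ n → coeff p i ⊑ coeff p j
    decreasing : ∀ i j → i ≤ j → n ≤ i ℕ.+ j → coeff p j ⊑ coeff p i
    vanishing  : ∀ j → n < j → coeff p j ≡ + 0
    nonneg     : ∀ i → + 0 ⊑ coeff p i
open SymmetricUnimodal

unimodal-one : SymmetricUnimodal 0 (+ 1 ∷ [])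
unimodal-one .increasing zero    zero    le le′ = ℤₚ.≤-refl
unimodal-one .decreasing zero    zero    le le′ = ℤₚ.≤-refl
unimodal-one .decreasing zero    (suc j) le le′ = ℤ.+≤+ z≤n
unimodal-one .decreasing (suc i) (suc j) le le′ = ℤₚ.≤-refl
unimodal-one .vanishing  (suc j) lt = refl
unimodal-one .nonneg zero    = ℤ.+≤+ z≤n
unimodal-one .nonneg (suc i) = ℤ.+≤+ z≤n

unimodal-scale : ∀ {n p} c → SymmetricUnimodal n p → SymmetricUnimodal n (scaleP (+ c) p)
unimodal-scale {n} {p} c u = record
  { increasing = λ i j le le′ → scale i j (increasing u i j le le′)
  ; decreasing = λ i j le le′ → scale j i (decreasing u i j le le′)
  ; vanishing  = λ j lt → trans (coeff-scaleP (+ c) p j) (trans (cong (λ z → + c * z) (vanishing u j lt)) (ℤₚ.*-zeroʳ (+ c)))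
  ; nonneg     = λ i → subst (λ z → + 0 ⊑ z) (≡-sym (coeff-scaleP (+ c) p i)) (*-nonneg (natural-nonneg c) (nonneg u i))
  }
  where
  scale : ∀ i j → coeff p i ⊑ coeff p j → coeff (scaleP (+ c) p) i ⊑ coeff (scaleP (+ c) p) j
  scale i j le rewrite coeff-scaleP (+ c) p i | coeff-scaleP (+ c) p j = ℤₚ.*-monoˡ-≤-nonNeg (+ c) le

unimodal-add : ∀ {n p q} → SymmetricUnimodal n p → SymmetricUnimodal n q → SymmetricUnimodal n (addP p q)
unimodal-add {n} {p} {q} u v = record
  { increasing = λ i j le le′ → add i j (increasing u i j le le′) (increasing v i j le le′)
  ; decreasing = λ i j le le′ → add j i (decreasing u i j le le′) (decreasing v i j le le′)
  ; vanishing  = λ j lt → trans (coeff-addP p q j) (cong₂ _+_ (vanishing u j lt) (vanishing v j lt))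
  ; nonneg     = λ i → subst (λ z → + 0 ⊑ z) (≡-sym (coeff-addP p q i)) (+-nonneg (nonneg u i) (nonneg v i))
  }
  where
  add : ∀ i j → coeff p i ⊑ coeff p j → coeff q i ⊑ coeff q j → coeff (addP p q) i ⊑ coeff (addP p q) j
  add i j le le′ rewrite coeff-addP p q i | coeff-addP p q j = ℤₚ.+-mono-≤ le le′

-- Multiplication by the variable moves the centre by one, hence the doubled centre `n` by two.
unimodal-shift : ∀ {n p} → SymmetricUnimodal n p → SymmetricUnimodal (suc (suc n)) (+ 0 ∷ p)
unimodal-shift {n} {p} u = record
  { increasing = inc
  ; decreasing = dec
  ; vanishing  = λ { (suc j) (s≤s lt) → vanishing u j (ℕₚ.<-trans (ℕₚ.n<1+n n) lt) }
  ; nonneg     = non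
  }
  where
  non : ∀ i → + 0 ⊑ coeff (+ 0 ∷ p) i
  non zero    = ℤₚ.≤-refl
  non (suc i) = nonneg u i
  inc : ∀ i j → i ≤ j → i ℕ.+ j ≤ suc (suc n) → coeff (+ 0 ∷ p) i ⊑ coeff (+ 0 ∷ p) j
  inc zero    j       le       le′       = non j
  inc (suc i) (suc j) (s≤s le) (s≤s le′) = increasing u i j le (ℕ.s≤s⁻¹ (subst (_≤ suc n) (ℕₚ.+-suc i j) le′))
  dec : ∀ i j → i ≤ j → suc (suc n) ≤ i ℕ.+ j → coeff (+ 0 ∷ p) j ⊑ coeff (+ 0 ∷ p) i
  dec zero    (suc j) le       (s≤s le′) = ℤₚ.≤-reflexive (vanishing u j le′)
  dec (suc i) (suc j) (s≤s le) (s≤s le′) = decreasing u i j le (ℕ.s≤s⁻¹ (subst (suc n ≤_) (ℕₚ.+-suc i j) le′))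

onePlus : Poly → Poly
onePlus p = addP p (+ 0 ∷ p)

-- Compare u_i + u_{i-1} with u_j + u_{j-1} crosswise.
unimodal-onePlus : ∀ {n p} → SymmetricUnimodal n p → SymmetricUnimodal (suc n) (onePlus p)
unimodal-onePlus {n} {p} u = record
  { increasing = λ i j le le′ → move i j (inc i j le le′)
  ; decreasing = λ i j le le′ → move j i (dec i j le le′)
  ; vanishing  = λ { (suc j) (s≤s lt) → trans (coeff-addP p (+ 0 ∷ p) (suc j)) (cong₂ _+_ (vanishing u (suc j) (ℕₚ.m<n⇒m<1+n lt)) (vanishing u j lt)) }
  ; nonneg     = λ i → subst (λ z → + 0 ⊑ z) (≡-sym (coeff-addP p (+ 0 ∷ p) i)) (+-nonneg (nonneg u i) (prev-nonneg i))
  }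
  where
  c prev : ℕ → ℤ
  c = coeff p
  prev = coeff (+ 0 ∷ p)
  prev-nonneg : ∀ i → + 0 ⊑ prev i
  prev-nonneg zero    = ℤₚ.≤-refl
  prev-nonneg (suc i) = nonneg u i
  move : ∀ i j → c i + prev i ⊑ c j + prev j → coeff (onePlus p) i ⊑ coeff (onePlus p) j
  move i j le rewrite coeff-addP p (+ 0 ∷ p) i | coeff-addP p (+ 0 ∷ p) j = le
  cross : ∀ i j → c i ⊑ prev j → prev i ⊑ c j → c i + prev i ⊑ c j + prev j
  cross i j p q = ℤₚ.≤-trans (ℤₚ.+-mono-≤ p q) (ℤₚ.≤-reflexive (ℤₚ.+-comm (prev j) (c j)))
  inc : ∀ i j → i ≤ j → i ℕ.+ j ≤ suc n → c i + prev i ⊑ c j + prev j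
  inc i j le le′ with ℕₚ.m≤n⇒m<n∨m≡n le
  ... | inj₂ refl = ℤₚ.≤-refl
  inc zero    (suc j) le le′ | inj₁ lt = cross zero (suc j) (increasing u 0 j z≤n (ℕ.s≤s⁻¹ le′)) (nonneg u (suc j))
  inc (suc i) (suc j) le le′ | inj₁ (s≤s lt) = cross (suc i) (suc j)
    (increasing u (suc i) j lt (ℕ.s≤s⁻¹ (subst (_≤ suc n) (ℕₚ.+-suc (suc i) j) le′)))
    (increasing u i (suc j) (ℕₚ.≤-trans (ℕₚ.n≤1+n i) le) (ℕ.s≤s⁻¹ le′))
  dec : ∀ i j → i ≤ j → suc n ≤ i ℕ.+ j → c j + prev j ⊑ c i + prev i
  dec i j le le′ with ℕₚ.m≤n⇒m<n∨m≡n le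
  ... | inj₂ refl = ℤₚ.≤-refl
  dec zero    (suc j) le le′ | inj₁ lt = cross (suc j) zero (ℤₚ.≤-reflexive (vanishing u (suc j) le′)) (decreasing u 0 j z≤n (ℕ.s≤s⁻¹ le′))
  dec (suc i) (suc j) le le′ | inj₁ (s≤s lt) = cross (suc j) (suc i)
    (decreasing u i (suc j) (ℕₚ.≤-trans (ℕₚ.n≤1+n i) le) (ℕ.s≤s⁻¹ le′))
    (decreasing u (suc i) j lt (ℕ.s≤s⁻¹ (subst (suc n ≤_) (ℕₚ.+-suc (suc i) j) le′)))

-- 2 (1 + t) p  and  4 (t² + (2 + L) t + 1) p = 4 ((1 + t)² + L t) p
binomialStep : Poly → Poly
binomialStep p = scaleP (+ 2) (onePlus p)

quadraticStep : ℕ → Poly → Poly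
quadraticStep L p = scaleP (+ 4) (addP (onePlus (onePlus p)) (scaleP (+ L) (+ 0 ∷ p)))

palindromic : ℕ → ℕ → ℕ → Poly
palindromic L zero    zero    = + 1 ∷ []
palindromic L zero    (suc b) = quadraticStep L (palindromic L zero b)
palindromic L (suc a) b       = binomialStep (palindromic L a b)

-- Sums preserve the property only for a common centre. In the splitting `(1 + t)² + L t` of the
-- quadratic both parts are centred at 1, so no theorem about products of unimodal sequences is
-- required.
unimodal-palindromic : ∀ L a b → SymmetricUnimodal (a ℕ.+ (b ℕ.+ b)) (palindromic L a b)
unimodal-palindromic L zero    zero    = unimodal-one
unimodal-palindromic L zero    (suc b) = subst (λ n → SymmetricUnimodal n (palindromic L zero (suc b))) (cong suc (≡-sym (ℕₚ.+-suc b b)))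
  (unimodal-scale 4 (unimodal-add (unimodal-onePlus (unimodal-onePlus u)) (unimodal-scale L (unimodal-shift u))))
  where
  u : SymmetricUnimodal (b ℕ.+ b) (palindromic L zero b)
  u = unimodal-palindromic L zero b
unimodal-palindromic L (suc a) b       = unimodal-scale 2 (unimodal-onePlus (unimodal-palindromic L a b))

eval-onePlus : ∀ p t → eval (onePlus p) t ≡ (+ 1 + t) * eval p t
eval-onePlus p t = trans (eval-addP p (+ 0 ∷ p) t) (lem t (eval p t))
  where
  lem : ∀ t e → e + (+ 0 + t * e) ≡ (+ 1 + t) * e
  lem = solve-∀

eval-palindromic : ∀ L a b t →
  eval (palindromic L a b) t ≡ (+ 2 * t + + 2) ^ a * quad (+ 2 * t) (+ L) ^ b
eval-palindromic L zero    zero    t = cong (λ z → + 1 + z) (ℤₚ.*-zeroʳ t)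
eval-palindromic L zero    (suc b) t = begin
  eval (scaleP (+ 4) (addP (onePlus (onePlus p)) (scaleP (+ L) (+ 0 ∷ p)))) t
    ≡⟨ eval-scaleP (+ 4) (addP (onePlus (onePlus p)) (scaleP (+ L) (+ 0 ∷ p))) t ⟩
  + 4 * eval (addP (onePlus (onePlus p)) (scaleP (+ L) (+ 0 ∷ p))) t
    ≡⟨ cong (λ z → + 4 * z) (eval-addP (onePlus (onePlus p)) (scaleP (+ L) (+ 0 ∷ p)) t) ⟩
  + 4 * (eval (onePlus (onePlus p)) t + eval (scaleP (+ L) (+ 0 ∷ p)) t)
    ≡⟨ cong₂ (λ u v → + 4 * (u + v)) (trans (eval-onePlus (onePlus p) t) (cong (λ z → (+ 1 + t) * z) (eval-onePlus p t))) (eval-scaleP (+ L) (+ 0 ∷ p) t) ⟩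
  + 4 * ((+ 1 + t) * ((+ 1 + t) * eval p t) + + L * (+ 0 + t * eval p t))
    ≡⟨ cong (λ z → + 4 * ((+ 1 + t) * ((+ 1 + t) * z) + + L * (+ 0 + t * z))) (eval-palindromic L zero b t) ⟩
  + 4 * ((+ 1 + t) * ((+ 1 + t) * (+ 1 * q ^ b)) + + L * (+ 0 + t * (+ 1 * q ^ b)))
    ≡⟨ lem t (+ L) (q ^ b) ⟩
  + 1 * (q * q ^ b) ∎
  where
  open ≡-Reasoning
  p : Poly
  p = palindromic L zero b
  q : ℤ
  q = quad (+ 2 * t) (+ L)
  lem : ∀ t L e → + 4 * ((+ 1 + t) * ((+ 1 + t) * (+ 1 * e)) + L * (+ 0 + t * (+ 1 * e)))
    ≡ + 1 * ((+ 2 * t * (+ 2 * t + + 2) + + 2 * (+ 2 * t + + 2) + + 2 * L * (+ 2 * t)) * e)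
  lem = solve-∀
eval-palindromic L (suc a) b t = trans (eval-scaleP (+ 2) (onePlus (palindromic L a b)) t)
  (trans (cong (λ z → + 2 * z) (trans (eval-onePlus (palindromic L a b) t) (cong (λ z → (+ 1 + t) * z) (eval-palindromic L a b t))))
         (lem t ((+ 2 * t + + 2) ^ a) (quad (+ 2 * t) (+ L) ^ b)))
  where
  lem : ∀ t x y → + 2 * ((+ 1 + t) * (x * y)) ≡ (+ 2 * t + + 2) * x * y
  lem = solve-∀

-- Normalised coefficients and their peak

dilate : ℤ → Poly → Poly
dilate c []      = []
dilate c (a ∷ p) = a ∷ scaleP c (dilate c p)

eval-dilate : ∀ c p x → eval (dilate c p) x ≡ eval p (c * x)
eval-dilate c []      x = refl
eval-dilate c (a ∷ p) x = cong (λ z → a + z) (trans (cong (λ z → x * z) (trans (eval-scaleP c (dilate c p) x) (cong (λ z → c * z) (eval-dilate c p x))))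
  (lem x c (eval p (c * x))))
  where
  lem : ∀ x c e → x * (c * e) ≡ c * x * e
  lem = solve-∀

-- For `m = 2` these are the numerators of the normalised coefficients before absolute values are
-- taken; their denominator does not depend on the index.
coeff-dilate : ∀ m p i → coeff (dilate (+ m) p) i ≡ + (m ℕ.^ i) * coeff p i
coeff-dilate m []      i       = ≡-sym (ℤₚ.*-zeroʳ (+ (m ℕ.^ i)))
coeff-dilate m (a ∷ p) zero    = ≡-sym (ℤₚ.*-identityˡ a)
coeff-dilate m (a ∷ p) (suc i) = trans (coeff-scaleP (+ m) (dilate (+ m) p) i) (trans (cong (λ z → + m * z) (coeff-dilate m p i))
  (trans (≡-sym (ℤₚ.*-assoc (+ m) (+ (m ℕ.^ i)) (coeff p i))) (cong (λ z → z * coeff p i) (≡-sym (ℤₚ.pos-* m (m ℕ.^ i))))))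

abs-≤ : ∀ a b → + 0 ⊑ b + - a → + 0 ⊑ b + a → ∣ a ∣ ≤ ∣ b ∣
abs-≤ (+ m) b p q with nonneg-difference {+ m} {b} p
... | ℤ.+≤+ le = le
abs-≤ -[1+ m ] b p q with nonneg-difference {+ suc m} {b} q
... | ℤ.+≤+ le = le

-- With u peaked at the index b, the negative contribution -8 u_{j-3} is outweighed by the one of u_{j-2}.
module Peak (c₀ c₁ c₂ : ℤ) (0≤c₀ : + 0 ⊑ c₀) (0≤c₁ : + 0 ⊑ c₁) (0≤c₂-16 : + 0 ⊑ c₂ + - + 16)
            (b : ℕ) (p : Poly) (uni : SymmetricUnimodal (suc b ℕ.+ suc b) p) where

  product : Poly
  product = mulP (c₀ ∷ c₁ ∷ c₂ ∷ - + 8 ∷ []) p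

  private
    u e : ℕ → ℤ
    u = coeff p
    e = coeff product

  product-coeff : ∀ i → e (suc (suc (suc i))) ≡ c₀ * u (3 ℕ.+ i) + (c₁ * u (2 ℕ.+ i) + (c₂ * u (1 ℕ.+ i) + - + 8 * u i))
  product-coeff i = trans (step₁ c₀ _ (2 ℕ.+ i)) (cong (λ z → c₀ * u (3 ℕ.+ i) + z)
    (trans (step₁ c₁ _ (1 ℕ.+ i)) (cong (λ z → c₁ * u (2 ℕ.+ i) + z)
      (trans (step₁ c₂ _ i) (cong (λ z → c₂ * u (1 ℕ.+ i) + z) (trans (coeff-addP (scaleP (- + 8) p) (+ 0 ∷ []) i)
        (trans (cong₂ _+_ (coeff-scaleP (- + 8) p i) (zeros i)) (ℤₚ.+-identityʳ (- + 8 * u i)))))))))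
    where
    zeros : ∀ i → coeff (+ 0 ∷ []) i ≡ + 0
    zeros zero    = refl
    zeros (suc i) = refl
    step₁ : ∀ c q i → coeff (addP (scaleP c p) (+ 0 ∷ q)) (suc i) ≡ c * u (suc i) + coeff q i
    step₁ c q i = trans (coeff-addP (scaleP c p) (+ 0 ∷ q) (suc i)) (cong (λ z → z + coeff q i) (coeff-scaleP c p (suc i)))

  peak : ∀ a → u a ⊑ u (suc b)
  peak a with ℕₚ.≤-total (suc b) a
  ... | inj₁ le = decreasing uni (suc b) a le (ℕₚ.+-monoʳ-≤ (suc b) le)
  ... | inj₂ le = increasing uni a (suc b) le (ℕₚ.+-monoˡ-≤ (suc b) le)

  falling : ∀ i j → suc b ≤ i → i ≤ j → u j ⊑ u i
  falling i j le le′ = decreasing uni i j le′ (ℕₚ.+-mono-≤ le (ℕₚ.≤-trans le le′))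

  private
    -- The `U` are coefficients at the peak, the `V` those further right, and `U₁` is the maximum.
    -- For the difference, 8 of `c₂` pays for `U₀ - V₀` by means of the last hypothesis; for the
    -- sum, `U₁` has to pay for `8 U₀` and `8 V₀` together, which is where 16 comes from.
    bound : ∀ U₃ U₂ U₁ U₀ V₃ V₂ V₁ V₀ →
      + 0 ⊑ V₃ → + 0 ⊑ V₂ → + 0 ⊑ V₁ → V₃ ⊑ U₃ → V₂ ⊑ U₂ → V₁ ⊑ U₁ → V₀ ⊑ U₁ → U₀ ⊑ U₁ → U₀ + - V₀ ⊑ U₁ + - V₁ →
      ∣ c₀ * V₃ + (c₁ * V₂ + (c₂ * V₁ + - + 8 * V₀)) ∣ ≤ ∣ c₀ * U₃ + (c₁ * U₂ + (c₂ * U₁ + - + 8 * U₀)) ∣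
    bound U₃ U₂ U₁ U₀ V₃ V₂ V₁ V₀ n₃ n₂ n₁ p₃ p₂ p₁ p₀ q₀ r = abs-≤
      (c₀ * V₃ + (c₁ * V₂ + (c₂ * V₁ + - + 8 * V₀))) (c₀ * U₃ + (c₁ * U₂ + (c₂ * U₁ + - + 8 * U₀)))
      (subst (λ z → + 0 ⊑ z) (≡-sym (lem c₀ c₁ c₂ U₃ U₂ U₁ U₀ V₃ V₂ V₁ V₀))
        (+-nonneg (*-nonneg 0≤c₀ (difference-nonneg p₃)) (+-nonneg (*-nonneg 0≤c₁ (difference-nonneg p₂))
          (+-nonneg (*-nonneg 0≤c₂-8 (difference-nonneg p₁)) (*-nonneg (natural-nonneg 8) (difference-nonneg r))))))
      (subst (λ z → + 0 ⊑ z) (≡-sym (lem′ c₀ c₁ c₂ U₃ U₂ U₁ U₀ V₃ V₂ V₁ V₀))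
        (+-nonneg (*-nonneg 0≤c₀ (+-nonneg (ℤₚ.≤-trans n₃ p₃) n₃)) (+-nonneg (*-nonneg 0≤c₁ (+-nonneg (ℤₚ.≤-trans n₂ p₂) n₂))
          (+-nonneg (*-nonneg 0≤c₂-16 (ℤₚ.≤-trans n₁ p₁)) (+-nonneg (*-nonneg 0≤c₂ n₁)
            (*-nonneg (natural-nonneg 8) (+-nonneg (difference-nonneg q₀) (difference-nonneg p₀))))))))
      where
      0≤c₂-8 : + 0 ⊑ c₂ + - + 8
      0≤c₂-8 = subst (λ z → + 0 ⊑ z) (lem c₂) (+-nonneg 0≤c₂-16 (natural-nonneg 8))
        where
        lem : ∀ c → c + - + 16 + + 8 ≡ c + - + 8
        lem = solve-∀
      0≤c₂ : + 0 ⊑ c₂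
      0≤c₂ = subst (λ z → + 0 ⊑ z) (lem c₂) (+-nonneg 0≤c₂-16 (natural-nonneg 16))
        where
        lem : ∀ c → c + - + 16 + + 16 ≡ c
        lem = solve-∀
      lem : ∀ c₀ c₁ c₂ U₃ U₂ U₁ U₀ V₃ V₂ V₁ V₀ →
        (c₀ * U₃ + (c₁ * U₂ + (c₂ * U₁ + - + 8 * U₀))) + - (c₀ * V₃ + (c₁ * V₂ + (c₂ * V₁ + - + 8 * V₀)))
        ≡ c₀ * (U₃ + - V₃) + (c₁ * (U₂ + - V₂) + ((c₂ + - + 8) * (U₁ + - V₁) + + 8 * ((U₁ + - V₁) + - (U₀ + - V₀))))
      lem = solve-∀
      lem′ : ∀ c₀ c₁ c₂ U₃ U₂ U₁ U₀ V₃ V₂ V₁ V₀ →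
        (c₀ * U₃ + (c₁ * U₂ + (c₂ * U₁ + - + 8 * U₀))) + (c₀ * V₃ + (c₁ * V₂ + (c₂ * V₁ + - + 8 * V₀)))
        ≡ c₀ * (U₃ + V₃) + (c₁ * (U₂ + V₂) + ((c₂ + - + 16) * U₁ + (c₂ * V₁ + + 8 * ((U₁ + - U₀) + (U₁ + - V₀)))))
      lem′ = solve-∀

  -- At index `3 + b` the window of four coefficients starts just before the maximum `u (suc b)`, so
  -- the terms with `c₀`, `c₁` and `c₂` do not grow when it moves right. Earlier indices may be
  -- larger; only an upper bound on the peak is sought.
  beyond-peak : ∀ r → ∣ e (3 ℕ.+ (r ℕ.+ b)) ∣ ≤ ∣ e (3 ℕ.+ b) ∣
  beyond-peak r rewrite product-coeff (r ℕ.+ b) | product-coeff b =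
    bound (u (3 ℕ.+ b)) (u (2 ℕ.+ b)) (u (1 ℕ.+ b)) (u b) (u (3 ℕ.+ i)) (u (2 ℕ.+ i)) (u (1 ℕ.+ i)) (u i)
      (nonneg uni _) (nonneg uni _) (nonneg uni _)
      (falling (3 ℕ.+ b) (3 ℕ.+ i) (ℕₚ.m≤n+m (suc b) 2) (s≤s (s≤s (s≤s b≤i))))
      (falling (2 ℕ.+ b) (2 ℕ.+ i) (ℕₚ.m≤n+m (suc b) 1) (s≤s (s≤s b≤i)))
      (peak (1 ℕ.+ i)) (peak i) (peak b) (last r)
    where
    i : ℕ
    i = r ℕ.+ b
    b≤i : b ≤ i
    b≤i = ℕₚ.m≤n+m b r
    -- Without a shift both differences are zero. Otherwise the step from `b` to the maximum goes
    -- up, while the step at the shifted place lies to the right of the maximum and goes down.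
    last : ∀ r → u b + - u (r ℕ.+ b) ⊑ u (suc b) + - u (suc (r ℕ.+ b))
    last zero    = ℤₚ.≤-reflexive (trans (ℤₚ.+-inverseʳ (u b)) (≡-sym (ℤₚ.+-inverseʳ (u (suc b)))))
    last (suc r) = ℤₚ.+-mono-≤ (peak b) (ℤₚ.neg-mono-≤ (falling (suc (r ℕ.+ b)) (suc (suc (r ℕ.+ b))) (s≤s (ℕₚ.m≤n+m b r)) (ℕₚ.n≤1+n _)))

-- Locating the maximum of a rational sequence

mutual
  loopℚ : (x : ℚ) (xs : List ℚ) (bi : ℕ) (bv : ℚ) (i : ℕ) → List ℚ → ℕ
  loopℚ = _

  loopℚ-spec : ∀ x y ys → argmaxℚ (x ∷ y ∷ ys)
    ≡ (if not (y ℚ.≤ᵇ x) then loopℚ x (y ∷ ys) 1 y 2 ys else loopℚ x (y ∷ ys) 0 x 2 ys)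
  loopℚ-spec x y ys with y ∷ ys | 2 | 1 | 0
  ... | zs | two | one | nil = refl

module _ (g : ℕ → ℚ) (m : ℕ) (max : ∀ j → m ≤ j → g j ℚ.≤ g m) where

  private
    tail-values : ∀ i (h : ℕ → ℚ) → (∀ j → h j ≡ g (i ℕ.+ j)) → ∀ j → h (suc j) ≡ g (suc i ℕ.+ j)
    tail-values i h eq j = trans (eq (suc j)) (cong g (ℕₚ.+-suc i j))

    head-value : ∀ i (h : ℕ → ℚ) → (∀ j → h j ≡ g (i ℕ.+ j)) → h 0 ≡ g i
    head-value i h eq = trans (eq 0) (cong g (ℕₚ.+-identityʳ i))

  -- Before m is passed, the current index is at most m; afterwards the current value is at least g m.
  loopℚ-bound : ∀ x xs n bi bv i h → (∀ j → h j ≡ g (i ℕ.+ j)) → bi ≤ m → (m < i → g m ℚ.≤ bv) →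
    loopℚ x xs bi bv i (applyUpTo h n) ≤ m
  loopℚ-bound x xs zero    bi bv i h eq bi≤m passed = bi≤m
  loopℚ-bound x xs (suc n) bi bv i h eq bi≤m passed with h 0 ℚ.≤ᵇ bv in test
  ... | true  = loopℚ-bound x xs n bi bv (suc i) (λ j → h (suc j)) (tail-values i h eq) bi≤m passed′
    where
    passed′ : m < suc i → g m ℚ.≤ bv
    passed′ lt with ℕₚ.m≤n⇒m<n∨m≡n (ℕ.s≤s⁻¹ lt)
    ... | inj₁ m<i  = passed m<i
    ... | inj₂ refl = subst (λ z → z ℚ.≤ bv) (head-value i h eq) (ℚₚ.≤ᵇ⇒≤ (subst T (≡-sym test) tt))
  ... | false with ℕₚ.≤-<-connex i m
  ...   | inj₁ i≤m = loopℚ-bound x xs n i (h 0) (suc i) (λ j → h (suc j)) (tail-values i h eq) i≤m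
          (λ lt → ℚₚ.≤-reflexive (trans (cong g (ℕₚ.≤-antisym (ℕ.s≤s⁻¹ lt) i≤m)) (≡-sym (head-value i h eq))))
  ...   | inj₂ m<i = contradiction
          (subst T test (ℚₚ.≤⇒≤ᵇ (subst (λ z → z ℚ.≤ bv) (≡-sym (head-value i h eq))
            (ℚₚ.≤-trans (max i (ℕₚ.<⇒≤ m<i)) (passed m<i)))))
          (λ ())

  -- The search replaces its candidate only by a strictly larger value, so a value after `m`, being
  -- at most `g m`, is never chosen once `m` has been seen.
  argmaxℚ-bound : ∀ n → argmaxℚ (map g (upTo (suc n))) ≤ m
  argmaxℚ-bound n = subst (λ xs → argmaxℚ (g 0 ∷ xs) ≤ m) (≡-sym (Listₚ.map-applyUpTo suc g n))
    (loopℚ-bound (g 0) (applyUpTo (λ j → g (suc j)) n) n 0 (g 0) 1 (λ j → g (suc j)) (λ j → refl) z≤n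
      (λ { (s≤s z≤n) → ℚₚ.≤-refl }))

fraction-≤ : ∀ i j d e → i * + suc e ⊑ j * + suc d → i ℚ./ suc d ℚ.≤ j ℚ./ suc e
fraction-≤ i j d e le = ℚₚ.toℚᵘ-cancel-≤ (ℚᵘₚ.≤-respˡ-≃ (ℚᵘₚ.≃-sym (ℚₚ.toℚᵘ-fromℚᵘ (ℚᵘ.mkℚᵘ i d)))
  (ℚᵘₚ.≤-respʳ-≃ (ℚᵘₚ.≃-sym (ℚₚ.toℚᵘ-fromℚᵘ (ℚᵘ.mkℚᵘ j e))) (ℚᵘ.*≤* le)))

frac-mono : ∀ m n d → m ≤ n → frac (+ m) d ℚ.≤ frac (+ n) d
frac-mono m n zero    le = ℚₚ.≤-refl
frac-mono m n (suc d) le = fraction-≤ (+ m) (+ n) d d (ℤₚ.*-monoʳ-≤-nonNeg (+ suc d) (ℤ.+≤+ le))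

-- The family of trees and its distance peak

-^-even : ∀ a m → (- a) ^ (m ℕ.+ m) ≡ a ^ (m ℕ.+ m)
-^-even a zero    = refl
-^-even a (suc m) rewrite ℕₚ.+-suc m m = trans (cong (λ z → - a * (- a * z)) (-^-even a m)) (lem a (a ^ (m ℕ.+ m)))
  where
  lem : ∀ a p → - a * (- a * p) ≡ a * (a * p)
  lem = solve-∀

-- k + 1 hubs, each with 2m + 1 leaves: the parity makes the power of - (x + 2) in the determinant positive.
module Family (k m : ℕ) (1≤m : 1 ≤ m) (2≤k : 2 ≤ k) where
  M′ L b : ℕ
  M′ = m ℕ.+ m
  L = suc M′
  -- 2 (b + 1) is the degree of the palindromic factor of the characteristic polynomial
  b = ℕ.pred (m ℕ.* suc k ℕ.+ k)
  T′ : Tree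
  T′ = tree (suc k) L
  K : ℤ
  K = + suc k

  suc-b : suc b ≡ m ℕ.* suc k ℕ.+ k
  suc-b = ℕₚ.suc-pred (m ℕ.* suc k ℕ.+ k) {{ℕ.>-nonZero (ℕₚ.≤-trans (ℕₚ.≤-trans (s≤s z≤n) 2≤k) (ℕₚ.m≤n+m k (m ℕ.* suc k)))}}

  -- The number of vertices is the degree of the characteristic polynomial: 3 from the cubic and the
  -- rest from the palindromic factor.
  size : N T′ ≡ 3 ℕ.+ (suc b ℕ.+ suc b)
  size = trans (cong suc (clusters-length (suc k) L)) (trans (lem k m) (cong (λ z → 3 ℕ.+ (z ℕ.+ z)) (≡-sym suc-b)))
    where
    lem : ∀ k m → 1 ℕ.+ (1 ℕ.+ k) ℕ.* (1 ℕ.+ (1 ℕ.+ (m ℕ.+ m))) ≡ 3 ℕ.+ (m ℕ.* (1 ℕ.+ k) ℕ.+ k ℕ.+ (m ℕ.* (1 ℕ.+ k) ℕ.+ k))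
    lem = ℕSolver.solve-∀

  4≤N : 4 ≤ N T′
  4≤N = subst (4 ≤_) (≡-sym size) (s≤s (s≤s (s≤s (s≤s z≤n))))

  -- The coefficients of `cubic` after the substitution `x = 2t`, which multiplies them by 1, 2 and
  -- 4; the leading `- x³` becomes the `- 8` of `Peak`.
  c₀ c₁ c₂ : ℤ
  c₀ = + 2 * K * (+ L + + 1)
  c₁ = + 2 * (K * K * + L + + 4 * K * + L + + 5 * K + - + 4)
  c₂ = + 4 * (+ 4 * K * + L + + 2 * K + - (+ 2 * + L) + - + 4)

  U : Poly
  U = palindromic L (M′ ℕ.* suc k) k

  uni : SymmetricUnimodal (suc b ℕ.+ suc b) U
  uni = subst (λ n → SymmetricUnimodal n U) (trans (lem k m) (cong (λ z → z ℕ.+ z) (≡-sym suc-b))) (unimodal-palindromic L (M′ ℕ.* suc k) k)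
    where
    lem : ∀ k m → (m ℕ.+ m) ℕ.* (1 ℕ.+ k) ℕ.+ (k ℕ.+ k) ≡ m ℕ.* (1 ℕ.+ k) ℕ.+ k ℕ.+ (m ℕ.* (1 ℕ.+ k) ℕ.+ k)
    lem = ℕSolver.solve-∀

  0≤c₀ : + 0 ⊑ c₀
  0≤c₀ = *-nonneg (*-nonneg (natural-nonneg 2) (natural-nonneg (suc k))) (+-nonneg (natural-nonneg L) (natural-nonneg 1))

  0≤c₁ : + 0 ⊑ c₁
  0≤c₁ = subst (λ z → + 0 ⊑ z) (lem (+ k) (+ L))
    (*-nonneg (natural-nonneg 2) (+-nonneg (+-nonneg (*-nonneg (*-nonneg K≥0 K≥0) L≥0) (*-nonneg (*-nonneg (natural-nonneg 4) K≥0) L≥0))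
      (+-nonneg (*-nonneg (natural-nonneg 5) (natural-nonneg k)) (natural-nonneg 1))))
    where
    K≥0 : + 0 ⊑ K
    K≥0 = natural-nonneg (suc k)
    L≥0 : + 0 ⊑ + L
    L≥0 = natural-nonneg L
    lem : ∀ k L → + 2 * ((+ 1 + k) * (+ 1 + k) * L + + 4 * (+ 1 + k) * L + (+ 5 * k + + 1))
      ≡ + 2 * ((+ 1 + k) * (+ 1 + k) * L + + 4 * (+ 1 + k) * L + + 5 * (+ 1 + k) + - + 4)
    lem = solve-∀

  0≤c₂-16 : + 0 ⊑ c₂ + - + 16
  -- Written in `k` and `M′ = L - 1`, the subtracted terms are absorbed and `c₂ - 16` is visibly
  -- nonnegative as soon as `k` is at least 1.
  0≤c₂-16 = subst (λ z → + 0 ⊑ z) (lem (+ k) (+ M′))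
    (+-nonneg (*-nonneg (natural-nonneg 8) (+-nonneg (+-nonneg (*-nonneg (natural-nonneg 2) (*-nonneg (natural-nonneg k) (natural-nonneg M′))) (natural-nonneg M′))
        (*-nonneg (natural-nonneg 3) (difference-nonneg {+ 1} {+ k} (ℤ.+≤+ (ℕₚ.≤-trans (s≤s z≤n) 2≤k))))))
      (natural-nonneg 8))
    where
    lem : ∀ k M → + 8 * (+ 2 * (k * M) + M + + 3 * (k + - + 1)) + + 8
      ≡ + 4 * (+ 4 * (+ 1 + k) * (+ 1 + M) + + 2 * (+ 1 + k) + - (+ 2 * (+ 1 + M)) + - + 4) + - + 16
    lem = solve-∀

  open Peak c₀ c₁ c₂ 0≤c₀ 0≤c₁ 0≤c₂-16 b U uni

  -- Among the cancelled multipliers only `corner`, which equals `x (q - K (x + 2 + 2 L x))`, has a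
  -- negative part. From `t = K (1 + 2 L)` on, the square in `q` outweighs it.
  threshold : ℕ
  threshold = suc k ℕ.* (1 ℕ.+ (L ℕ.+ L))

  eval-CPD-product : ∀ t → threshold ≤ t → eval (dilate (+ 2) (CPD T′)) (+ t) ≡ eval product (+ t)
  eval-CPD-product t le = begin
    eval (dilate (+ 2) (CPD T′)) (+ t)
      ≡⟨ eval-dilate (+ 2) (CPD T′) (+ t) ⟩
    eval (CPD T′) x
      ≡⟨ eval-CPD (suc k) L x 4≤N ⟩
    listDet (charD x) (vertices (suc k) L)
      ≡⟨ distance-det x k M′ x≢0 y≢0 q≢0 corner≢0 ⟩
    cubic x K (+ L) * (((- (x + + 2)) ^ M′) ^ suc k * quad x (+ L) ^ k)
      ≡⟨ cong (λ z → cubic x K (+ L) * (z * quad x (+ L) ^ k))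
           (trans (cong (λ z → z ^ suc k) (-^-even (x + + 2) m)) (ℤₚ.^-*-assoc (x + + 2) M′ (suc k))) ⟩
    cubic x K (+ L) * ((x + + 2) ^ (M′ ℕ.* suc k) * quad x (+ L) ^ k)
      ≡⟨ cong₂ _*_ (expand (+ t) K (+ L)) (≡-sym (eval-palindromic L (M′ ℕ.* suc k) k (+ t))) ⟩
    eval (c₀ ∷ c₁ ∷ c₂ ∷ - + 8 ∷ []) (+ t) * eval U (+ t)
      ≡⟨ eval-mulP (c₀ ∷ c₁ ∷ c₂ ∷ - + 8 ∷ []) U (+ t) ⟨
    eval product (+ t) ∎
    where
    open ≡-Reasoning
    x z : ℤ
    x = + 2 * + t
    z = + t + - + threshold
    0≤z : + 0 ⊑ z
    0≤z = difference-nonneg (ℤ.+≤+ le)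
    0≤x : + 0 ⊑ x
    0≤x = *-nonneg (natural-nonneg 2) (natural-nonneg t)
    expand : ∀ t k L → + 2 * k * (L + + 1) + + 2 * t * ((k * k * L + + 4 * k * L + + 5 * k + - + 4) + + 2 * t * ((+ 4 * k * L + + 2 * k + - (+ 2 * L) + - + 4) + + 2 * t * - + 1))
      ≡ + 2 * k * (L + + 1) + t * (+ 2 * (k * k * L + + 4 * k * L + + 5 * k + - + 4) + t * (+ 4 * (+ 4 * k * L + + 2 * k + - (+ 2 * L) + - + 4) + t * (- + 8 + t * + 0)))
    expand = solve-∀
    y≢0 : ∀ l → (x + + 2) + + 2 * + l ≢ + 0
    y≢0 l = nonneg-shifted {c = x + + 2 * + l} 1 (+-nonneg 0≤x (*-nonneg (natural-nonneg 2) (natural-nonneg l))) (lem x (+ l))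
      where
      lem : ∀ x l → (x + + 2) + + 2 * l ≡ x + + 2 * l + + 2
      lem = solve-∀
    q≢0 : quad x (+ L) ≢ + 0
    q≢0 = nonneg-shifted {c = x * x + + 4 * x + + 2 * + L * x} 3
      (+-nonneg (+-nonneg (*-nonneg 0≤x 0≤x) (*-nonneg (natural-nonneg 4) 0≤x)) (*-nonneg (*-nonneg (natural-nonneg 2) (natural-nonneg L)) 0≤x))
      (lem x (+ L))
      where
      lem : ∀ x L → x * (x + + 2) + + 2 * (x + + 2) + + 2 * L * x ≡ x * x + + 4 * x + + 2 * L * x + + 4
      lem = solve-∀
    x≢0 : x ≢ + 0
    x≢0 e = ℕₚ.<⇒≢ (ℕₚ.≤-trans (s≤s z≤n) le) (≡-sym (ℤₚ.+-injective (cancel-nonzero (+ 2) {+ t} {+ 0} (λ ()) e)))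
    threshold-value : + threshold ≡ K * (+ 1 + (+ L + + L))
    threshold-value = ℤₚ.pos-* (suc k) (1 ℕ.+ (L ℕ.+ L))
    t-value : + t ≡ K * (+ 1 + (+ L + + L)) + z
    t-value = trans (lem (+ t) (+ threshold)) (cong (λ w → w + z) threshold-value)
      where
      lem : ∀ a b → a ≡ b + (a + - b)
      lem = solve-∀
    factor : ℤ
    factor = quad x (+ L) + - (K * (x + + 2 + + 2 * + L * x))
    factor≢0 : factor ≢ + 0
    -- With `z = t - K (1 + 2 L)` and `x = 2t`, the difference `x - K (1 + 2 L)` is `t + z`. Half of
    -- `4 x = 8 t` is kept, and the other half absorbs `- 2 K`; all remaining terms are nonnegative
    -- and a constant 4 is left over.
    factor≢0 = nonneg-shifted {c = x * (+ t + z) + + 2 * + L * x + + 4 * + t + + 2 * (+ t + z + K * + L + K * + L)} 3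
      (+-nonneg (+-nonneg (+-nonneg (*-nonneg 0≤x (+-nonneg (natural-nonneg t) 0≤z)) (*-nonneg (*-nonneg (natural-nonneg 2) (natural-nonneg L)) 0≤x))
          (*-nonneg (natural-nonneg 4) (natural-nonneg t)))
        (*-nonneg (natural-nonneg 2) (+-nonneg (+-nonneg (+-nonneg (natural-nonneg t) 0≤z) KL≥0) KL≥0)))
      (subst (λ w → factorOf w ≡ boundOf w) (≡-sym t-value) (lem K (+ L) z))
      where
      KL≥0 : + 0 ⊑ K * + L
      KL≥0 = *-nonneg (natural-nonneg (suc k)) (natural-nonneg L)
      factorOf boundOf : ℤ → ℤ
      factorOf w = quad (+ 2 * w) (+ L) + - (K * (+ 2 * w + + 2 + + 2 * + L * (+ 2 * w)))
      boundOf w = + 2 * w * (w + z) + + 2 * + L * (+ 2 * w) + + 4 * w + + 2 * (w + z + K * + L + K * + L) + + 4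
      lem : ∀ K L z → + 2 * (K * (+ 1 + (L + L)) + z) * (+ 2 * (K * (+ 1 + (L + L)) + z) + + 2) + + 2 * (+ 2 * (K * (+ 1 + (L + L)) + z) + + 2) + + 2 * L * (+ 2 * (K * (+ 1 + (L + L)) + z))
           + - (K * (+ 2 * (K * (+ 1 + (L + L)) + z) + + 2 + + 2 * L * (+ 2 * (K * (+ 1 + (L + L)) + z))))
        ≡ + 2 * (K * (+ 1 + (L + L)) + z) * ((K * (+ 1 + (L + L)) + z) + z) + + 2 * L * (+ 2 * (K * (+ 1 + (L + L)) + z)) + + 4 * (K * (+ 1 + (L + L)) + z)
           + + 2 * ((K * (+ 1 + (L + L)) + z) + z + K * L + K * L) + + 4
      lem = solve-∀
    corner≢0 : corner x K (+ L) ≢ + 0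
    corner≢0 e = factor≢0 (cancel-nonzero x x≢0 (trans (≡-sym (lem x K (+ L))) (trans e (≡-sym (ℤₚ.*-zeroʳ x)))))
      where
      lem : ∀ x k L →
        x * (x * (x + + 2) + + 2 * (x + + 2) + + 2 * L * x) + - (+ 0 * (x * (x + + 2) + + 2 * (x + + 2) + + 2 * L * x) + k * (+ 1 * (x * (x + + 2)) + L * (+ 2 * (x * x))))
        ≡ x * ((x * (x + + 2) + + 2 * (x + + 2) + + 2 * L * x) + - (k * (x + + 2 + + 2 * L * x)))
      lem = solve-∀

  dcoeff-product : ∀ j → 2 ℕ.^ j ℕ.* ∣ coeff (CPD T′) j ∣ ≡ ∣ coeff product j ∣
  dcoeff-product j = trans (≡-sym (ℤₚ.abs-* (+ (2 ℕ.^ j)) (coeff (CPD T′) j)))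
    (cong ∣_∣ (trans (≡-sym (coeff-dilate 2 (CPD T′) j)) (eventually-equal (dilate (+ 2) (CPD T′)) product threshold eval-CPD-product j)))

  dcoeff-bound : ∀ j → 3 ℕ.+ b ≤ j → dcoeff T′ j ℚ.≤ dcoeff T′ (3 ℕ.+ b)
  dcoeff-bound j le = frac-mono _ _ (2 ℕ.^ (N T′ ∸ 2))
    (subst₂ _≤_ (≡-sym (dcoeff-product j)) (≡-sym (dcoeff-product (3 ℕ.+ b)))
      (subst (λ i → ∣ coeff product i ∣ ≤ ∣ coeff product (3 ℕ.+ b) ∣) index (beyond-peak (j ∸ (3 ℕ.+ b)))))
    where
    index : 3 ℕ.+ (j ∸ (3 ℕ.+ b) ℕ.+ b) ≡ j
    index = trans (lem (j ∸ (3 ℕ.+ b)) b) (ℕₚ.m∸n+n≡m le)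
      where
      lem : ∀ r b → 3 ℕ.+ (r ℕ.+ b) ≡ r ℕ.+ (3 ℕ.+ b)
      lem = ℕSolver.solve-∀

  -- The palindromic factor is centred at `suc b` and the cubic shifts the peak by at most two more
  -- places. By `nD-value` the resulting index is exactly half the number of terms.
  pD-bound : pD T′ ≤ 3 ℕ.+ b
  pD-bound = argmaxℚ-bound (dcoeff T′) (3 ℕ.+ b) dcoeff-bound (N T′ ∸ 2)

  nD-value : nD T′ ≡ 2 ℕ.* (3 ℕ.+ b)
  nD-value = trans (cong suc size) (lem b)
    where
    lem : ∀ b → 1 ℕ.+ (3 ℕ.+ (1 ℕ.+ b ℕ.+ (1 ℕ.+ b))) ≡ 2 ℕ.* (3 ℕ.+ b)
    lem = ℕSolver.solve-∀

-- The lower bound for f and the sequence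

half-bound : ∀ p c → p ≤ suc c → frac (+ p) (2 ℕ.* suc c) ℚ.≤ ℚ.½
half-bound p c le = fraction-≤ (+ p) (+ 1) (c ℕ.+ suc (c ℕ.+ 0)) 1
  (subst₂ _⊑_ (ℤₚ.pos-* p 2) (≡-sym (ℤₚ.*-identityˡ (+ suc (c ℕ.+ suc (c ℕ.+ 0)))))
    (ℤ.+≤+ (ℕₚ.≤-trans (ℕₚ.*-monoˡ-≤ 2 le) (ℕₚ.≤-reflexive (ℕₚ.*-comm (suc c) 2)))))

fifth-bound : ∀ m → 5 ≤ suc m → frac (+ 1) (suc m) ℚ.≤ + 1 ℚ./ 5
fifth-bound m le = fraction-≤ (+ 1) (+ 1) m 4 (ℤₚ.*-monoˡ-≤-nonNeg (+ 1) (ℤ.+≤+ le))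

p≤∣p∣ : ∀ p → p ℚ.≤ ℚ.∣ p ∣
p≤∣p∣ p with ℚₚ.≤-total ℚ.0ℚ p
... | inj₁ 0≤p = ℚₚ.≤-reflexive (≡-sym (ℚₚ.0≤p⇒∣p∣≡p 0≤p))
... | inj₂ p≤0 = ℚₚ.≤-trans p≤0 (ℚₚ.0≤∣p∣ p)

-- The quantity inside the absolute value increases with both `p` and `q`, so upper bounds suffice:
-- it is at most 1/5 - 1/2, hence its negation is at least 3/10.
gap : ∀ p q → p ℚ.≤ + 1 ℚ./ 5 → q ℚ.≤ ℚ.½ → + 3 ℚ./ 10 ℚ.≤ ℚ.∣ p ℚ.- (ℚ.1ℚ ℚ.- q) ∣
gap p q p≤ q≤ = begin
  + 3 ℚ./ 10                                        ≡⟨⟩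
  ℚ.- (+ 1 ℚ./ 5 ℚ.- (ℚ.1ℚ ℚ.- ℚ.½))                ≤⟨ ℚₚ.neg-antimono-≤ (ℚₚ.+-mono-≤ p≤ (ℚₚ.neg-antimono-≤ (ℚₚ.+-monoʳ-≤ ℚ.1ℚ (ℚₚ.neg-antimono-≤ q≤)))) ⟩
  ℚ.- (p ℚ.- (ℚ.1ℚ ℚ.- q))                          ≤⟨ p≤∣p∣ _ ⟩
  ℚ.∣ ℚ.- (p ℚ.- (ℚ.1ℚ ℚ.- q)) ∣                    ≡⟨ ℚₚ.∣-p∣≡∣p∣ _ ⟩
  ℚ.∣ p ℚ.- (ℚ.1ℚ ℚ.- q) ∣                          ∎
  where open ℚₚ.≤-Reasoning

f-lower : ∀ T {m c} → pA T ≡ 1 → mA T ≡ suc m → 5 ≤ suc m → nD T ≡ 2 ℕ.* suc c → pD T ≤ suc c → + 3 ℚ./ 10 ℚ.≤ f T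
f-lower T {m} {c} eA em 5≤m en le = gap (frac (+ pA T) (mA T)) (frac (+ pD T) (nD T))
  (subst₂ (λ p m → frac (+ p) m ℚ.≤ + 1 ℚ./ 5) (≡-sym eA) (≡-sym em) (fifth-bound m 5≤m))
  (subst (λ n → frac (+ pD T) n ℚ.≤ ℚ.½) (≡-sym en) (half-bound (pD T) c le))

module _ (k : ℕ) where
  private
    κ : ℕ
    -- The adjacency polynomial has `κ + 2` nonzero coefficients, and 3 is the least offset that
    -- makes this at least 5. Using `κ` for both parameters gives `κ + 1` hubs with `2 κ + 1` leaves
    -- each, an odd number not below the number of hubs.
    κ = 3 ℕ.+ k
    open Family κ κ (s≤s z≤n) (s≤s (s≤s z≤n))
    small : suc κ ≤ L
    small = s≤s (ℕₚ.m≤m+n κ κ)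

  sequence : Tree
  sequence = T′

  mA-sequence : mA sequence ≡ 5 ℕ.+ k
  mA-sequence = mA-tree κ M′ small

  k≤nD : k ≤ nD sequence
  k≤nD = subst (k ≤_) (≡-sym nD-value) (begin
    k                    ≤⟨ ℕₚ.m≤n+m k 3 ⟩
    κ                    ≤⟨ ℕₚ.m≤n+m κ (κ ℕ.* suc κ) ⟩
    κ ℕ.* suc κ ℕ.+ κ    ≡⟨ suc-b ⟨
    suc b                ≤⟨ ℕₚ.m≤n+m (suc b) 2 ⟩
    3 ℕ.+ b              ≤⟨ ℕₚ.m≤n*m (3 ℕ.+ b) 2 ⟩
    2 ℕ.* (3 ℕ.+ b)      ∎)
    where open ℕₚ.≤-Reasoning

  f-bound : + 3 ℚ./ 10 ℚ.≤ f sequence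
  f-bound = f-lower sequence {4 ℕ.+ k} {2 ℕ.+ b} (pA-tree κ M′ small) mA-sequence (ℕₚ.m≤m+n 5 k) nD-value pD-bound

mainTheorem1 : ∃ λ (T : ℕ → Tree) →
    (∀ B → ∃ λ K → ∀ k → K ≤ k → B ≤ nD (T k))
    × (∀ B → ∃ λ K → ∀ k → K ≤ k → B ≤ mA (T k))
    × (∀ k → (+ 3 ℚ./ 10) ℚ.≤ f (T k))
mainTheorem1 = sequence
  , (λ B → B , λ k B≤k → ℕₚ.≤-trans B≤k (k≤nD k))
  , (λ B → B , λ k B≤k → subst (B ≤_) (≡-sym (mA-sequence k)) (ℕₚ.≤-trans B≤k (ℕₚ.m≤n+m k 5)))
  , f-bound
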